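{- Let $$E(x,y,z)=\sum_{n\ge0}\sum_{m\ge0}\sum_{t\ge0}\bigl|\mathcal{IS}_{n,t}^{(m)}(102,000)\bigr|\,z^ty^mx^n,$$ where $\mathcal{IS}_{n,t}^{(m)}(102,000)$ is the set of $(102,000)$-avoiding inversion sequences $e$ of length $n$ with $\operatorname{dist}(e)=m$ and $\operatorname{rank}(e)=t$. Then $E$ is algebraic over $\mathbb{Q}(x,y,z)$ with minimal polynomial (in the variable $T$) $$\begin{aligned} 1&-\bigl(1-2yx(1-x)z+y(1-x)^2(1-z)\bigr)T\\ &+y\bigl(2x^2z^2+x(1-x)(2z^2-6z+3)+yx^2(1-x)^2z^2+(1-x)^2(1-z)-yx(1-x)^3(1-z)\bigr)T^2\\ &+yx\bigl(2yx^2(1-x)z^3+xz(1-z)(4-z)-2yx(1-x)^2z(1-z)-2(1-x)(1-z)^2\bigr)T^3\\ &+yx^2\bigl(yx^2z^4-yx(1-x)z^2(1-z)+(1-z)^3\bigr)T^4 . \end{aligned}$$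
   Context: An inversion sequence of length $n$ is an integer sequence $e=(e_1,\dots,e_n)$ with $0\le e_j\le j-1$ for all $j$. It is $(102,000)$-avoiding if there are no indices $i<j<k$ with $e_j<e_i<e_k$ and no indices $i<j<k$ with $e_i=e_j=e_k$. $\operatorname{dist}(e)$ is the number of distinct entries of $e$. For such $e$ of length $n\ge1$, let $p$ be the position of the first descent, i.e. the least $p$ with $e_1\le e_2\le\dots\le e_p>e_{p+1}$, using the convention $e_{n+1}=-1$; then $\operatorname{rank}(e):=(p-1)-e_p\ge 0$. By convention, for $n=0$ the only sequence is the empty sequence, with $\operatorname{dist}=\operatorname{rank}=0$. -}

module Defs where

open import Data.Nat as ℕ using (ℕ; zero; suc; _∸_; _≡ᵇ_; _<ᵇ_)
open import Data.Integer as ℤ using (ℤ; +_; -_)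
open import Data.Bool using (Bool; true; false; _∧_; _∨_; if_then_else_; T)
open import Data.List using (List; []; _∷_; [_]; _++_; map; concatMap; upTo; length; filter; foldr; deduplicate)
open import Data.Product using (_×_; _,_)
open import Relation.Nullary.Decidable using (T?)
open import Relation.Binary.PropositionalEquality using (_≡_)

allB : {A : Set} → (A → Bool) → List A → Bool
allB p = foldr (λ a r → p a ∧ r) true

-- Inversion sequences, stored as lists e = (e₁,…,eₙ) (0-indexed access)

-- entry at 0-based position i (default 0 outside range; never used there)
at : List ℕ → ℕ → ℕ
at []       _       = 0
at (a ∷ _)  zero    = a
at (_ ∷ es) (suc i) = at es i

invSeqs : ℕ → List (List ℕ)
invSeqs zero    = [] ∷ []
invSeqs (suc n) = concatMap (λ e → map (λ v → e ++ [ v ]) (upTo (suc n))) (invSeqs n)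

badTriple : ℕ → ℕ → ℕ → Bool
badTriple a b c = ((b <ᵇ a) ∧ (a <ᵇ c)) ∨ ((a ≡ᵇ b) ∧ (b ≡ᵇ c))

avoids102-000 : List ℕ → Bool
avoids102-000 e =
  allB (λ k → allB (λ j → allB (λ i → notB (badTriple (at e i) (at e j) (at e k)))
                              (upTo j))
                 (upTo k))
      (upTo (length e))
  where
  notB : Bool → Bool
  notB true  = false
  notB false = true

dist : List ℕ → ℕ
dist e = length (deduplicate ℕ._≟_ e)

-- 0-based index q = p - 1 of the first descent e_p > e_{p+1} (with e_{n+1} = -1)
firstDescent : List ℕ → ℕ
firstDescent (a ∷ b ∷ rest) = if b <ᵇ a then 0 else suc (firstDescent (b ∷ rest))
firstDescent (a ∷ [])       = 0
firstDescent []             = 0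

-- rank(e) = (p - 1) - e_p   (nonnegative since e_p ≤ p - 1); rank of [] is 0
rank : List ℕ → ℕ
rank e = firstDescent e ∸ at e (firstDescent e)

count : ℕ → ℕ → ℕ → ℕ
count n m t = length (filter (λ e → T? (avoids102-000 e ∧ (dist e ≡ᵇ m) ∧ (rank e ≡ᵇ t))) (invSeqs n))

-- Formal power series in x, y, z over ℤ: coefficient of x^n y^m z^t

FPS : Set
FPS = ℕ → ℕ → ℕ → ℤ

_≈ₛ_ : FPS → FPS → Set
f ≈ₛ g = ∀ n m t → f n m t ≡ g n m t
infix 4 _≈ₛ_

Σ≤ : ℕ → (ℕ → ℤ) → ℤ
Σ≤ n f = foldr (λ a s → f a ℤ.+ s) (+ 0) (upTo (suc n))

cst : ℤ → FPS
cst k zero zero zero = k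
cst k _    _    _    = + 0

monoS : ℤ → ℕ → ℕ → ℕ → FPS
monoS c a b d n m t = if (n ≡ᵇ a) ∧ (m ≡ᵇ b) ∧ (t ≡ᵇ d) then c else + 0

X Y Z : FPS
X = monoS (+ 1) 1 0 0
Y = monoS (+ 1) 0 1 0
Z = monoS (+ 1) 0 0 1

infixl 6 _⊕_ _⊖_
infixl 7 _⊛_
infixr 8 _^^_

_⊕_ : FPS → FPS → FPS
(f ⊕ g) n m t = f n m t ℤ.+ g n m t

⊝_ : FPS → FPS
(⊝ f) n m t = - f n m t

_⊖_ : FPS → FPS → FPS
f ⊖ g = f ⊕ (⊝ g)

_⊛_ : FPS → FPS → FPS
(f ⊛ g) n m t =
  Σ≤ n (λ a → Σ≤ m (λ b → Σ≤ t (λ c → f a b c ℤ.* g (n ∸ a) (m ∸ b) (t ∸ c))))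

_^^_ : FPS → ℕ → FPS
f ^^ zero  = cst (+ 1)
f ^^ suc k = f ⊛ (f ^^ k)

E : FPS
E n m t = + (count n m t)

-- Polynomials in ℤ[x,y,z] as finite lists of monomials c·x^a y^b z^d

Poly : Set
Poly = List (ℤ × ℕ × ℕ × ℕ)

⟦_⟧ : Poly → FPS
⟦ ps ⟧ = foldr (λ { (c , a , b , d) s → monoS c a b d ⊕ s }) (cst (+ 0)) ps

k : ℕ → FPS
k n = cst (+ n)

c0 c1 c2 c3 c4 : FPS
c0 = k 1
c1 = ⊝ (k 1 ⊖ k 2 ⊛ Y ⊛ X ⊛ (k 1 ⊖ X) ⊛ Z ⊕ Y ⊛ (k 1 ⊖ X) ^^ 2 ⊛ (k 1 ⊖ Z))
c2 = Y ⊛ ( k 2 ⊛ X ^^ 2 ⊛ Z ^^ 2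
         ⊕ X ⊛ (k 1 ⊖ X) ⊛ (k 2 ⊛ Z ^^ 2 ⊖ k 6 ⊛ Z ⊕ k 3)
         ⊕ Y ⊛ X ^^ 2 ⊛ (k 1 ⊖ X) ^^ 2 ⊛ Z ^^ 2
         ⊕ (k 1 ⊖ X) ^^ 2 ⊛ (k 1 ⊖ Z)
         ⊖ Y ⊛ X ⊛ (k 1 ⊖ X) ^^ 3 ⊛ (k 1 ⊖ Z))
c3 = Y ⊛ X ⊛ ( k 2 ⊛ Y ⊛ X ^^ 2 ⊛ (k 1 ⊖ X) ⊛ Z ^^ 3
             ⊕ X ⊛ Z ⊛ (k 1 ⊖ Z) ⊛ (k 4 ⊖ Z)
             ⊖ k 2 ⊛ Y ⊛ X ⊛ (k 1 ⊖ X) ^^ 2 ⊛ Z ⊛ (k 1 ⊖ Z)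
             ⊖ k 2 ⊛ (k 1 ⊖ X) ⊛ (k 1 ⊖ Z) ^^ 2)
c4 = Y ⊛ X ^^ 2 ⊛ ( Y ⊛ X ^^ 2 ⊛ Z ^^ 4
                  ⊖ Y ⊛ X ⊛ (k 1 ⊖ X) ⊛ Z ^^ 2 ⊛ (k 1 ⊖ Z)
                  ⊕ (k 1 ⊖ Z) ^^ 3)

P : FPS → FPS
P F = c0 ⊕ c1 ⊛ F ⊕ c2 ⊛ F ^^ 2 ⊕ c3 ⊛ F ^^ 3 ⊕ c4 ⊛ F ^^ 4

{-# OPTIONS --safe #-}
module Submission where

-- Deleting the maximum M from a (102,000)-avoiding inversion sequence leaves one with fewer values, and M is put back
-- by inserting it once or twice into the first weakly increasing run. How many insertions give rank t depends only on
-- the rank s of what is left, so the coefficients E_t of z^t satisfy a linear recurrence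
-- E_t = [t = 0] + y Σ_s (x N₁(s,t) + x² N₂(s,t)) E_s. For t ≥ 1 its kernels depend on s - t only, and the sequences
-- E_{t+1} and w E_t, where w = E_1 / E_0, both satisfy it; hence E_t = w^t E_0. Substituting this back gives
--   (1 - z w) E = E_0,   y x² E_0 = w (1 - w)²,   x (1 - w) E_0 = w (1 - w) + x (1 - w + w²),
-- and eliminating w and E_0 gives the quartic equation.
--
-- These formulas parametrise y and E by x, z and w, and w is transcendental over the series in x and z. At w = 1 the
-- function y has a triple zero and E a simple pole, so in a relation q₀ + q₁ E + q₂ E² + q₃ E³ = 0 the orders at w = 1
-- show successively that y divides q₃, q₂ and q₁, and then it divides q₀ too. Dividing by y and repeating, all q_i vanish.

open import Defs
open import Data.Product using (_×_)
import Data.Nat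
import Data.Nat.Properties
import Data.Integer
import Data.Integer.Properties
import Algebra.Solver.Ring
import Relation.Binary.Reasoning.Setoid
import Algebra.Properties.CommutativeSemigroup
open import Algebra.Bundles using (CommutativeRing)
open import Algebra.Solver.Ring.AlmostCommutativeRing using (fromCommutativeRing; _-Raw-AlmostCommutative⟶_)
open import Algebra.Structures using (IsCommutativeRing)
open import Data.Bool using (Bool; true; false; T; _∧_; if_then_else_)
import Data.Bool.Properties as Boolₚ
open import Data.Empty using (⊥; ⊥-elim)
open import Data.Fin as Fin using (Fin; #_)
open import Data.List using (List; []; _∷_; [_]; _++_; map; concatMap; upTo; applyUpTo; length; filter; foldr; deduplicate; take; drop; initLast; _∷ʳ′_)
import Data.List.Properties as Listₚ
open import Data.List.Membership.Propositional using (_∈_; find; lose)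
open import Data.List.Membership.Propositional.Properties
open import Data.List.Membership.Propositional.Properties.WithK using (unique∧set⇒bag)
open import Data.List.Relation.Binary.BagAndSetEquality using (∼bag⇒↭)
open import Data.List.Relation.Binary.Permutation.Propositional.Properties using (↭-length)
open import Data.List.Relation.Binary.Sublist.Propositional using (_⊆_; []; _∷_; _∷ʳ_; ⊆-refl; ⊆-trans; from∈; to∈; minimum)
open import Data.List.Relation.Binary.Sublist.Propositional.Properties using (filter-⊆; filter⁺; ++⁺; All-resp-⊆; Any-resp-⊆)
open import Data.List.Relation.Unary.All as All using (All; []; _∷_)
import Data.List.Relation.Unary.All.Properties as Allₚ
open import Data.List.Relation.Unary.AllPairs using (AllPairs; []; _∷_)
import Data.List.Relation.Unary.AllPairs.Properties as AllPairsₚ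
open import Data.List.Relation.Unary.Any using (here; there)
open import Data.List.Relation.Unary.Unique.Propositional using (Unique)
import Data.List.Relation.Unary.Unique.Propositional.Properties as Uniqueₚ
open import Data.List.Relation.Unary.Unique.DecPropositional.Properties Data.Nat._≟_ using (deduplicate-!)
open import Data.Maybe using (Maybe; just; nothing)
open import Data.Product using (_,_; ∃; ∃₂; proj₁; proj₂)
open import Data.Sum using (_⊎_; inj₁; inj₂)
open import Data.Unit using (tt)
open import Data.Vec using (Vec; []; _∷_; lookup)
open import Function using (_∘_; id; mk⇔; Equivalence)
open import Relation.Binary.Definitions using (tri<; tri≈; tri>)
open import Relation.Nullary using (¬_; yes; no)
open import Relation.Nullary.Decidable using (T?)
open import Relation.Binary.PropositionalEquality as ≡ using (_≡_; _≢_)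

-- In a 102-avoiding sequence no entry after the first descent exceeds the entry before it, so the
-- peak of the first run is the maximum of the whole sequence. The rank is therefore the leeway for
-- a new maximum. It is shared between raising the value above the least possible one, moving it to
-- the right of the first position that admits this value and, for two copies, the gap between them:
-- the kernels count the solutions of `r + c + d ≤ s`. Two adjacent copies lengthen the run by one
-- and never yield rank 0; this alone breaks the shift of the kernels at target rank 0. All
-- divisions are governed by orders in `y`. Since `y` divides `w`, the series `1 - w` and `1 - z w`
-- are units, and uniqueness for the recurrence is tested modulo powers of `y`. For independence,
-- the transcendence of `w` turns a relation into a polynomial identity in `ω` whose coefficients
-- are free of `y`. The letter `y` can then be reused as the local parameter `1 - ω` at the place
-- `ω = 1`, and orders at that place become orders in `y`.

module Counting where

  open Data.Nat
  open Data.Nat.Properties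
  open Algebra.Properties.CommutativeSemigroup +-commutativeSemigroup using (interchange)
  open ≡ using (refl; sym; trans; cong; cong₂; subst; subst₂)

  -- Counting with duplicate-free lists

  length-unique : ∀ {A : Set} {xs ys : List A} → Unique xs → Unique ys →
    (∀ {a} → a ∈ xs → a ∈ ys) → (∀ {a} → a ∈ ys → a ∈ xs) → length xs ≡ length ys
  length-unique p q to from = ↭-length (∼bag⇒↭ (unique∧set⇒bag p q (mk⇔ to from)))

  unique-map : ∀ {A B : Set} (f : A → B) {xs} → Unique xs →
    (∀ {a b} → a ∈ xs → b ∈ xs → f a ≡ f b → a ≡ b) → Unique (map f xs)
  unique-map f []       inj = []
  unique-map f (p ∷ ps) inj =
    Allₚ.map⁺ (All.tabulate λ b∈ fa≡fb → All.lookup p b∈ (inj (here refl) (there b∈) fa≡fb))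
    ∷ unique-map f ps λ a∈ b∈ → inj (there a∈) (there b∈)

  -- Used with `xs` a list of parents, `codes` the ways to extend each of them and `f` the resulting
  -- child: joint injectivity makes the list of all children duplicate-free, so that its length is a
  -- count.
  unique-children : ∀ {A B C : Set} (f : A → B → C) (codes : A → List B) {xs} → Unique xs → (∀ a → Unique (codes a)) →
    (∀ {a a′ b b′} → a ∈ xs → a′ ∈ xs → b ∈ codes a → b′ ∈ codes a′ → f a b ≡ f a′ b′ → a ≡ a′ × b ≡ b′) →
    Unique (concatMap (λ a → map (f a) (codes a)) xs)
  unique-children f codes []                 q inj = []
  unique-children f codes {x ∷ xs} (p ∷ ps) q inj = Uniqueₚ.++⁺
    (unique-map (f x) (q x) λ b∈ b′∈ eq → proj₂ (inj (here refl) (here refl) b∈ b′∈ eq))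
    (unique-children f codes ps q λ a∈ a′∈ → inj (there a∈) (there a′∈))
    disjoint
    where
    disjoint : ∀ {c} → c ∈ map (f x) (codes x) × c ∈ concatMap (λ a → map (f a) (codes a)) xs → ⊥
    disjoint (c∈ , c∈′) with ∈-map⁻ (f x) c∈ | find (∈-concatMap⁻ (λ a → map (f a) (codes a)) c∈′)
    ... | b , b∈ , refl | a , a∈ , c∈a with ∈-map⁻ (f a) c∈a
    ... | b′ , b′∈ , eq = All.lookup p a∈ (proj₁ (inj (here refl) (there a∈) b∈ b′∈ eq))

  ∈-children⁺ : ∀ {A B C : Set} (f : A → B → C) (codes : A → List B) {xs a b} → a ∈ xs → b ∈ codes a →
    f a b ∈ concatMap (λ a → map (f a) (codes a)) xs
  ∈-children⁺ f codes a∈ b∈ = ∈-concatMap⁺ (λ a → map (f a) (codes a)) (lose a∈ (∈-map⁺ (f _) b∈))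

  ∈-children⁻ : ∀ {A B C : Set} (f : A → B → C) (codes : A → List B) {xs c} →
    c ∈ concatMap (λ a → map (f a) (codes a)) xs → ∃₂ λ a b → a ∈ xs × b ∈ codes a × c ≡ f a b
  ∈-children⁻ f codes c∈ with find (∈-concatMap⁻ (λ a → map (f a) (codes a)) c∈)
  ... | a , a∈ , c∈a with ∈-map⁻ (f a) c∈a
  ... | b , b∈ , eq = a , b , a∈ , b∈ , eq

  -- Inversion sequences

  -- The offset `o` is the number of entries to the left, so inversion sequences are `InvFrom 0`. It
  -- permits recursion from the front, while `invSeqs` extends at the back.
  data InvFrom (o : ℕ) : List ℕ → Set where
    []  : InvFrom o []
    _∷_ : ∀ {a e} → a ≤ o → InvFrom (suc o) e → InvFrom o (a ∷ e)

  InvFrom-mono : ∀ {o o′ e} → o ≤ o′ → InvFrom o e → InvFrom o′ e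
  InvFrom-mono o≤o′ []      = []
  InvFrom-mono o≤o′ (p ∷ i) = ≤-trans p o≤o′ ∷ InvFrom-mono (s≤s o≤o′) i

  InvFrom-all : ∀ {o e} → All (_≤ o) e → InvFrom o e
  InvFrom-all []       = []
  InvFrom-all (p ∷ ps) = p ∷ InvFrom-all (All.map m≤n⇒m≤1+n ps)

  InvFrom-insert : ∀ {o M} u {v} → InvFrom o (u ++ v) → M ≤ o + length u → InvFrom o (u ++ M ∷ v)
  InvFrom-insert {o} []      i       M≤ = subst (_ ≤_) (+-identityʳ o) M≤ ∷ InvFrom-mono (n≤1+n o) i
  InvFrom-insert {o} {M} (a ∷ u) (p ∷ i) M≤ = p ∷ InvFrom-insert u i (subst (M ≤_) (+-suc o (length u)) M≤)

  -- Entries behind the deleted one move a step to the left. They keep within their bounds because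
  -- they are at most `M`, which fits at its own position.
  InvFrom-delete : ∀ {o M} u {v} → InvFrom o (u ++ M ∷ v) → All (_≤ M) v → InvFrom o (u ++ v) × M ≤ o + length u
  InvFrom-delete {o} []      (p ∷ i) v≤ =
    InvFrom-all (All.map (λ a≤M → ≤-trans a≤M p) v≤) , subst (_ ≤_) (sym (+-identityʳ o)) p
  InvFrom-delete {o} {M} (a ∷ u) (p ∷ i) v≤ with InvFrom-delete u i v≤
  ... | i′ , M≤ = p ∷ i′ , subst (M ≤_) (sym (+-suc o (length u))) M≤

  InvFrom-at : ∀ {o} e i → InvFrom o e → at e i ≤ o + i
  InvFrom-at []      i       inv       = z≤n
  InvFrom-at (a ∷ e) zero    (p ∷ inv) = ≤-trans p (m≤m+n _ _)
  InvFrom-at {o} (a ∷ e) (suc i) (p ∷ inv) = subst (at e i ≤_) (sym (+-suc o i)) (InvFrom-at e i inv)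

  InvFrom-∷ʳ⁻ : ∀ {o v} e → InvFrom o (e ++ [ v ]) → InvFrom o e × v ≤ o + length e
  InvFrom-∷ʳ⁻ e i with InvFrom-delete e i []
  ... | i′ , v≤ = subst (InvFrom _) (Listₚ.++-identityʳ e) i′ , v≤

  ∈-invSeqs⁺ : ∀ n {e} → InvFrom 0 e → length e ≡ n → e ∈ invSeqs n
  ∈-invSeqs⁺ n {e} inv len with initLast e
  ∈-invSeqs⁺ zero    inv len | []       = here refl
  ∈-invSeqs⁺ zero    inv len | e ∷ʳ′ v with () ← trans (sym (trans (Listₚ.length-++ e) (+-comm (length e) 1))) len
  ∈-invSeqs⁺ (suc n) inv ()  | []
  ∈-invSeqs⁺ (suc n) inv len | e ∷ʳ′ v with InvFrom-∷ʳ⁻ e inv | suc-injective (trans (sym (trans (Listₚ.length-++ e) (+-comm (length e) 1))) len)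
  ... | i , v≤ | refl = ∈-children⁺ (λ e v → e ++ [ v ]) (λ _ → upTo (suc (length e))) (∈-invSeqs⁺ n i refl) (∈-upTo⁺ (s≤s v≤))

  ∈-invSeqs⁻ : ∀ n {e} → e ∈ invSeqs n → InvFrom 0 e × length e ≡ n
  ∈-invSeqs⁻ zero    (here refl) = [] , refl
  ∈-invSeqs⁻ (suc n) e∈ with ∈-children⁻ (λ e v → e ++ [ v ]) (λ _ → upTo (suc n)) e∈
  ... | e , v , e∈′ , v∈ , refl with ∈-invSeqs⁻ n e∈′
  ... | i , refl = InvFrom-insert e (subst (InvFrom 0) (sym (Listₚ.++-identityʳ e)) i) (≤-pred (∈-upTo⁻ v∈))
                 , trans (Listₚ.length-++ e) (+-comm (length e) 1)

  invSeqs-unique : ∀ n → Unique (invSeqs n)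
  invSeqs-unique zero    = [] ∷ []
  invSeqs-unique (suc n) = unique-children (λ e v → e ++ [ v ]) (λ _ → upTo (suc n)) (invSeqs-unique n)
    (λ _ → Uniqueₚ.upTo⁺ (suc n)) λ {e} {e′} _ _ _ _ eq → Listₚ.∷ʳ-injective e e′ eq

  -- Pattern avoidance in terms of sublists

  allB⁻ : ∀ {A : Set} (p : A → Bool) {xs x} → T (allB p xs) → x ∈ xs → T (p x)
  allB⁻ p {y ∷ xs} h (here refl) with p y
  ... | true = tt
  allB⁻ p {y ∷ xs} h (there x∈) with p y
  ... | true = allB⁻ p h x∈

  ¬allB⁻ : ∀ {A : Set} (p : A → Bool) xs → ¬ T (allB p xs) → ∃ λ x → x ∈ xs × ¬ T (p x)
  ¬allB⁻ p []       h = ⊥-elim (h tt)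
  ¬allB⁻ p (x ∷ xs) h with p x in eq
  ... | false = x , here refl , λ t → subst T eq t
  ... | true  with ¬allB⁻ p xs h
  ... | y , y∈ , ¬py = y , there y∈ , ¬py

  data Bad (a b c : ℕ) : Set where
    102-pattern : b < a → a < c → Bad a b c
    000-pattern : a ≡ b → b ≡ c → Bad a b c

  Bad⇒T : ∀ {a b c} → Bad a b c → T (badTriple a b c)
  Bad⇒T (102-pattern p q) = Equivalence.from Boolₚ.T-∨ (inj₁ (Equivalence.from Boolₚ.T-∧ (<⇒<ᵇ p , <⇒<ᵇ q)))
  Bad⇒T {a} {b} {c} (000-pattern p q) = Equivalence.from (Boolₚ.T-∨ {(b <ᵇ a) ∧ (a <ᵇ c)})
    (inj₂ (Equivalence.from Boolₚ.T-∧ (≡⇒≡ᵇ a b p , ≡⇒≡ᵇ b c q)))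

  T⇒Bad : ∀ {a b c} → T (badTriple a b c) → Bad a b c
  T⇒Bad {a} {b} {c} t with Equivalence.to (Boolₚ.T-∨ {(b <ᵇ a) ∧ (a <ᵇ c)}) t
  ... | inj₁ s = let p , q = Equivalence.to (Boolₚ.T-∧ {b <ᵇ a}) s in 102-pattern (<ᵇ⇒< b a p) (<ᵇ⇒< a c q)
  ... | inj₂ s = let p , q = Equivalence.to (Boolₚ.T-∧ {a ≡ᵇ b}) s in 000-pattern (≡ᵇ⇒≡ a b p) (≡ᵇ⇒≡ b c q)

  -- Occurrences are sublists instead of index triples: heredity is then transitivity of `⊆`, and
  -- occurrences in a concatenation are assembled with `++⁺`.
  record Avoiding (e : List ℕ) : Set where
    constructor avoiding
    field avoids : ∀ {a b c} → a ∷ b ∷ c ∷ [] ⊆ e → ¬ Bad a b c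
  open Avoiding public

  at-⊆₁ : ∀ e {k} → k < length e → at e k ∷ [] ⊆ e
  at-⊆₁ (a ∷ e) {zero}  _       = refl ∷ minimum e
  at-⊆₁ (a ∷ e) {suc k} (s≤s k<) = a ∷ʳ at-⊆₁ e k<

  at-⊆₂ : ∀ e {j k} → j < k → k < length e → at e j ∷ at e k ∷ [] ⊆ e
  at-⊆₂ (a ∷ e) {zero}  {suc k} _         (s≤s k<) = refl ∷ at-⊆₁ e k<
  at-⊆₂ (a ∷ e) {suc j} {suc k} (s≤s j<k) (s≤s k<) = a ∷ʳ at-⊆₂ e j<k k<

  at-⊆₃ : ∀ e {i j k} → i < j → j < k → k < length e → at e i ∷ at e j ∷ at e k ∷ [] ⊆ e
  at-⊆₃ (a ∷ e) {zero}  {suc j} {suc k} _         (s≤s j<k) (s≤s k<) = refl ∷ at-⊆₂ e j<k k<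
  at-⊆₃ (a ∷ e) {suc i} {suc j} {suc k} (s≤s i<j) (s≤s j<k) (s≤s k<) = a ∷ʳ at-⊆₃ e i<j j<k k<

  ⊆-at₁ : ∀ {e c} → c ∷ [] ⊆ e → ∃ λ k → k < length e × at e k ≡ c
  ⊆-at₁ (a ∷ʳ p) = let k , k< , eq = ⊆-at₁ p in suc k , s≤s k< , eq
  ⊆-at₁ (refl ∷ p) = 0 , s≤s z≤n , refl

  ⊆-at₂ : ∀ {e b c} → b ∷ c ∷ [] ⊆ e → ∃₂ λ j k → j < k × k < length e × at e j ≡ b × at e k ≡ c
  ⊆-at₂ (a ∷ʳ p) = let j , k , j<k , k< , eqs = ⊆-at₂ p in suc j , suc k , s≤s j<k , s≤s k< , eqs
  ⊆-at₂ (refl ∷ p) = let k , k< , eq = ⊆-at₁ p in 0 , suc k , s≤s z≤n , s≤s k< , refl , eq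

  ⊆-at₃ : ∀ {e a b c} → a ∷ b ∷ c ∷ [] ⊆ e →
    ∃ λ i → ∃₂ λ j k → i < j × j < k × k < length e × at e i ≡ a × at e j ≡ b × at e k ≡ c
  ⊆-at₃ (a ∷ʳ p) = let i , j , k , i<j , j<k , k< , eqs = ⊆-at₃ p in suc i , suc j , suc k , s≤s i<j , s≤s j<k , s≤s k< , eqs
  ⊆-at₃ (refl ∷ p) = let j , k , j<k , k< , eqs = ⊆-at₂ p in 0 , suc j , suc k , s≤s z≤n , s≤s j<k , s≤s k< , refl , eqs

  avoids⇒Avoiding : ∀ e → T (avoids102-000 e) → Avoiding e
  avoids⇒Avoiding e h = avoiding go
    where
    at-indices : ∀ {i j k} → i < j → j < k → k < length e → ¬ Bad (at e i) (at e j) (at e k)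
    at-indices {i} {j} {k} i<j j<k k< bad
      -- The negation inside `avoids102-000` is local to that definition; abstracting its argument
      -- makes it reduce.
      with badTriple (at e i) (at e j) (at e k) | Bad⇒T bad
         | allB⁻ _ (allB⁻ _ (allB⁻ _ h (∈-upTo⁺ k<)) (∈-upTo⁺ j<k)) (∈-upTo⁺ i<j)
    ... | true | _ | ()
    go : ∀ {a b c} → a ∷ b ∷ c ∷ [] ⊆ e → ¬ Bad a b c
    go p bad with ⊆-at₃ p
    ... | i , j , k , i<j , j<k , k< , refl , refl , refl = at-indices i<j j<k k< bad

  Avoiding⇒avoids : ∀ e → Avoiding e → T (avoids102-000 e)
  Avoiding⇒avoids e av with T? (avoids102-000 e)
  ... | yes p = p
  ... | no ¬p with ¬allB⁻ _ (upTo (length e)) ¬p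
  ... | k , k∈ , ¬k with ¬allB⁻ _ (upTo k) ¬k
  ... | j , j∈ , ¬j with ¬allB⁻ _ (upTo j) ¬j
  ... | i , i∈ , ¬i with badTriple (at e i) (at e j) (at e k)
                       | (λ (t : T (badTriple (at e i) (at e j) (at e k))) →
                            avoids av (at-⊆₃ e (∈-upTo⁻ i∈) (∈-upTo⁻ j∈) (∈-upTo⁻ k∈)) (T⇒Bad t))
  ... | false | _ = ⊥-elim (¬i tt)
  ... | true  | f = ⊥-elim (f tt)

  -- Removing and restoring the maximal entries

  Sorted : List ℕ → Set
  Sorted = AllPairs _≤_

  Avoiding-⊆ : ∀ {e e′} → e ⊆ e′ → Avoiding e′ → Avoiding e
  Avoiding-⊆ p av = avoiding λ q → avoids av (⊆-trans q p)

  Sorted-pairs : ∀ {e} → (∀ {a b} → a ∷ b ∷ [] ⊆ e → a ≤ b) → Sorted e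
  Sorted-pairs {[]}    h = []
  Sorted-pairs {a ∷ e} h = All.tabulate (λ b∈ → h (refl ∷ from∈ b∈)) ∷ Sorted-pairs (λ p → h (a ∷ʳ p))

  Sorted-⊆₂ : ∀ {e a b} → Sorted e → a ∷ b ∷ [] ⊆ e → a ≤ b
  Sorted-⊆₂ (p ∷ ps) (_ ∷ʳ q)   = Sorted-⊆₂ ps q
  Sorted-⊆₂ (p ∷ ps) (refl ∷ q) = All.lookup p (to∈ q)

  smaller : ℕ → List ℕ → List ℕ
  smaller M = filter (_<? M)

  smaller-all : ∀ {M u} → All (_< M) u → smaller M u ≡ u
  smaller-all {M} = Listₚ.filter-all (_<? M)

  smaller-insert : ∀ M u v → smaller M (u ++ M ∷ v) ≡ smaller M u ++ smaller M v
  smaller-insert M u v = trans (Listₚ.filter-++ (_<? M) u (M ∷ v))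
    (cong (smaller M u ++_) (Listₚ.filter-reject (_<? M) {M} {v} (<-irrefl refl)))

  ∈-smaller⇒< : ∀ {M u a} → a ∈ smaller M u → a < M
  ∈-smaller⇒< {M} {u} = proj₂ ∘ ∈-filter⁻ (_<? M) {xs = u}

  -- The final `M` of the pattern cannot lie in `v`, so it is matched at or before the displayed
  -- `M`, and everything preceding it is matched inside `u`.
  ⊆-before-last : ∀ xs u {M v} → All (_< M) v → xs ++ [ M ] ⊆ u ++ M ∷ v → xs ⊆ u
  ⊆-before-last []       u       v< p          = minimum u
  ⊆-before-last (x ∷ xs) []      v< (_ ∷ʳ p)   =
    ⊥-elim (<-irrefl refl (All.lookup v< (Any-resp-⊆ p (there (∈-++⁺ʳ xs (here refl))))))
  ⊆-before-last (x ∷ xs) []      v< (refl ∷ p) = ⊥-elim (<-irrefl refl (All.lookup v< (Any-resp-⊆ p (∈-++⁺ʳ xs (here refl)))))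
  ⊆-before-last (x ∷ xs) (a ∷ u) v< (_ ∷ʳ p)   = a ∷ʳ ⊆-before-last (x ∷ xs) u v< p
  ⊆-before-last (x ∷ xs) (a ∷ u) v< (eq ∷ p)   = eq ∷ ⊆-before-last xs u v< p

  -- With M maximal, a 102 ending in M needs a descent of smaller entries before the last M, and any other pattern avoids M or is M M M.
  Avoiding-insert : ∀ {M} u {v} → All (_≤ M) u → All (_< M) v → Sorted (smaller M u) → ¬ (M ∷ M ∷ [] ⊆ u) →
    Avoiding (smaller M u ++ v) → Avoiding (u ++ M ∷ v)
  Avoiding-insert {M} u {v} u≤ v< sorted once av = avoiding go
    where
    all≤ : All (_≤ M) (u ++ M ∷ v)
    all≤ = Allₚ.++⁺ u≤ (≤-refl ∷ All.map <⇒≤ v<)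
    rest : smaller M (u ++ M ∷ v) ≡ smaller M u ++ v
    rest = trans (smaller-insert M u v) (cong (smaller M u ++_) (smaller-all v<))
    below : ∀ {xs} → All (_< M) xs → xs ⊆ u ++ M ∷ v → xs ⊆ smaller M u ++ v
    below xs< p = subst (_ ⊆_) rest (subst (_⊆ smaller M (u ++ M ∷ v)) (smaller-all xs<) (filter⁺ (_<? M) (_<? M) (λ { refl q → q }) p))
    go : ∀ {a b c} → a ∷ b ∷ c ∷ [] ⊆ u ++ M ∷ v → ¬ Bad a b c
    go {a} {b} {c} p bad with All-resp-⊆ p all≤ | <-cmp c M
    go p bad | _ ∷ _ ∷ c≤M ∷ [] | tri> _ _ M<c = <⇒≱ M<c c≤M
    go p (102-pattern b<a a<c) | _ | tri< c<M _ _ =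
      avoids av (below (<-trans a<c c<M ∷ <-trans b<a (<-trans a<c c<M) ∷ c<M ∷ []) p) (102-pattern b<a a<c)
    go p (000-pattern refl refl) | _ | tri< c<M _ _ =
      avoids av (below (c<M ∷ c<M ∷ c<M ∷ []) p) (000-pattern refl refl)
    go {a} {b} p (102-pattern b<a a<M) | _ | tri≈ _ refl _ = <⇒≱ b<a (Sorted-⊆₂ sorted
      (subst (_⊆ smaller M u) (smaller-all (a<M ∷ <-trans b<a a<M ∷ [])) (filter⁺ (_<? M) (_<? M) (λ { refl q → q }) (⊆-before-last (a ∷ b ∷ []) u v< p))))
    go p (000-pattern refl refl) | _ | tri≈ _ refl _ = once (⊆-before-last (M ∷ M ∷ []) u v< p)

  Avoiding-once : ∀ {M} u {v} → Avoiding (u ++ M ∷ v) → ¬ (M ∷ M ∷ [] ⊆ u)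
  Avoiding-once {M} u av p = avoids av (++⁺ p (refl ∷ minimum _)) (000-pattern refl refl)

  -- A descent among the smaller entries before `M` would be the 10 of a 102 whose 2 is `M`.
  Avoiding-sorted : ∀ {M} u {v} → Avoiding (u ++ M ∷ v) → Sorted (smaller M u)
  Avoiding-sorted {M} u {v} av = Sorted-pairs λ {a} {b} p → ≮⇒≥ λ b<a → avoids av
    (++⁺ (⊆-trans p (filter-⊆ (_<? M) u)) (refl ∷ minimum v))
    (102-pattern b<a (∈-smaller⇒< {M} {u} (to∈ p)))

  dist-insert : ∀ {M} e → M ∈ e → All (_≤ M) e → dist e ≡ suc (dist (smaller M e))
  dist-insert {M} e M∈ e≤ = length-unique (deduplicate-! e)
    (All.tabulate (λ a∈ M≡a → <-irrefl (sym M≡a) (∈-smaller⇒< {M} {e} (∈-deduplicate⁻ _≟_ (smaller M e) a∈))) ∷ deduplicate-! (smaller M e))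
    to from
    where
    to : ∀ {a} → a ∈ deduplicate _≟_ e → a ∈ M ∷ deduplicate _≟_ (smaller M e)
    to {a} a∈ with m≤n⇒m<n∨m≡n (All.lookup e≤ (∈-deduplicate⁻ _≟_ e a∈))
    ... | inj₁ a<M  = there (∈-deduplicate⁺ _≟_ (∈-filter⁺ (_<? M) (∈-deduplicate⁻ _≟_ e a∈) a<M))
    ... | inj₂ refl = here refl
    from : ∀ {a} → a ∈ M ∷ deduplicate _≟_ (smaller M e) → a ∈ deduplicate _≟_ e
    from (here refl) = ∈-deduplicate⁺ _≟_ M∈
    from (there a∈)  = ∈-deduplicate⁺ _≟_ (proj₁ (∈-filter⁻ (_<? M) (∈-deduplicate⁻ _≟_ (smaller M e) a∈)))

  -- The first weakly increasing run

  -- For nonempty sequences these are `p` and `e_p + 1`, so the rank is their difference. Under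
  -- avoidance of 102, `bound` is the least value above all entries; the value 0 at `[]` extends
  -- this to the empty sequence.
  runLength bound : List ℕ → ℕ
  runLength []      = 0
  runLength (a ∷ e) = suc (firstDescent (a ∷ e))
  bound []      = 0
  bound (a ∷ e) = suc (at (a ∷ e) (firstDescent (a ∷ e)))

  rank-run : ∀ f → rank f ≡ runLength f ∸ bound f
  rank-run []      = refl
  rank-run (a ∷ f) = refl

  -- `at-end` encodes the convention that a -1 follows the last entry.
  data Drops (M : ℕ) : List ℕ → Set where
    at-end   : Drops M []
    drops-to : ∀ {a v} → a < M → Drops M (a ∷ v)

  Drops-all : ∀ {M v} → All (_< M) v → Drops M v
  Drops-all []      = at-end
  Drops-all (p ∷ _) = drops-to p

  firstDescent-run : ∀ u {M v} → Sorted u → All (_≤ M) u → Drops M v → firstDescent (u ++ M ∷ v) ≡ length u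
  firstDescent-run []          sorted u≤ at-end = refl
  firstDescent-run []  {M}     sorted u≤ (drops-to {a} a<M) with a <ᵇ M | <⇒<ᵇ a<M
  ... | true | _ = refl
  firstDescent-run (a ∷ []) {M} sorted (a≤M ∷ []) d with M <ᵇ a in eq
  ... | true  = ⊥-elim (≤⇒≯ a≤M (<ᵇ⇒< M a (subst T (sym eq) tt)))
  ... | false = cong suc (firstDescent-run [] [] [] d)
  firstDescent-run (a ∷ b ∷ u) ((a≤b ∷ _) ∷ sorted) (_ ∷ u≤) d with b <ᵇ a in eq
  ... | true  = ⊥-elim (≤⇒≯ a≤b (<ᵇ⇒< b a (subst T (sym eq) tt)))
  ... | false = cong suc (firstDescent-run (b ∷ u) sorted u≤ d)

  at-length : ∀ u {M v} → at (u ++ M ∷ v) (length u) ≡ M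
  at-length []      = refl
  at-length (a ∷ u) = at-length u

  rank-peak : ∀ u {M v} → Sorted u → All (_≤ M) u → Drops M v → rank (u ++ M ∷ v) ≡ length u ∸ M
  rank-peak u {M} {v} sorted u≤ d rewrite firstDescent-run u sorted u≤ d | at-length u {M} {v} = refl

  record Run (f : List ℕ) : Set where
    constructor run
    field
      {before}      : List ℕ
      {peak}        : ℕ
      {after}       : List ℕ
      decomposition : f ≡ before ++ peak ∷ after
      increasing    : Sorted before
      below-peak    : All (_≤ peak) before
      drops         : Drops peak after

  first-run : ∀ a e → Run (a ∷ e)
  first-run a []      = run {before = []} refl [] [] at-end
  first-run a (b ∷ e) with b <? a | first-run b e
  ... | yes b<a | _ = run {before = []} refl [] [] (drops-to b<a)
  ... | no b≮a | run {[]} refl _ _ d = run {before = a ∷ []} refl ([] ∷ []) (≮⇒≥ b≮a ∷ []) d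
  ... | no b≮a | run {_ ∷ u} refl (b≤ ∷ sorted) (b≤L ∷ u≤) d =
    run {before = a ∷ b ∷ u} refl ((a≤b ∷ All.map (≤-trans a≤b) b≤) ∷ b≤ ∷ sorted) (≤-trans a≤b b≤L ∷ b≤L ∷ u≤) d
    where a≤b = ≮⇒≥ b≮a

  open Run

  run-length : ∀ {f} (r : Run f) → runLength f ≡ suc (length (before r))
  run-length (run {[]}    refl sorted u≤ d) = cong suc (firstDescent-run [] sorted u≤ d)
  run-length (run {a ∷ u} refl sorted u≤ d) = cong suc (firstDescent-run (a ∷ u) sorted u≤ d)

  run-bound : ∀ {f} (r : Run f) → bound f ≡ suc (peak r)
  run-bound (run {[]} {L} {v} refl sorted u≤ d) = cong suc (cong (at (L ∷ v)) (firstDescent-run [] sorted u≤ d))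
  run-bound (run {a ∷ u} {L} {v} refl sorted u≤ d) = cong suc
    (trans (cong (at (a ∷ u ++ L ∷ v)) (firstDescent-run (a ∷ u) sorted u≤ d)) (at-length u))

  -- The peak, the smaller entry right after it and a later entry above the peak would form a 102.
  -- This makes the peak the maximum of all of `f` and ties the rank to the choice of a new maximum.
  after≤peak : ∀ {f} (r : Run f) → Avoiding f → All (_≤ peak r) (after r)
  after≤peak (run refl sorted u≤ at-end) av = []
  after≤peak (run {u} {L} refl sorted u≤ (drops-to a<L)) av = <⇒≤ a<L ∷ All.tabulate λ c∈ → ≮⇒≥ λ L<c →
    avoids av (++⁺ (minimum u) (refl ∷ refl ∷ from∈ c∈)) (102-pattern a<L L<c)

  take-++ˡ : ∀ i (xs : List ℕ) {ys} → i ≤ length xs → take i (xs ++ ys) ≡ take i xs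
  take-++ˡ zero    xs       i≤       = refl
  take-++ˡ (suc i) (a ∷ xs) (s≤s i≤) = cong (a ∷_) (take-++ˡ i xs i≤)

  Sorted-∷ʳ : ∀ {u L} → Sorted u → All (_≤ L) u → Sorted (u ++ [ L ])
  Sorted-∷ʳ sorted u≤ = AllPairsₚ.++⁺ sorted ([] ∷ []) (All.map (λ p → p ∷ []) u≤)

  Sorted-take : ∀ f i → i ≤ runLength f → Sorted (take i f)
  Sorted-take []      zero i≤ = []
  Sorted-take (a ∷ e) i    i≤ with first-run a e
  ... | r@(run {u} {L} {v} eq sorted u≤ d) = subst Sorted
    (sym (trans (cong (take i) (trans eq (sym (Listₚ.++-assoc u [ L ] v))))
           (take-++ˡ i (u ++ [ L ]) (subst (i ≤_) (trans (run-length r) (sym (trans (Listₚ.length-++ u) (+-comm (length u) 1)))) i≤))))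
    (AllPairsₚ.take⁺ i (Sorted-∷ʳ sorted u≤))

  runLength≤length : ∀ f → runLength f ≤ length f
  runLength≤length []      = z≤n
  runLength≤length (a ∷ e) with first-run a e
  ... | r@(run {u} {L} {v} eq sorted u≤ d) = subst₂ _≤_ (sym (run-length r))
    (sym (trans (cong length eq) (trans (Listₚ.length-++ u) (+-suc (length u) (length v)))))
    (s≤s (m≤m+n (length u) (length v)))

  All-<bound : ∀ f → Avoiding f → All (_< bound f) f
  All-<bound []      av = []
  All-<bound (a ∷ e) av with first-run a e
  ... | r@(run {u} {L} {v} eq sorted u≤ d) = subst₂ (λ b xs → All (_< b) xs) (sym (run-bound r)) (sym eq)
    (All.map s≤s (Allₚ.++⁺ u≤ (≤-refl ∷ after≤peak r av)))

  bound≤runLength : ∀ f → InvFrom 0 f → bound f ≤ runLength f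
  bound≤runLength []      inv = z≤n
  bound≤runLength (a ∷ e) inv = s≤s (InvFrom-at (a ∷ e) _ inv)

  bound≤ : ∀ f {M} → All (_< M) f → bound f ≤ M
  bound≤ []      f< = z≤n
  bound≤ (a ∷ e) {M} f< with first-run a e
  ... | r@(run {u} eq sorted u≤ d) = subst (_≤ M) (sym (run-bound r))
    (All.lookup (subst (All _) eq f<) (∈-++⁺ʳ u (here refl)))

  -- A sorted prefix cannot run past the first descent. This turns the sortedness forced by
  -- avoidance into the room condition on codes.
  length≤runLength : ∀ u {v} → Sorted u → length u ≤ runLength (u ++ v)
  length≤runLength []          sorted = z≤n
  length≤runLength (a ∷ [])    sorted = s≤s z≤n
  length≤runLength (a ∷ b ∷ u) ((a≤b ∷ _) ∷ sorted) with b <ᵇ a in eq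
  ... | true  = ⊥-elim (≤⇒≯ a≤b (<ᵇ⇒< b a (subst T (sym eq) tt)))
  ... | false = s≤s (length≤runLength (b ∷ u) sorted)

  -- Inserting a new maximum once or twice

  record Good (n m : ℕ) (e : List ℕ) : Set where
    constructor good
    field
      inv    : InvFrom 0 e
      len    : length e ≡ n
      avoid  : Avoiding e
      values : dist e ≡ m
  open Good

  length-insert : ∀ (u : List ℕ) {M v} → length (u ++ M ∷ v) ≡ suc (length (u ++ v))
  length-insert []      = refl
  length-insert (a ∷ u) = cong suc (length-insert u)

  -- Here `r` is the rank that the first copy alone would give and `d` the number of entries between
  -- the copies. For `d = 0` the second copy still belongs to the run and moves its end one position
  -- to the right.
  doubleRank : ℕ → ℕ → ℕ
  doubleRank r zero    = suc r
  doubleRank r (suc d) = r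

  module _ {M : ℕ} (u v : List ℕ) (u< : All (_< M) u) (v< : All (_< M) v) where
    private
      smaller-single : smaller M (u ++ M ∷ v) ≡ u ++ v
      smaller-single = trans (smaller-insert M u v) (cong₂ _++_ (smaller-all u<) (smaller-all v<))

      dist-single : dist (u ++ M ∷ v) ≡ suc (dist (u ++ v))
      dist-single = trans (dist-insert (u ++ M ∷ v) (∈-++⁺ʳ u (here refl)) (Allₚ.++⁺ (All.map <⇒≤ u<) (≤-refl ∷ All.map <⇒≤ v<)))
        (cong (suc ∘ dist) smaller-single)

    single-good : ∀ {n m} → Good n m (u ++ v) → M ≤ length u → Sorted u → Good (suc n) (suc m) (u ++ M ∷ v)
    single-good g M≤ sorted = good
      (InvFrom-insert u (inv g) M≤)
      (trans (length-insert u) (cong suc (len g)))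
      (Avoiding-insert u (All.map <⇒≤ u<) v< (subst Sorted (sym (smaller-all u<)) sorted)
        (λ p → <-irrefl refl (All.lookup u< (to∈ p)))
        (subst (λ u′ → Avoiding (u′ ++ v)) (sym (smaller-all u<)) (avoid g)))
      (trans dist-single (cong suc (values g)))

    single-parent : ∀ {n m} → Good (suc n) (suc m) (u ++ M ∷ v) → Good n m (u ++ v) × M ≤ length u × Sorted u
    single-parent g with InvFrom-delete u (inv g) (All.map <⇒≤ v<)
    ... | i , M≤ = good i (suc-injective (trans (sym (length-insert u)) (len g)))
                     (Avoiding-⊆ (++⁺ ⊆-refl (M ∷ʳ ⊆-refl)) (avoid g))
                     (suc-injective (trans (sym dist-single) (values g)))
                 , M≤ , subst Sorted (smaller-all u<) (Avoiding-sorted u (avoid g))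

    rank-single : Sorted u → rank (u ++ M ∷ v) ≡ length u ∸ M
    rank-single sorted = rank-peak u sorted (All.map <⇒≤ u<) (Drops-all v<)

  module _ {M : ℕ} (u v t : List ℕ) (u< : All (_< M) u) (v< : All (_< M) v) (t< : All (_< M) t) where
    private
      child : List ℕ
      child = u ++ M ∷ (v ++ M ∷ t)

      assoc : child ≡ (u ++ M ∷ v) ++ M ∷ t
      assoc = sym (Listₚ.++-assoc u (M ∷ v) (M ∷ t))

      smaller-head : smaller M (u ++ M ∷ v) ≡ u ++ v
      smaller-head = trans (smaller-insert M u v) (cong₂ _++_ (smaller-all u<) (smaller-all v<))

      smaller-double : smaller M child ≡ u ++ v ++ t
      smaller-double = trans (smaller-insert M u (v ++ M ∷ t)) (cong₂ _++_ (smaller-all u<)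
        (trans (smaller-insert M v t) (cong₂ _++_ (smaller-all v<) (smaller-all t<))))

      tail≤ : All (_≤ M) (v ++ M ∷ t)
      tail≤ = Allₚ.++⁺ (All.map <⇒≤ v<) (≤-refl ∷ All.map <⇒≤ t<)

      dist-double : dist child ≡ suc (dist (u ++ v ++ t))
      dist-double = trans (dist-insert child (∈-++⁺ʳ u (here refl)) (Allₚ.++⁺ (All.map <⇒≤ u<) (≤-refl ∷ tail≤)))
        (cong (suc ∘ dist) smaller-double)

      length-double : length child ≡ suc (suc (length (u ++ v ++ t)))
      length-double = trans (length-insert u) (cong suc
        (trans (cong length (sym (Listₚ.++-assoc u v (M ∷ t)))) (trans (length-insert (u ++ v))
          (cong (suc ∘ length) (Listₚ.++-assoc u v t)))))

      once : ¬ (M ∷ M ∷ [] ⊆ u ++ M ∷ v)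
      once p = <-irrefl refl (All.lookup u< (to∈ (⊆-before-last [ M ] u v< p)))

    double-good : ∀ {n m} → Good n m (u ++ v ++ t) → M ≤ length u → Sorted (u ++ v) → Good (suc (suc n)) (suc m) child
    double-good g M≤ sorted = good
      (InvFrom-insert u (subst (InvFrom 0) (Listₚ.++-assoc u v (M ∷ t))
        (InvFrom-insert (u ++ v) (subst (InvFrom 0) (sym (Listₚ.++-assoc u v t)) (inv g))
          (≤-trans M≤ (subst (length u ≤_) (sym (Listₚ.length-++ u)) (m≤m+n _ _))))) M≤)
      (trans length-double (cong (suc ∘ suc) (len g)))
      (subst Avoiding (sym assoc) (Avoiding-insert (u ++ M ∷ v) (Allₚ.++⁺ (All.map <⇒≤ u<) (≤-refl ∷ All.map <⇒≤ v<)) t<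
        (subst Sorted (sym smaller-head) sorted) once
        (subst Avoiding (sym (trans (cong (_++ t) smaller-head) (Listₚ.++-assoc u v t))) (avoid g))))
      (trans dist-double (cong suc (values g)))

    double-parent : ∀ {n m} → Good (suc (suc n)) (suc m) child → Good n m (u ++ v ++ t) × M ≤ length u × Sorted (u ++ v)
    double-parent g with InvFrom-delete u (inv g) tail≤
    ... | i , M≤ with InvFrom-delete (u ++ v) (subst (InvFrom 0) (sym (Listₚ.++-assoc u v (M ∷ t))) i) (All.map <⇒≤ t<)
    ... | i′ , _ = good (subst (InvFrom 0) (Listₚ.++-assoc u v t) i′)
                     (suc-injective (suc-injective (trans (sym length-double) (len g))))
                     (Avoiding-⊆ (++⁺ ⊆-refl (M ∷ʳ ++⁺ ⊆-refl (M ∷ʳ ⊆-refl))) (avoid g))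
                     (suc-injective (trans (sym dist-double) (values g)))
                 , M≤ , subst Sorted smaller-head (Avoiding-sorted (u ++ M ∷ v) (subst Avoiding assoc (avoid g)))

    rank-double : M ≤ length u → Sorted u → rank child ≡ doubleRank (length u ∸ M) (length v)
    rank-double M≤ sorted = go v v<
      where
      go : ∀ v → All (_< M) v → rank (u ++ M ∷ (v ++ M ∷ t)) ≡ doubleRank (length u ∸ M) (length v)
      go []      []        = trans
        (cong rank (sym (Listₚ.++-assoc u [ M ] (M ∷ t))))
        (trans (rank-peak (u ++ [ M ]) (Sorted-∷ʳ sorted (All.map <⇒≤ u<)) (Allₚ.++⁺ (All.map <⇒≤ u<) (≤-refl ∷ [])) (Drops-all t<))
          (trans (cong (_∸ M) (trans (Listₚ.length-++ u) (+-comm (length u) 1))) (+-∸-assoc 1 M≤)))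
      go (a ∷ _) (a<M ∷ _) = rank-peak u sorted (All.map <⇒≤ u<) (drops-to a<M)

  last-maximum : ∀ a e → ∃ λ u → ∃₂ λ M v → a ∷ e ≡ u ++ M ∷ v × All (_≤ M) u × All (_< M) v
  last-maximum a []      = [] , a , [] , refl , [] , []
  last-maximum a (b ∷ e) with last-maximum b e
  ... | u , M , v , eq , u≤ , v< with a ≤? M
  ... | yes a≤M = a ∷ u , M , v , cong (a ∷_) eq , a≤M ∷ u≤ , v<
  ... | no a≰M  = [] , a , b ∷ e , refl , [] ,
    subst (All (_< a)) (sym eq) (All.map (λ p → ≤-<-trans p (≰⇒> a≰M)) (Allₚ.++⁺ u≤ (≤-refl ∷ All.map <⇒≤ v<)))

  first-maximum : ∀ M u → All (_≤ M) u → All (_< M) u ⊎ ∃₂ λ u₁ u₂ → u ≡ u₁ ++ M ∷ u₂ × All (_< M) u₁ × All (_≤ M) u₂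
  first-maximum M []      []         = inj₁ []
  first-maximum M (a ∷ u) (a≤M ∷ u≤) with m≤n⇒m<n∨m≡n a≤M | first-maximum M u u≤
  ... | inj₂ refl | _                                 = inj₂ ([] , u , refl , [] , u≤)
  ... | inj₁ a<M  | inj₁ u<                           = inj₁ (a<M ∷ u<)
  ... | inj₁ a<M  | inj₂ (u₁ , u₂ , refl , u₁< , u₂≤) = inj₂ (a ∷ u₁ , u₂ , refl , a<M ∷ u₁< , u₂≤)

  data Origin (n m : ℕ) (e : List ℕ) : Set where
    single : ∀ {n′} M u v → n ≡ suc n′ → e ≡ u ++ M ∷ v → All (_< M) u → All (_< M) v →
      Good n′ m (u ++ v) → M ≤ length u → Sorted u → Origin n m e
    double : ∀ {n′} M u v t → n ≡ suc (suc n′) → e ≡ u ++ M ∷ (v ++ M ∷ t) → All (_< M) u → All (_< M) v → All (_< M) t →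
      Good n′ m (u ++ v ++ t) → M ≤ length u → Sorted (u ++ v) → Origin n m e

  origin : ∀ {n m e} → Good n (suc m) e → Origin n m e
  origin {e = []}    g with () ← values g
  origin {e = a ∷ e} g with last-maximum a e
  ... | u , M , v , eq , u≤ , v< with first-maximum M u u≤
  ... | inj₁ u< rewrite eq with trans (sym (len g)) (length-insert u)
  ... | refl = let g′ , M≤ , sorted = single-parent u v u< v< g in single M u v refl refl u< v< g′ M≤ sorted
  origin {e = a ∷ e} g | u , M , v , eq , u≤ , v< | inj₂ (u₁ , u₂ , refl , u₁< , u₂≤)
    rewrite trans eq (Listₚ.++-assoc u₁ (M ∷ u₂) (M ∷ v))
    with trans (sym (len g)) (trans (length-insert u₁) (cong suc
           (trans (cong length (sym (Listₚ.++-assoc u₁ u₂ (M ∷ v)))) (length-insert (u₁ ++ u₂)))))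
  ... | refl = let g′ , M≤ , sorted = double-parent u₁ u₂ v u₁< u₂< v< g
               in double M u₁ u₂ v refl refl u₁< u₂< v< g′ M≤ sorted
    where
    -- A copy of `M` in `u₂` would be the second of three, hence a 000.
    u₂< : All (_< M) u₂
    u₂< = All.tabulate λ a∈ → ≤∧≢⇒< (All.lookup u₂≤ a∈) λ { refl →
      Avoiding-once (u₁ ++ M ∷ u₂) (subst Avoiding (sym (Listₚ.++-assoc u₁ (M ∷ u₂) (M ∷ v))) (avoid g))
        (++⁺ (minimum u₁) (refl ∷ from∈ a∈)) }

  -- Kernels of the recurrence and codes of insertions

  triangle : ℕ → ℕ
  triangle zero    = 0
  triangle (suc n) = suc n + triangle n

  pairs : ℕ → List (ℕ × ℕ)
  pairs zero    = []
  pairs (suc k) = map (λ c → c , k ∸ c) (upTo (suc k)) ++ pairs k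

  length-pairs : ∀ k → length (pairs k) ≡ triangle k
  length-pairs zero    = refl
  length-pairs (suc k) = trans (Listₚ.length-++ (map (λ c → c , k ∸ c) (upTo (suc k))))
    (cong₂ _+_ (trans (Listₚ.length-map _ (upTo (suc k))) (Listₚ.length-upTo (suc k))) (length-pairs k))

  ∈-pairs⁻ : ∀ k {c d} → (c , d) ∈ pairs k → c + d < k
  ∈-pairs⁻ (suc k) p with ∈-++⁻ (map (λ c → c , k ∸ c) (upTo (suc k))) p
  ... | inj₂ q = m<n⇒m<1+n (∈-pairs⁻ k q)
  ... | inj₁ q with ∈-map⁻ (λ c → c , k ∸ c) q
  ... | c , c∈ , refl = s≤s (≤-reflexive (m+[n∸m]≡n (≤-pred (∈-upTo⁻ c∈))))

  ∈-pairs⁺ : ∀ k {c d} → c + d < k → (c , d) ∈ pairs k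
  ∈-pairs⁺ (suc k) {c} {d} (s≤s c+d≤k) with m≤n⇒m<n∨m≡n c+d≤k
  ... | inj₁ c+d<k = ∈-++⁺ʳ (map (λ c → c , k ∸ c) (upTo (suc k))) (∈-pairs⁺ k c+d<k)
  ... | inj₂ refl  = ∈-++⁺ˡ (subst (λ d′ → (c , d′) ∈ map (λ c′ → c′ , (c + d) ∸ c′) (upTo (suc (c + d)))) (m+n∸m≡n c d)
    (∈-map⁺ (λ c′ → c′ , (c + d) ∸ c′) (∈-upTo⁺ (s≤s (m≤m+n c d)))))

  pairs-unique : ∀ k → Unique (pairs k)
  pairs-unique zero    = []
  pairs-unique (suc k) = Uniqueₚ.++⁺ (unique-map _ (Uniqueₚ.upTo⁺ (suc k)) λ _ _ → cong proj₁) (pairs-unique k) disjoint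
    where
    disjoint : ∀ {p} → p ∈ map (λ c → c , k ∸ c) (upTo (suc k)) × p ∈ pairs k → ⊥
    disjoint (p , q) with ∈-map⁻ (λ c → c , k ∸ c) p
    ... | c , c∈ , refl = <-irrefl (m+[n∸m]≡n (≤-pred (∈-upTo⁻ c∈))) (∈-pairs⁻ k q)

  adjacent : ℕ → ℕ → ℕ
  adjacent s zero    = 0
  adjacent s (suc t) = suc s ∸ t

  -- The numbers of children of rank t of a parent of rank s, with the new maximum inserted once and twice.
  N₁ N₂ : ℕ → ℕ → ℕ
  N₁ s t = suc s ∸ t
  N₂ s t = adjacent s t + triangle (s ∸ t)

  -- A code `r , c , d` is admissible for a parent of rank `s` when `r + c + d ≤ s`, and its child
  -- has rank `doubleRank r d`. For target rank `t` this forces `r = t - 1` if `d = 0` and `r = t`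
  -- otherwise; the pairs used in `separatedCodes` hold the gap less one.
  adjacentCodes : ℕ → ℕ → List (ℕ × ℕ × ℕ)
  adjacentCodes s zero    = []
  adjacentCodes s (suc r) = map (λ c → r , c , 0) (upTo (suc s ∸ r))

  separatedCodes : ℕ → ℕ → List (ℕ × ℕ × ℕ)
  separatedCodes s t = map (λ (c , d) → t , c , suc d) (pairs (s ∸ t))

  doubleCodes : ℕ → ℕ → List (ℕ × ℕ × ℕ)
  doubleCodes s t = adjacentCodes s t ++ separatedCodes s t

  length-doubleCodes : ∀ s t → length (doubleCodes s t) ≡ N₂ s t
  length-doubleCodes s t = trans (Listₚ.length-++ (adjacentCodes s t)) (cong₂ _+_ (adj t)
    (trans (Listₚ.length-map _ (pairs (s ∸ t))) (length-pairs (s ∸ t))))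
    where
    adj : ∀ t → length (adjacentCodes s t) ≡ adjacent s t
    adj zero    = refl
    adj (suc r) = trans (Listₚ.length-map _ (upTo (suc s ∸ r))) (Listₚ.length-upTo (suc s ∸ r))

  <∸⇒+< : ∀ {a} t {c} → c < a ∸ t → t + c < a
  <∸⇒+<         zero    p = p
  <∸⇒+< {suc a} (suc t) p = s≤s (<∸⇒+< t p)

  +<⇒<∸ : ∀ {a} t {c} → t + c < a → c < a ∸ t
  +<⇒<∸         zero    p       = p
  +<⇒<∸ {suc a} (suc t) (s≤s p) = +<⇒<∸ t p

  doubleCodes-unique : ∀ s t → Unique (doubleCodes s t)
  doubleCodes-unique s t = Uniqueₚ.++⁺ (adj t)
    (unique-map _ (pairs-unique (s ∸ t)) λ { _ _ refl → refl }) (disjoint t)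
    where
    adj : ∀ t → Unique (adjacentCodes s t)
    adj zero    = []
    adj (suc r) = unique-map _ (Uniqueₚ.upTo⁺ (suc s ∸ r)) λ { _ _ refl → refl }
    disjoint : ∀ t {p} → p ∈ adjacentCodes s t × p ∈ separatedCodes s t → ⊥
    disjoint (suc r) (p , q) with ∈-map⁻ _ p | ∈-map⁻ _ q
    ... | _ , _ , refl | _ , _ , ()

  ∈-doubleCodes⁻ : ∀ s t {r c d} → (r , c , d) ∈ doubleCodes s t → r + c + d ≤ s × doubleRank r d ≡ t
  ∈-doubleCodes⁻ s t p with ∈-++⁻ (adjacentCodes s t) p
  ∈-doubleCodes⁻ s (suc r) p | inj₁ q with ∈-map⁻ _ q
  ... | c , c∈ , refl = subst (_≤ s) (sym (+-identityʳ (r + c))) (≤-pred (<∸⇒+< r (∈-upTo⁻ c∈))) , refl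
  ∈-doubleCodes⁻ s t p | inj₂ q with ∈-map⁻ _ q
  ... | (c , d) , cd∈ , refl = subst (_≤ s) (trans (sym (+-suc t (c + d))) (trans (cong (t +_) (sym (+-suc c d))) (sym (+-assoc t c (suc d)))))
      (<∸⇒+< t (∈-pairs⁻ (s ∸ t) cd∈)) , refl

  ∈-doubleCodes⁺ : ∀ s {r c} d → r + c + d ≤ s → (r , c , d) ∈ doubleCodes s (doubleRank r d)
  ∈-doubleCodes⁺ s {r} {c} zero    p = ∈-++⁺ˡ (∈-map⁺ (λ c → r , c , 0) (∈-upTo⁺ (+<⇒<∸ r (s≤s (subst (_≤ s) (+-identityʳ (r + c)) p)))))
  ∈-doubleCodes⁺ s {r} {c} (suc d) p = ∈-++⁺ʳ (adjacentCodes s r) (∈-map⁺ _ (∈-pairs⁺ (s ∸ r) (+<⇒<∸ r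
    (subst (_≤ s) (trans (+-assoc r c (suc d)) (trans (cong (r +_) (+-suc c d)) (+-suc r (c + d)))) p))))

  -- Children: soundness, injectivity and completeness of the codes

  fits : ∀ {n m f k} → Good n m f → k ≤ rank f → bound f + k ≤ runLength f
  fits {f = f} {k} g k≤ = subst (bound f + k ≤_) (m+[n∸m]≡n (bound≤runLength f (inv g)))
    (+-monoʳ-≤ (bound f) (subst (k ≤_) (rank-run f) k≤))

  fits⁻ : ∀ {n m f k} → Good n m f → bound f + k ≤ runLength f → k ≤ rank f
  fits⁻ {f = f} {k} g p = subst (k ≤_) (sym (rank-run f))
    (+-cancelˡ-≤ (bound f) _ _ (subst (bound f + k ≤_) (sym (m+[n∸m]≡n (bound≤runLength f (inv g)))) p))

  take-take-drop : ∀ i d (f : List ℕ) → take i f ++ take d (drop i f) ≡ take (i + d) f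
  take-take-drop zero    d f       = refl
  take-take-drop (suc i) d []      = cong ([] ++_) (Listₚ.take-[] d)
  take-take-drop (suc i) d (a ∷ f) = cong (a ∷_) (take-take-drop i d f)

  insert₁ : ℕ → ℕ → List ℕ → List ℕ
  insert₁ i M f = take i f ++ M ∷ drop i f

  insert₂ : ℕ → ℕ → ℕ → List ℕ → List ℕ
  insert₂ i d M f = take i f ++ M ∷ (take d (drop i f) ++ M ∷ drop d (drop i f))

  insert₁-++ : ∀ {i M M′} u v → i ≡ length u → M ≡ M′ → insert₁ i M (u ++ v) ≡ u ++ M′ ∷ v
  insert₁-++ []      v refl refl = refl
  insert₁-++ (a ∷ u) v refl refl = cong (a ∷_) (insert₁-++ u v refl refl)

  insert₂-++ : ∀ {i d M M′} u v t → i ≡ length u → d ≡ length v → M ≡ M′ → insert₂ i d M (u ++ v ++ t) ≡ u ++ M′ ∷ (v ++ M′ ∷ t)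
  insert₂-++ {M = M} []      v t refl refl refl = cong (M ∷_) (insert₁-++ v t refl refl)
  insert₂-++ (a ∷ u) v t refl refl refl = cong (a ∷_) (insert₂-++ u v t refl refl refl)

  -- `M` is the maximum of the whole list and `u` is what precedes its first occurrence, so both can
  -- be read off the list.
  insert-injective : ∀ {M M′} u u′ {v v′} → All (_< M) u → All (_< M′) u′ → All (_≤ M) v → All (_≤ M′) v′ →
    u ++ M ∷ v ≡ u′ ++ M′ ∷ v′ → M ≡ M′ × u ≡ u′ × v ≡ v′
  insert-injective {M} {M′} u u′ {v} {v′} u< u′< v≤ v′≤ eq = M≡M′ , same u u′ u< (subst (λ K → All (_< K) u′) (sym M≡M′) u′<)
      (trans eq (cong (λ K → u′ ++ K ∷ v′) (sym M≡M′)))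
    where
    M≡M′ : M ≡ M′
    M≡M′ = ≤-antisym
      (All.lookup (subst (All (_≤ M′)) (sym eq) (Allₚ.++⁺ (All.map <⇒≤ u′<) (≤-refl ∷ v′≤))) (∈-++⁺ʳ u (here refl)))
      (All.lookup (subst (All (_≤ M)) eq (Allₚ.++⁺ (All.map <⇒≤ u<) (≤-refl ∷ v≤))) (∈-++⁺ʳ u′ (here refl)))
    same : ∀ {M} u u′ {v v′} → All (_< M) u → All (_< M) u′ → u ++ M ∷ v ≡ u′ ++ M ∷ v′ → u ≡ u′ × v ≡ v′
    same []      []       _        _         refl = refl , refl
    same []      (a ∷ u′) _        (a< ∷ _)  refl = ⊥-elim (<-irrefl refl a<)
    same (a ∷ u) []       (a< ∷ _) _         refl = ⊥-elim (<-irrefl refl a<)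
    same (a ∷ u) (b ∷ u′) (_ ∷ u<) (_ ∷ u′<) eq with Listₚ.∷-injective eq
    ... | refl , eq′ with same u u′ u< u′< eq′
    ... | refl , refl = refl , refl

  -- The new maximum is bound f + c, and r is the rank of the child, or one less if the maximum is doubled in place.
  child₁ : ℕ → List ℕ → ℕ → List ℕ
  child₁ r f c = insert₁ (bound f + c + r) (bound f + c) f

  child₂ : List ℕ → ℕ × ℕ × ℕ → List ℕ
  child₂ f (r , c , d) = insert₂ (bound f + c + r) d (bound f + c) f

  -- The room condition keeps the insertion inside the first run: the second copy goes to position
  -- `bound f + (r + c + d)` of `f`, which is at most `runLength f`. A single insertion is treated
  -- as `d = 0`.
  module Slot {n m f} (g : Good n m f) (r c d : ℕ) (room : r + c + d ≤ rank f) where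
    M i : ℕ
    M = bound f + c
    i = M + r
    u v t : List ℕ
    u = take i f
    v = take d (drop i f)
    t = drop d (drop i f)

    f< : All (_< M) f
    f< = All.map (λ p → ≤-trans p (m≤m+n (bound f) c)) (All-<bound f (avoid g))
    u< : All (_< M) u
    u< = Allₚ.take⁺ i f<
    rest< : All (_< M) (drop i f)
    rest< = Allₚ.drop⁺ i f<
    v< : All (_< M) v
    v< = Allₚ.take⁺ d rest<
    t< : All (_< M) t
    t< = Allₚ.drop⁺ d rest<

    i+d≤ : i + d ≤ runLength f
    i+d≤ = subst (_≤ runLength f)
      (trans (sym (+-assoc (bound f) (r + c) d))
        (cong (_+ d) (trans (cong (bound f +_) (+-comm r c)) (sym (+-assoc (bound f) c r)))))
      (fits g room)

    i≤ : i ≤ runLength f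
    i≤ = ≤-trans (m≤m+n i d) i+d≤

    length-take-run : ∀ k → k ≤ runLength f → length (take k f) ≡ k
    length-take-run k k≤ = trans (Listₚ.length-take k f) (m≤n⇒m⊓n≡m (≤-trans k≤ (runLength≤length f)))

    length-u : length u ≡ i
    length-u = length-take-run i i≤

    length-v : length v ≡ d
    length-v = +-cancelˡ-≡ i _ _ (trans (cong (_+ length v) (sym length-u))
      (trans (sym (Listₚ.length-++ u)) (trans (cong length (take-take-drop i d f)) (length-take-run (i + d) i+d≤))))

    M≤ : M ≤ length u
    M≤ = subst (M ≤_) (sym length-u) (m≤m+n M r)

    u-sorted : Sorted u
    u-sorted = Sorted-take f i i≤

    v++t : v ++ t ≡ drop i f
    v++t = Listₚ.take++drop≡id d (drop i f)

    u++v++t : u ++ v ++ t ≡ f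
    u++v++t = trans (cong (u ++_) v++t) (Listₚ.take++drop≡id i f)

    length-u∸M : length u ∸ M ≡ r
    length-u∸M = trans (cong (_∸ M) length-u) (m+n∸m≡n M r)

  child₁-sound : ∀ {n m f r c} → Good n m f → r + c ≤ rank f →
    Good (suc n) (suc m) (child₁ r f c) × rank (child₁ r f c) ≡ r
  child₁-sound {f = f} {r} {c} g room =
    single-good u (drop i f) u< rest< (subst (Good _ _) (sym (Listₚ.take++drop≡id i f)) g) M≤ u-sorted ,
    trans (rank-single u (drop i f) u< rest< u-sorted) length-u∸M
    where open Slot g r c 0 (subst (_≤ rank f) (sym (+-identityʳ (r + c))) room)

  child₂-sound : ∀ {n m f r c d} → Good n m f → r + c + d ≤ rank f →
    Good (suc (suc n)) (suc m) (child₂ f (r , c , d)) × rank (child₂ f (r , c , d)) ≡ doubleRank r d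
  child₂-sound {f = f} {r} {c} {d} g room =
    double-good u v t u< v< t< (subst (Good _ _) (sym u++v++t) g) M≤
      (subst Sorted (sym (take-take-drop i d f)) (Sorted-take f (i + d) i+d≤)) ,
    trans (rank-double u v t u< v< t< M≤ u-sorted) (cong₂ doubleRank length-u∸M length-v)
    where open Slot g r c d room

  child₁-injective : ∀ {n m f f′ r c c′} → Good n m f → Good n m f′ → r + c ≤ rank f → r + c′ ≤ rank f′ →
    child₁ r f c ≡ child₁ r f′ c′ → f ≡ f′ × c ≡ c′
  child₁-injective {f = f} {f′} {r} {c} {c′} g g′ room room′ eq =
    parents≡ , +-cancelˡ-≡ (bound f) c c′ (trans (proj₁ parts) (cong (λ h → bound h + c′) (sym parents≡)))
    where
    module S  = Slot g  r c  0 (subst (_≤ rank f)  (sym (+-identityʳ (r + c)))  room)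
    module S′ = Slot g′ r c′ 0 (subst (_≤ rank f′) (sym (+-identityʳ (r + c′))) room′)
    parts : S.M ≡ S′.M × S.u ≡ S′.u × drop S.i f ≡ drop S′.i f′
    parts = insert-injective S.u S′.u S.u< S′.u< (All.map <⇒≤ S.rest<) (All.map <⇒≤ S′.rest<) eq
    parents≡ : f ≡ f′
    parents≡ = trans (sym (Listₚ.take++drop≡id S.i f))
      (trans (cong₂ _++_ (proj₁ (proj₂ parts)) (proj₂ (proj₂ parts))) (Listₚ.take++drop≡id S′.i f′))

  child₂-injective : ∀ {n m f f′ r c d r′ c′ d′} → Good n m f → Good n m f′ → r + c + d ≤ rank f → r′ + c′ + d′ ≤ rank f′ →
    child₂ f (r , c , d) ≡ child₂ f′ (r′ , c′ , d′) → f ≡ f′ × (r , c , d) ≡ (r′ , c′ , d′)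
  child₂-injective {f = f} {f′} {r} {c} {d} {r′} {c′} {d′} g g′ room room′ eq = parents≡ , cong₂ _,_ r≡ (cong₂ _,_ c≡ d≡)
    where
    module S  = Slot g  r  c  d  room
    module S′ = Slot g′ r′ c′ d′ room′
    outer : S.M ≡ S′.M × S.u ≡ S′.u × S.v ++ S.M ∷ S.t ≡ S′.v ++ S′.M ∷ S′.t
    outer = insert-injective S.u S′.u S.u< S′.u<
      (Allₚ.++⁺ (All.map <⇒≤ S.v<) (≤-refl ∷ All.map <⇒≤ S.t<)) (Allₚ.++⁺ (All.map <⇒≤ S′.v<) (≤-refl ∷ All.map <⇒≤ S′.t<)) eq
    inner : S.M ≡ S′.M × S.v ≡ S′.v × S.t ≡ S′.t
    inner = insert-injective S.v S′.v S.v< S′.v< (All.map <⇒≤ S.t<) (All.map <⇒≤ S′.t<) (proj₂ (proj₂ outer))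
    parents≡ : f ≡ f′
    parents≡ = trans (sym S.u++v++t) (trans (cong₂ _++_ (proj₁ (proj₂ outer))
      (cong₂ _++_ (proj₁ (proj₂ inner)) (proj₂ (proj₂ inner)))) S′.u++v++t)
    r≡ : r ≡ r′
    r≡ = trans (sym S.length-u∸M) (trans (cong₂ _∸_ (cong length (proj₁ (proj₂ outer))) (proj₁ outer)) S′.length-u∸M)
    c≡ : c ≡ c′
    c≡ = +-cancelˡ-≡ (bound f) c c′ (trans (proj₁ outer) (cong (λ h → bound h + c′) (sym parents≡)))
    d≡ : d ≡ d′
    d≡ = trans (sym S.length-v) (trans (cong length (proj₁ (proj₂ inner))) S′.length-v)

  -- Behind its first maximum a single insertion has only smaller entries, a double one has another
  -- maximum.
  child₁≢child₂ : ∀ {n n′ m f f′ r c r′ c′ d′} → Good n m f → Good n′ m f′ → r + c ≤ rank f → r′ + c′ + d′ ≤ rank f′ →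
    child₁ r f c ≢ child₂ f′ (r′ , c′ , d′)
  child₁≢child₂ {f = f} {f′} {r} {c} {r′} {c′} {d′} g g′ room room′ eq =
    <-irrefl (sym (proj₁ parts)) (All.lookup S.rest< (subst (S′.M ∈_) (sym (proj₂ (proj₂ parts))) (∈-++⁺ʳ S′.v (here refl))))
    where
    module S  = Slot g  r c 0 (subst (_≤ rank f) (sym (+-identityʳ (r + c))) room)
    module S′ = Slot g′ r′ c′ d′ room′
    parts : S.M ≡ S′.M × S.u ≡ S′.u × drop S.i f ≡ S′.v ++ S′.M ∷ S′.t
    parts = insert-injective S.u S′.u S.u< S′.u< (All.map <⇒≤ S.rest<)
      (Allₚ.++⁺ (All.map <⇒≤ S′.v<) (≤-refl ∷ All.map <⇒≤ S′.t<)) eq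

  Sorted-++⁻ˡ : ∀ u {v} → Sorted (u ++ v) → Sorted u
  Sorted-++⁻ˡ []      sorted       = []
  Sorted-++⁻ˡ (a ∷ u) (p ∷ sorted) = Allₚ.++⁻ˡ u p ∷ Sorted-++⁻ˡ u sorted

  rotate : ∀ b r c → b + c + r ≡ b + (r + c)
  rotate b r c = trans (+-assoc b c r) (cong (b +_) (+-comm c r))

  -- The parameters are forced: `r` is the rank of the child and `c` the excess of `M` over the
  -- least new maximum. Being sorted, `u` lies within the first run of the parent, which gives the
  -- room condition.
  child₁-complete : ∀ {n m M} u v → Good n m (u ++ v) → All (_< M) (u ++ v) → M ≤ length u → Sorted u →
    ∃ λ c → (length u ∸ M) + c ≤ rank (u ++ v) × u ++ M ∷ v ≡ child₁ (length u ∸ M) (u ++ v) c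
  child₁-complete {M = M} u v g f< M≤ sorted = c , fits⁻ g (subst (_≤ runLength (u ++ v)) (trans (sym i≡) (rotate b r c)) (length≤runLength u sorted)) ,
    sym (insert₁-++ u v i≡ M≡)
    where
    b r c : ℕ
    b = bound (u ++ v)
    r = length u ∸ M
    c = M ∸ b
    M≡ : b + c ≡ M
    M≡ = m+[n∸m]≡n (bound≤ (u ++ v) f<)
    i≡ : b + c + r ≡ length u
    i≡ = trans (cong (_+ r) M≡) (m+[n∸m]≡n M≤)

  child₂-complete : ∀ {n m M} u v t → Good n m (u ++ v ++ t) → All (_< M) (u ++ v ++ t) → M ≤ length u → Sorted (u ++ v) →
    ∃ λ c → (length u ∸ M) + c + length v ≤ rank (u ++ v ++ t)
          × u ++ M ∷ (v ++ M ∷ t) ≡ child₂ (u ++ v ++ t) (length u ∸ M , c , length v)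
  child₂-complete {M = M} u v t g f< M≤ sorted = c , fits⁻ g (subst₂ _≤_ total≡ (cong runLength (Listₚ.++-assoc u v t)) (length≤runLength (u ++ v) sorted)) ,
    sym (insert₂-++ u v t i≡ refl M≡)
    where
    b r c : ℕ
    b = bound (u ++ v ++ t)
    r = length u ∸ M
    c = M ∸ b
    M≡ : b + c ≡ M
    M≡ = m+[n∸m]≡n (bound≤ (u ++ v ++ t) f<)
    i≡ : b + c + r ≡ length u
    i≡ = trans (cong (_+ r) M≡) (m+[n∸m]≡n M≤)
    total≡ : length (u ++ v) ≡ b + (r + c + length v)
    total≡ = trans (Listₚ.length-++ u) (trans (cong (_+ length v) (trans (sym i≡) (rotate b r c))) (+-assoc b (r + c) (length v)))

  -- The recurrence for `count`

  parents : ℕ → ℕ → List (List ℕ)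
  parents n m = filter (λ e → T? (avoids102-000 e ∧ (dist e ≡ᵇ m))) (invSeqs n)

  ranked : ℕ → ℕ → ℕ → List (List ℕ)
  ranked n m t = filter (λ e → T? (avoids102-000 e ∧ (dist e ≡ᵇ m) ∧ (rank e ≡ᵇ t))) (invSeqs n)

  ∈-ranked⁻ : ∀ {n m t e} → e ∈ ranked n m t → Good n m e × rank e ≡ t
  ∈-ranked⁻ {n} {m} {t} {e} e∈ with ∈-filter⁻ (λ e → T? (avoids102-000 e ∧ (dist e ≡ᵇ m) ∧ (rank e ≡ᵇ t))) {xs = invSeqs n} e∈
  ... | e∈′ , p with ∈-invSeqs⁻ n e∈′ | Equivalence.to (Boolₚ.T-∧ {avoids102-000 e}) p
  ... | i , l | av , q with Equivalence.to (Boolₚ.T-∧ {dist e ≡ᵇ m}) q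
  ... | d , r = good i l (avoids⇒Avoiding e av) (≡ᵇ⇒≡ (dist e) m d) , ≡ᵇ⇒≡ (rank e) t r

  ∈-ranked⁺ : ∀ {n m e} → Good n m e → e ∈ ranked n m (rank e)
  ∈-ranked⁺ {n} {m} {e} g = ∈-filter⁺ (λ e′ → T? (avoids102-000 e′ ∧ (dist e′ ≡ᵇ m) ∧ (rank e′ ≡ᵇ rank e)))
    (∈-invSeqs⁺ n (inv g) (len g))
    (Equivalence.from (Boolₚ.T-∧ {avoids102-000 e}) (Avoiding⇒avoids e (avoid g) ,
      Equivalence.from (Boolₚ.T-∧ {dist e ≡ᵇ m}) (≡⇒≡ᵇ (dist e) m (values g) , ≡⇒≡ᵇ (rank e) (rank e) refl)))

  ∈-parents⁻ : ∀ n m {e} → e ∈ parents n m → Good n m e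
  ∈-parents⁻ n m {e} e∈ with ∈-filter⁻ (λ e → T? (avoids102-000 e ∧ (dist e ≡ᵇ m))) {xs = invSeqs n} e∈
  ... | e∈′ , p with ∈-invSeqs⁻ n e∈′ | Equivalence.to (Boolₚ.T-∧ {avoids102-000 e}) p
  ... | i , l | av , d = good i l (avoids⇒Avoiding e av) (≡ᵇ⇒≡ (dist e) m d)

  ∈-parents⁺ : ∀ {n m e} → Good n m e → e ∈ parents n m
  ∈-parents⁺ {n} {m} {e} g = ∈-filter⁺ (λ e′ → T? (avoids102-000 e′ ∧ (dist e′ ≡ᵇ m))) (∈-invSeqs⁺ n (inv g) (len g))
    (Equivalence.from (Boolₚ.T-∧ {avoids102-000 e}) (Avoiding⇒avoids e (avoid g) , ≡⇒≡ᵇ (dist e) m (values g)))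

  parents-unique : ∀ n m → Unique (parents n m)
  parents-unique n m = Uniqueₚ.filter⁺ _ (invSeqs-unique n)

  ranked-unique : ∀ n m t → Unique (ranked n m t)
  ranked-unique n m t = Uniqueₚ.filter⁺ _ (invSeqs-unique n)

  singles : ℕ → ℕ → ℕ → List (List ℕ)
  singles n m t = concatMap (λ f → map (child₁ t f) (upTo (N₁ (rank f) t))) (parents n m)

  -- Indexed by the length of the parents of single insertions, so a double insertion starts from
  -- parents one entry shorter.
  doublesOf : ℕ → ℕ → ℕ → List (List ℕ)
  doublesOf zero    m t = []
  doublesOf (suc n) m t = concatMap (λ f → map (child₂ f) (doubleCodes (rank f) t)) (parents n m)

  single-room : ∀ s t {c} → c ∈ upTo (N₁ s t) → t + c ≤ s
  single-room s t c∈ = ≤-pred (<∸⇒+< t (∈-upTo⁻ c∈))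

  singles-unique : ∀ n m t → Unique (singles n m t)
  singles-unique n m t = unique-children (child₁ t) (λ f → upTo (N₁ (rank f) t)) (parents-unique n m) (λ f → Uniqueₚ.upTo⁺ _)
    λ {f} {f′} f∈ f′∈ c∈ c′∈ → child₁-injective (∈-parents⁻ n m f∈) (∈-parents⁻ n m f′∈) (single-room (rank f) t c∈) (single-room (rank f′) t c′∈)

  doublesOf-unique : ∀ n m t → Unique (doublesOf n m t)
  doublesOf-unique zero    m t = []
  doublesOf-unique (suc n) m t = unique-children child₂ (λ f → doubleCodes (rank f) t) (parents-unique n m) (λ f → doubleCodes-unique (rank f) t)
    λ {f} {f′} f∈ f′∈ p∈ p′∈ → child₂-injective (∈-parents⁻ n m f∈) (∈-parents⁻ n m f′∈)
      (proj₁ (∈-doubleCodes⁻ (rank f) t p∈)) (proj₁ (∈-doubleCodes⁻ (rank f′) t p′∈))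

  singles-doubles-disjoint : ∀ n m t {e} → e ∈ singles n m t × e ∈ doublesOf n m t → ⊥
  singles-doubles-disjoint (suc n) m t (p , q)
    with ∈-children⁻ (child₁ t) (λ f → upTo (N₁ (rank f) t)) {parents (suc n) m} p | ∈-children⁻ child₂ (λ f → doubleCodes (rank f) t) {parents n m} q
  ... | f , c , f∈ , c∈ , refl | f′ , code , f′∈ , code∈ , eq =
    child₁≢child₂ (∈-parents⁻ (suc n) m f∈) (∈-parents⁻ n m f′∈) (single-room (rank f) t c∈) (proj₁ (∈-doubleCodes⁻ (rank f′) t code∈)) eq

  ranked⇒child : ∀ {n m t e} → e ∈ ranked (suc n) (suc m) t → e ∈ singles n m t ++ doublesOf n m t
  ranked⇒child {n} {m} {t} {e} e∈ with ∈-ranked⁻ {suc n} {suc m} {t} {e} e∈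
  ... | g , refl with origin g
  ... | single M u v refl refl u< v< g′ M≤ sorted with child₁-complete u v g′ (Allₚ.++⁺ u< v<) M≤ sorted
  ... | c , room , eq rewrite rank-single u v u< v< sorted = ∈-++⁺ˡ (subst (_∈ singles n m (length u ∸ M)) (sym eq)
    (∈-children⁺ (child₁ (length u ∸ M)) (λ f → upTo (N₁ (rank f) (length u ∸ M))) (∈-parents⁺ g′) (∈-upTo⁺ (+<⇒<∸ (length u ∸ M) (s≤s room)))))
  ranked⇒child {n} {m} {t} {e} e∈ | g , refl | double M u v w refl refl u< v< w< g′ M≤ sorted
    with child₂-complete u v w g′ (Allₚ.++⁺ u< (Allₚ.++⁺ v< w<)) M≤ sorted
  ... | c , room , eq = ∈-++⁺ʳ (singles n m (rank e)) (subst (_∈ doublesOf n m (rank e)) (sym eq)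
    (∈-children⁺ child₂ (λ f → doubleCodes (rank f) (rank e)) (∈-parents⁺ g′)
      (subst (λ k → (length u ∸ M , c , length v) ∈ doubleCodes (rank (u ++ v ++ w)) k) (sym rank≡)
        (∈-doubleCodes⁺ (rank (u ++ v ++ w)) (length v) room))))
    where
    rank≡ : rank e ≡ doubleRank (length u ∸ M) (length v)
    rank≡ = rank-double u v w u< v< w< M≤ (Sorted-++⁻ˡ u sorted)

  child⇒ranked : ∀ {n m t e} → e ∈ singles n m t ++ doublesOf n m t → e ∈ ranked (suc n) (suc m) t
  child⇒ranked {n} {m} {t} e∈ with ∈-++⁻ (singles n m t) e∈
  ... | inj₁ p with ∈-children⁻ (child₁ t) (λ f → upTo (N₁ (rank f) t)) {parents n m} p
  ... | f , c , f∈ , c∈ , refl with child₁-sound (∈-parents⁻ n m f∈) (single-room (rank f) t c∈)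
  ... | g , eq = subst (λ k → child₁ t f c ∈ ranked (suc n) (suc m) k) eq (∈-ranked⁺ g)
  child⇒ranked {suc n} {m} {t} e∈ | inj₂ q with ∈-children⁻ child₂ (λ f → doubleCodes (rank f) t) {parents n m} q
  ... | f , code , f∈ , code∈ , refl with ∈-doubleCodes⁻ (rank f) t code∈
  ... | room , refl with child₂-sound (∈-parents⁻ n m f∈) room
  ... | g , eq = subst (λ k → child₂ f code ∈ ranked (suc (suc n)) (suc m) k) eq (∈-ranked⁺ g)

  count-children : ∀ n m t → count (suc n) (suc m) t ≡ length (singles n m t) + length (doublesOf n m t)
  count-children n m t = trans
    (length-unique (ranked-unique (suc n) (suc m) t)
      (Uniqueₚ.++⁺ (singles-unique n m t) (doublesOf-unique n m t) (singles-doubles-disjoint n m t))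
      (ranked⇒child {n} {m} {t}) (child⇒ranked {n} {m} {t}))
    (Listₚ.length-++ (singles n m t))

  sumℕ : ℕ → (ℕ → ℕ) → ℕ
  sumℕ zero    f = f 0
  sumℕ (suc n) f = f 0 + sumℕ n (f ∘ suc)

  sumℕ-cong : ∀ n {f g : ℕ → ℕ} → (∀ s → f s ≡ g s) → sumℕ n f ≡ sumℕ n g
  sumℕ-cong zero    p = p 0
  sumℕ-cong (suc n) p = cong₂ _+_ (p 0) (sumℕ-cong n (p ∘ suc))

  sumℕ-+ : ∀ n (f g : ℕ → ℕ) → sumℕ n (λ s → f s + g s) ≡ sumℕ n f + sumℕ n g
  sumℕ-+ zero    f g = refl
  sumℕ-+ (suc n) f g = trans (cong (f 0 + g 0 +_) (sumℕ-+ n (f ∘ suc) (g ∘ suc))) (interchange (f 0) (g 0) _ _)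

  sumℕ-zero : ∀ n {f : ℕ → ℕ} → (∀ s → f s ≡ 0) → sumℕ n f ≡ 0
  sumℕ-zero zero    p = p 0
  sumℕ-zero (suc n) p = cong₂ _+_ (p 0) (sumℕ-zero n (p ∘ suc))

  indicator : Bool → ℕ
  indicator true  = 1
  indicator false = 0

  sumℕ-indicator : ∀ n {r} (φ : ℕ → ℕ) → r ≤ n → sumℕ n (λ s → φ s * indicator (r ≡ᵇ s)) ≡ φ r
  sumℕ-indicator zero    {zero}  φ r≤ = *-identityʳ (φ 0)
  sumℕ-indicator (suc n) {zero}  φ r≤ = trans (cong₂ _+_ (*-identityʳ (φ 0)) (sumℕ-zero n λ s → *-zeroʳ (φ (suc s)))) (+-identityʳ (φ 0))
  sumℕ-indicator (suc n) {suc r} φ (s≤s r≤) = trans (cong (_+ sumℕ n (λ s → φ (suc s) * indicator (r ≡ᵇ s))) (*-zeroʳ (φ 0)))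
    (sumℕ-indicator n (φ ∘ suc) r≤)

  length-filter-∷ : ∀ {A : Set} (p : A → Bool) x xs →
    length (filter (λ e → T? (p e)) (x ∷ xs)) ≡ indicator (p x) + length (filter (λ e → T? (p e)) xs)
  length-filter-∷ p x xs with p x
  ... | true  = refl
  ... | false = refl

  weigh : (ℕ → ℕ) → List (List ℕ) → ℕ
  weigh φ []       = 0
  weigh φ (e ∷ es) = φ (rank e) + weigh φ es

  length-children : ∀ {B : Set} (f : List ℕ → B → List ℕ) (codes : List ℕ → List B) φ xs → (∀ e → length (codes e) ≡ φ (rank e)) →
    length (concatMap (λ e → map (f e) (codes e)) xs) ≡ weigh φ xs
  length-children f codes φ []       p = refl
  length-children f codes φ (x ∷ xs) p = trans (Listₚ.length-++ (map (f x) (codes x)))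
    (cong₂ _+_ (trans (Listₚ.length-map (f x) (codes x)) (p x)) (length-children f codes φ xs p))

  -- Groups the list by rank. The sum stops at `n`, which is where the bound on the ranks enters;
  -- for inversion sequences it comes from `rank≤length`.
  weigh-by-rank : ∀ n φ (p : List ℕ → Bool) xs → (∀ {e} → e ∈ xs → rank e ≤ n) →
    weigh φ (filter (λ e → T? (p e)) xs) ≡ sumℕ n (λ s → φ s * length (filter (λ e → T? (p e ∧ (rank e ≡ᵇ s))) xs))
  weigh-by-rank n φ p []       r≤ = sym (sumℕ-zero n λ s → *-zeroʳ (φ s))
  weigh-by-rank n φ p (x ∷ xs) r≤ = trans (trans head-term (cong₂ _+_ (first (p x)) (weigh-by-rank n φ p xs (r≤ ∘ there))))
    (trans (sym (sumℕ-+ n _ _)) (sumℕ-cong n λ s → trans (sym (*-distribˡ-+ (φ s) _ _))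
      (cong (φ s *_) (sym (length-filter-∷ (λ e → p e ∧ (rank e ≡ᵇ s)) x xs)))))
    where
    head-term : weigh φ (filter (λ e → T? (p e)) (x ∷ xs)) ≡ (if p x then φ (rank x) else 0) + weigh φ (filter (λ e → T? (p e)) xs)
    head-term with p x
    ... | true  = refl
    ... | false = refl
    first : ∀ b → (if b then φ (rank x) else 0) ≡ sumℕ n (λ s → φ s * indicator (b ∧ (rank x ≡ᵇ s)))
    first true  = sym (sumℕ-indicator n φ (r≤ (here refl)))
    first false = sym (sumℕ-zero n λ s → *-zeroʳ (φ s))

  rank≤length : ∀ e → rank e ≤ length e
  rank≤length e = subst (_≤ length e) (sym (rank-run e)) (≤-trans (m∸n≤m (runLength e) (bound e)) (runLength≤length e))

  rank≤ : ∀ n {e} → e ∈ invSeqs n → rank e ≤ n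
  rank≤ n {e} e∈ = subst (rank e ≤_) (proj₂ (∈-invSeqs⁻ n e∈)) (rank≤length e)

  weigh-parents : ∀ n m φ → weigh φ (parents n m) ≡ sumℕ n (λ s → φ s * count n m s)
  weigh-parents n m φ = trans (weigh-by-rank n φ (λ e → avoids102-000 e ∧ (dist e ≡ᵇ m)) (invSeqs n) (rank≤ n))
    (sumℕ-cong n λ s → cong (λ es → φ s * length es)
      (Listₚ.filter-≐ (λ e → T? ((avoids102-000 e ∧ (dist e ≡ᵇ m)) ∧ (rank e ≡ᵇ s)))
                      (λ e → T? (avoids102-000 e ∧ (dist e ≡ᵇ m) ∧ (rank e ≡ᵇ s)))
        ((λ {e} → subst T (Boolₚ.∧-assoc (avoids102-000 e) _ _)) , (λ {e} → subst T (sym (Boolₚ.∧-assoc (avoids102-000 e) _ _))))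
        (invSeqs n)))

  doubles : ℕ → ℕ → ℕ → ℕ
  doubles zero    m t = 0
  doubles (suc n) m t = sumℕ n λ s → N₂ s t * count n m s

  -- Both kinds of insertion add one value, hence the common factor `y` later on; they add one and
  -- two entries, hence the factors `x` and `x^2`.
  count-ss : ∀ n m t → count (suc n) (suc m) t ≡ sumℕ n (λ s → N₁ s t * count n m s) + doubles n m t
  count-ss n m t = trans (count-children n m t) (cong₂ _+_
    (trans (length-children (child₁ t) (λ f → upTo (N₁ (rank f) t)) (λ s → N₁ s t) (parents n m) (λ f → Listₚ.length-upTo _))
      (weigh-parents n m (λ s → N₁ s t)))
    (second n))
    where
    second : ∀ n → length (doublesOf n m t) ≡ doubles n m t
    second zero    = refl
    second (suc n) = trans (length-children child₂ (λ f → doubleCodes (rank f) t) (λ s → N₂ s t) (parents n m) (λ f → length-doubleCodes (rank f) t))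
      (weigh-parents n m (λ s → N₂ s t))

  empty : ∀ {A : Set} (xs : List A) → (∀ {a} → ¬ a ∈ xs) → length xs ≡ 0
  empty []       p = refl
  empty (x ∷ xs) p = ⊥-elim (p (here refl))

  count-rank : ∀ n m s → n < s → count n m s ≡ 0
  count-rank n m s n<s = empty (ranked n m s) λ {e} e∈ → let g , r = ∈-ranked⁻ {n} {m} {s} e∈ in
    <⇒≱ n<s (subst₂ _≤_ r (len g) (rank≤length e))

  count-000 : count 0 0 0 ≡ 1
  count-000 = refl

  count-00s : ∀ t → count 0 0 (suc t) ≡ 0
  count-00s t = refl

  count-0s : ∀ m t → count 0 (suc m) t ≡ 0
  count-0s m t = refl

  count-s0 : ∀ n t → count (suc n) 0 t ≡ 0
  count-s0 n t = empty (ranked (suc n) 0 t) λ {e} e∈ → nonempty (proj₁ (∈-ranked⁻ {suc n} {0} {t} e∈))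
    where
    nonempty : ∀ {e} → ¬ Good (suc n) 0 e
    nonempty {[]}    g with () ← len g
    nonempty {a ∷ e} g with () ← values g

open import Data.Integer using (+_)

module GeneratingFunction where

  open Counting using (sumℕ; triangle; N₁; N₂; doubles; count-rank; count-000; count-00s; count-s0; count-0s; count-ss)
  open import Data.Nat as ℕ using (ℕ; zero; suc; _∸_; z≤n; s≤s; _≡ᵇ_; _⊔_)
  import Data.Nat.Properties as ℕₚ
  open import Data.Integer as ℤ using (ℤ)
  import Data.Integer.Properties as ℤₚ

  -- Rings of formal power series

  module PowerSeries {c ℓ} (R : CommutativeRing c ℓ) where
    open CommutativeRing R hiding (zero)
    open Algebra.Properties.CommutativeSemigroup +-commutativeSemigroup using (interchange)
    open Relation.Binary.Reasoning.Setoid setoid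

    Series : Set c
    Series = ℕ → Carrier

    infix 4 _≐_
    _≐_ : Series → Series → Set ℓ
    f ≐ g = ∀ n → f n ≈ g n

    tail : Series → Series
    tail f n = f (suc n)

    -- The Cauchy product by recursion on the first factor. No subtraction of indices occurs, so the
    -- ring laws follow by induction on the degree.
    conv : Series → Series → Series
    conv f g zero    = f 0 * g 0
    conv f g (suc n) = f 0 * g (suc n) + conv (tail f) g n

    one : Series
    one zero    = 1#
    one (suc _) = 0#

    conv-cong : ∀ {f f′ g g′} → f ≐ f′ → g ≐ g′ → conv f g ≐ conv f′ g′
    conv-cong p q zero    = *-cong (p 0) (q 0)
    conv-cong p q (suc n) = +-cong (*-cong (p 0) (q (suc n))) (conv-cong (p ∘ suc) q n)

    conv-zeroˡ : ∀ {f} g → (∀ n → f n ≈ 0#) → ∀ n → conv f g n ≈ 0#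
    conv-zeroˡ g f≈0 zero    = trans (*-congʳ (f≈0 0)) (zeroˡ _)
    conv-zeroˡ g f≈0 (suc n) = trans
      (+-cong (trans (*-congʳ (f≈0 0)) (zeroˡ _)) (conv-zeroˡ g (f≈0 ∘ suc) n)) (+-identityˡ _)

    conv-headˡ : ∀ {f} g → (∀ n → f (suc n) ≈ 0#) → ∀ n → conv f g n ≈ f 0 * g n
    conv-headˡ g f≈0 zero    = refl
    conv-headˡ g f≈0 (suc n) = trans (+-congˡ (conv-zeroˡ g f≈0 n)) (+-identityʳ _)

    conv-identityˡ : ∀ g → conv one g ≐ g
    conv-identityˡ g n = trans (conv-headˡ g (λ _ → refl) n) (*-identityˡ _)

    conv-lastʳ : ∀ f g n → conv f g (suc n) ≈ conv f (tail g) n + f (suc n) * g 0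
    conv-lastʳ f g zero    = refl
    conv-lastʳ f g (suc n) = trans (+-congˡ (conv-lastʳ (tail f) g n)) (sym (+-assoc _ _ _))

    conv-comm : ∀ f g → conv f g ≐ conv g f
    conv-comm f g zero    = *-comm _ _
    conv-comm f g (suc n) = begin
      f 0 * g (suc n) + conv (tail f) g n ≈⟨ +-cong (*-comm _ _) (conv-comm (tail f) g n) ⟩
      g (suc n) * f 0 + conv g (tail f) n ≈⟨ +-comm _ _ ⟩
      conv g (tail f) n + g (suc n) * f 0 ≈⟨ conv-lastʳ g f n ⟨
      conv g f (suc n) ∎

    conv-distribʳ : ∀ h f g → conv (λ n → f n + g n) h ≐ (λ n → conv f h n + conv g h n)
    conv-distribʳ h f g zero    = distribʳ _ _ _
    conv-distribʳ h f g (suc n) = trans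
      (+-cong (distribʳ _ _ _) (conv-distribʳ h (tail f) (tail g) n)) (interchange _ _ _ _)

    conv-scaleˡ : ∀ r f g → conv (λ n → r * f n) g ≐ (λ n → r * conv f g n)
    conv-scaleˡ r f g zero    = *-assoc _ _ _
    conv-scaleˡ r f g (suc n) = trans
      (+-cong (*-assoc _ _ _) (conv-scaleˡ r (tail f) g n)) (sym (distribˡ _ _ _))

    conv-assoc : ∀ f g h → conv (conv f g) h ≐ conv f (conv g h)
    conv-assoc f g h zero    = *-assoc _ _ _
    conv-assoc f g h (suc n) = begin
      (f 0 * g 0) * h (suc n) + conv (λ k → f 0 * g (suc k) + conv (tail f) g k) h n
        ≈⟨ +-cong (*-assoc _ _ _) (conv-distribʳ h _ _ n) ⟩
      f 0 * (g 0 * h (suc n)) + (conv (λ k → f 0 * g (suc k)) h n + conv (conv (tail f) g) h n)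
        ≈⟨ +-congˡ (+-cong (conv-scaleˡ (f 0) (tail g) h n) (conv-assoc (tail f) g h n)) ⟩
      f 0 * (g 0 * h (suc n)) + (f 0 * conv (tail g) h n + conv (tail f) (conv g h) n)
        ≈⟨ +-assoc _ _ _ ⟨
      (f 0 * (g 0 * h (suc n)) + f 0 * conv (tail g) h n) + conv (tail f) (conv g h) n
        ≈⟨ +-congʳ (distribˡ _ _ _) ⟨
      f 0 * conv g h (suc n) + conv (tail f) (conv g h) n ∎

    seriesRing : CommutativeRing c ℓ
    seriesRing = record
      { Carrier = Series
      ; _≈_ = _≐_
      ; _+_ = λ f g n → f n + g n
      ; _*_ = conv
      ; -_ = λ f n → - f n
      ; 0# = λ _ → 0#
      ; 1# = one
      ; isCommutativeRing = record
        { isRing = record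
          { +-isAbelianGroup = record
            { isGroup = record
              { isMonoid = record
                { isSemigroup = record
                  { isMagma = record
                    { isEquivalence = record
                      { refl = λ _ → refl ; sym = λ p n → sym (p n) ; trans = λ p q n → trans (p n) (q n) }
                    ; ∙-cong = λ p q n → +-cong (p n) (q n) }
                  ; assoc = λ f g h n → +-assoc _ _ _ }
                ; identity = (λ f n → +-identityˡ _) , (λ f n → +-identityʳ _) }
              ; inverse = (λ f n → -‿inverseˡ _) , (λ f n → -‿inverseʳ _)
              ; ⁻¹-cong = λ p n → -‿cong (p n) }
            ; comm = λ f g n → +-comm _ _ }
          ; *-cong = conv-cong
          ; *-assoc = conv-assoc
          ; *-identity = conv-identityˡ , λ f n → trans (conv-comm f one n) (conv-identityˡ f n)
          ; distrib = (λ h f g n → trans (conv-comm h _ n)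
                                     (trans (conv-distribʳ h f g n)
                                       (+-cong (conv-comm f h n) (conv-comm g h n))))
                    , conv-distribʳ }
        ; *-comm = conv-comm }
      }

    const : Carrier → Series
    const c zero    = c
    const c (suc _) = 0#

    var : Series
    var zero          = 0#
    var (suc zero)    = 1#
    var (suc (suc _)) = 0#

    shift : Series → Series
    shift f zero    = 0#
    shift f (suc n) = f n

    conv-const : ∀ c f n → conv (const c) f n ≈ c * f n
    conv-const c f = conv-headˡ f (λ _ → refl)

    conv-var : ∀ f → conv var f ≐ shift f
    conv-var f zero    = zeroˡ _
    conv-var f (suc n) = trans (+-cong (zeroˡ _) (trans (conv-cong (λ { zero → refl ; (suc _) → refl }) (λ _ → refl) n) (conv-identityˡ f n))) (+-identityˡ _)

  -- Despite the brackets these are rings of power series. Iterating the construction in one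
  -- variable gives the ring laws in three, and `⊛≈conv` carries them over to `⊛`.
  module ℤ[z] = PowerSeries ℤₚ.+-*-commutativeRing
  module ℤ[y,z] = PowerSeries ℤ[z].seriesRing
  module ℤ[x,y,z] = PowerSeries ℤ[y,z].seriesRing

  sumTo : ℕ → (ℕ → ℤ) → ℤ
  sumTo zero    f = f 0
  sumTo (suc n) f = f 0 ℤ.+ sumTo n (f ∘ suc)

  Σ≤≡sumTo : ∀ n f → Σ≤ n f ≡ sumTo n f
  Σ≤≡sumTo n f = go n id
    where
    go : ∀ m (h : ℕ → ℕ) →
         foldr (λ a s → f a ℤ.+ s) (+ 0) (applyUpTo h (suc m)) ≡ sumTo m (f ∘ h)
    go zero    h = ℤₚ.+-identityʳ _
    go (suc m) h = ≡.cong (λ s → f (h 0) ℤ.+ s) (go m (h ∘ suc))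

  sumTo-cong : ∀ n (f g : ℕ → ℤ) → (∀ i → i ℕ.≤ n → f i ≡ g i) → sumTo n f ≡ sumTo n g
  sumTo-cong zero    f g f≡g = f≡g 0 z≤n
  sumTo-cong (suc n) f g f≡g = ≡.cong₂ ℤ._+_ (f≡g 0 z≤n)
    (sumTo-cong n (f ∘ suc) (g ∘ suc) (λ i i≤n → f≡g (suc i) (s≤s i≤n)))

  sumTo-zero : ∀ n (f : ℕ → ℤ) → (∀ i → i ℕ.≤ n → f i ≡ + 0) → sumTo n f ≡ + 0
  sumTo-zero zero    f f≡0 = f≡0 0 z≤n
  sumTo-zero (suc n) f f≡0 = ≡.cong₂ ℤ._+_ (f≡0 0 z≤n) (sumTo-zero n (f ∘ suc) (λ i i≤n → f≡0 (suc i) (s≤s i≤n)))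

  Σ≤-cong : ∀ n (f g : ℕ → ℤ) → (∀ i → i ℕ.≤ n → f i ≡ g i) → Σ≤ n f ≡ Σ≤ n g
  Σ≤-cong n f g f≡g = ≡.trans (Σ≤≡sumTo n f) (≡.trans (sumTo-cong n f g f≡g) (≡.sym (Σ≤≡sumTo n g)))

  Σ≤-zero : ∀ n (f : ℕ → ℤ) → (∀ i → i ℕ.≤ n → f i ≡ + 0) → Σ≤ n f ≡ + 0
  Σ≤-zero n f f≡0 = ≡.trans (Σ≤≡sumTo n f) (sumTo-zero n f f≡0)

  sumTo≡conv : ∀ f g n → sumTo n (λ i → f i ℤ.* g (n ∸ i)) ≡ ℤ[z].conv f g n
  sumTo≡conv f g zero    = ≡.refl
  sumTo≡conv f g (suc n) = ≡.cong (λ s → f 0 ℤ.* g (suc n) ℤ.+ s) (sumTo≡conv (f ∘ suc) g n)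

  sumTo≡conv₂ : ∀ f g m t → sumTo m (λ b → ℤ[z].conv (f b) (g (m ∸ b)) t) ≡ ℤ[y,z].conv f g m t
  sumTo≡conv₂ f g zero    t = ≡.refl
  sumTo≡conv₂ f g (suc m) t = ≡.cong (λ s → ℤ[z].conv (f 0) (g (suc m)) t ℤ.+ s) (sumTo≡conv₂ (f ∘ suc) g m t)

  sumTo≡conv₃ : ∀ f g n m t → sumTo n (λ a → ℤ[y,z].conv (f a) (g (n ∸ a)) m t) ≡ ℤ[x,y,z].conv f g n m t
  sumTo≡conv₃ f g zero    m t = ≡.refl
  sumTo≡conv₃ f g (suc n) m t =
    ≡.cong (λ s → ℤ[y,z].conv (f 0) (g (suc n)) m t ℤ.+ s) (sumTo≡conv₃ (f ∘ suc) g n m t)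

  ⊛≈conv : ∀ f g → f ⊛ g ≈ₛ ℤ[x,y,z].conv f g
  ⊛≈conv f g n m t = ≡.trans
    (Σ≤-cong n _ (λ a → ℤ[y,z].conv (f a) (g (n ∸ a)) m t) λ a _ → ≡.trans
      (Σ≤-cong m _ (λ b → ℤ[z].conv (f a b) (g (n ∸ a) (m ∸ b)) t) λ b _ →
        ≡.trans (Σ≤≡sumTo t _) (sumTo≡conv (f a b) (g (n ∸ a) (m ∸ b)) t))
      (≡.trans (Σ≤≡sumTo m _) (sumTo≡conv₂ (f a) (g (n ∸ a)) m t)))
    (≡.trans (Σ≤≡sumTo n _) (sumTo≡conv₃ f g n m t))

  cst0≈0 : cst (+ 0) ≈ₛ λ _ _ _ → + 0
  cst0≈0 zero    zero    zero    = ≡.refl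
  cst0≈0 zero    zero    (suc _) = ≡.refl
  cst0≈0 zero    (suc _) _       = ≡.refl
  cst0≈0 (suc _) _       _       = ≡.refl

  cst1≈one : cst (+ 1) ≈ₛ ℤ[x,y,z].one
  cst1≈one zero    zero    zero    = ≡.refl
  cst1≈one zero    zero    (suc _) = ≡.refl
  cst1≈one zero    (suc _) _       = ≡.refl
  cst1≈one (suc _) _       _       = ≡.refl

  -- Wrapping FPS keeps products of series from unfolding to their coefficients during type checking.
  record 𝕊 : Set where
    no-eta-equality
    constructor series
    field coeff : FPS
  open 𝕊 public

  infixl 6 _+_ _-_
  infixl 7 _*_
  infix  8 -_
  infix  4 _≈_

  _+_ _*_ : 𝕊 → 𝕊 → 𝕊
  -_ : 𝕊 → 𝕊
  ι : ℤ → 𝕊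
  coeff (f + g) = coeff f ⊕ coeff g
  coeff (f * g) = coeff f ⊛ coeff g
  coeff (- f)   = ⊝ coeff f
  coeff (ι c)   = cst c

  _-_ : 𝕊 → 𝕊 → 𝕊
  f - g = f + - g

  record _≈_ (f g : 𝕊) : Set where
    constructor pointwise
    field at-coeff : coeff f ≈ₛ coeff g
  open _≈_ public

  module _ where
    private
      module S = CommutativeRing ℤ[x,y,z].seriesRing

      ⊛-cong : ∀ f f′ g g′ → f ≈ₛ f′ → g ≈ₛ g′ → f ⊛ g ≈ₛ f′ ⊛ g′
      ⊛-cong f f′ g g′ p q = S.trans (⊛≈conv f g) (S.trans (S.*-cong p q) (S.sym (⊛≈conv f′ g′)))

      ⊛-assoc : ∀ f g h → (f ⊛ g) ⊛ h ≈ₛ f ⊛ (g ⊛ h)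
      ⊛-assoc f g h = S.trans (⊛≈conv (f ⊛ g) h) (S.trans (S.*-congʳ (⊛≈conv f g))
        (S.trans (S.*-assoc f g h) (S.sym (S.trans (⊛≈conv f (g ⊛ h)) (S.*-congˡ {f} (⊛≈conv g h))))))

      ⊛-identityˡ : ∀ f → cst (+ 1) ⊛ f ≈ₛ f
      ⊛-identityˡ f = S.trans (⊛≈conv (cst (+ 1)) f) (S.trans (S.*-congʳ cst1≈one) (S.*-identityˡ f))

      ⊛-comm : ∀ f g → f ⊛ g ≈ₛ g ⊛ f
      ⊛-comm f g = S.trans (⊛≈conv f g) (S.trans (S.*-comm f g) (S.sym (⊛≈conv g f)))

      ⊛-distribʳ : ∀ h f g → (f ⊕ g) ⊛ h ≈ₛ (f ⊛ h) ⊕ (g ⊛ h)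
      ⊛-distribʳ h f g = S.trans (⊛≈conv (f ⊕ g) h) (S.trans (S.distribʳ h f g) (S.sym (S.+-cong (⊛≈conv f h) (⊛≈conv g h))))

      ⊛-distribˡ : ∀ h f g → h ⊛ (f ⊕ g) ≈ₛ (h ⊛ f) ⊕ (h ⊛ g)
      ⊛-distribˡ h f g = S.trans (⊛-comm h (f ⊕ g)) (S.trans (⊛-distribʳ h f g) (S.+-cong (⊛-comm f h) (⊛-comm g h)))

    𝕊-isCommutativeRing : IsCommutativeRing _≈_ _+_ _*_ -_ (ι (+ 0)) (ι (+ 1))
    𝕊-isCommutativeRing = record
      { isRing = record
        { +-isAbelianGroup = record
          { isGroup = record
            { isMonoid = record
              { isSemigroup = record
                { isMagma = record
                  { isEquivalence = record
                    { refl  = pointwise S.refl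
                    ; sym   = λ p → pointwise (S.sym (at-coeff p))
                    ; trans = λ p q → pointwise (S.trans (at-coeff p) (at-coeff q)) }
                  ; ∙-cong = λ p q → pointwise (S.+-cong (at-coeff p) (at-coeff q)) }
                ; assoc = λ f g h → pointwise (S.+-assoc (coeff f) (coeff g) (coeff h)) }
              ; identity = (λ f → pointwise (S.trans (S.+-congʳ cst0≈0) (S.+-identityˡ (coeff f))))
                         , (λ f → pointwise (S.trans (S.+-congˡ {coeff f} cst0≈0) (S.+-identityʳ (coeff f)))) }
            ; inverse = (λ f → pointwise (S.trans (S.-‿inverseˡ (coeff f)) (S.sym cst0≈0)))
                      , (λ f → pointwise (S.trans (S.-‿inverseʳ (coeff f)) (S.sym cst0≈0)))
            ; ⁻¹-cong = λ p → pointwise (S.-‿cong (at-coeff p)) }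
          ; comm = λ f g → pointwise (S.+-comm (coeff f) (coeff g)) }
        ; *-cong = λ {f} {f′} {g} {g′} p q → pointwise (⊛-cong (coeff f) (coeff f′) (coeff g) (coeff g′) (at-coeff p) (at-coeff q))
        ; *-assoc = λ f g h → pointwise (⊛-assoc (coeff f) (coeff g) (coeff h))
        ; *-identity = (λ f → pointwise (⊛-identityˡ (coeff f)))
                     , λ f → pointwise (S.trans (⊛-comm (coeff f) (cst (+ 1))) (⊛-identityˡ (coeff f)))
        ; distrib = (λ h f g → pointwise (⊛-distribˡ (coeff h) (coeff f) (coeff g)))
                  , λ h f g → pointwise (⊛-distribʳ (coeff h) (coeff f) (coeff g)) }
      ; *-comm = λ f g → pointwise (⊛-comm (coeff f) (coeff g)) }

  𝕊-ring : CommutativeRing _ _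
  𝕊-ring = record { isCommutativeRing = 𝕊-isCommutativeRing }

  -- Products with the variables and with integer constants

  shiftX shiftY shiftZ : FPS → FPS
  shiftX f zero    m t = + 0
  shiftX f (suc n) m t = f n m t
  shiftY f n zero    t = + 0
  shiftY f n (suc m) t = f n m t
  shiftZ f n m zero    = + 0
  shiftZ f n m (suc t) = f n m t

  X⊛ : ∀ f → X ⊛ f ≈ₛ shiftX f
  X⊛ f n m t = ≡.trans (⊛≈conv X f n m t) (≡.trans (ℤ[x,y,z].conv-cong {f = X} {g = f} X≈ (λ _ _ _ → ≡.refl) n m t) (≡.trans (ℤ[x,y,z].conv-var f n m t) (out n)))
    where
    X≈ : X ≈ₛ ℤ[x,y,z].var
    X≈ zero          m       t       = ≡.refl
    X≈ (suc (suc n)) m       t       = ≡.refl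
    X≈ (suc zero)    zero    zero    = ≡.refl
    X≈ (suc zero)    zero    (suc t) = ≡.refl
    X≈ (suc zero)    (suc m) t       = ≡.refl
    out : ∀ n → ℤ[x,y,z].shift f n m t ≡ shiftX f n m t
    out zero    = ≡.refl
    out (suc n) = ≡.refl

  Y⊛ : ∀ f → Y ⊛ f ≈ₛ shiftY f
  Y⊛ f n m t = ≡.trans (⊛≈conv Y f n m t) (≡.trans (ℤ[x,y,z].conv-cong {f = Y} {g = f} Y≈ (λ _ _ _ → ≡.refl) n m t)
      (≡.trans (ℤ[x,y,z].conv-const ℤ[y,z].var f n m t) (≡.trans (ℤ[y,z].conv-var (f n) m t) (out m))))
    where
    Y≈ : Y ≈ₛ ℤ[x,y,z].const ℤ[y,z].var
    Y≈ zero    zero          t       = ≡.refl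
    Y≈ zero    (suc zero)    zero    = ≡.refl
    Y≈ zero    (suc zero)    (suc t) = ≡.refl
    Y≈ zero    (suc (suc m)) t       = ≡.refl
    Y≈ (suc n) m             t       = ≡.refl
    out : ∀ m → ℤ[y,z].shift (f n) m t ≡ shiftY f n m t
    out zero    = ≡.refl
    out (suc m) = ≡.refl

  Z⊛ : ∀ f → Z ⊛ f ≈ₛ shiftZ f
  Z⊛ f n m t = ≡.trans (⊛≈conv Z f n m t) (≡.trans (ℤ[x,y,z].conv-cong {f = Z} {g = f} Z≈ (λ _ _ _ → ≡.refl) n m t)
      (≡.trans (ℤ[x,y,z].conv-const (ℤ[y,z].const ℤ[z].var) f n m t) (≡.trans (ℤ[y,z].conv-const ℤ[z].var (f n) m t)
        (≡.trans (ℤ[z].conv-var (f n m) t) (out t)))))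
    where
    Z≈ : Z ≈ₛ ℤ[x,y,z].const (ℤ[y,z].const ℤ[z].var)
    Z≈ zero    zero    zero          = ≡.refl
    Z≈ zero    zero    (suc zero)    = ≡.refl
    Z≈ zero    zero    (suc (suc t)) = ≡.refl
    Z≈ zero    (suc m) t             = ≡.refl
    Z≈ (suc n) m       t             = ≡.refl
    out : ∀ t → ℤ[z].shift (f n m) t ≡ shiftZ f n m t
    out zero    = ≡.refl
    out (suc t) = ≡.refl

  cst⊛ : ∀ c f n m t → (cst c ⊛ f) n m t ≡ c ℤ.* f n m t
  cst⊛ c f n m t = ≡.trans (⊛≈conv (cst c) f n m t) (≡.trans (ℤ[x,y,z].conv-cong {f = cst c} {g = f} cst≈ (λ _ _ _ → ≡.refl) n m t)
      (≡.trans (ℤ[x,y,z].conv-const (ℤ[y,z].const (ℤ[z].const c)) f n m t) (≡.trans (ℤ[y,z].conv-const (ℤ[z].const c) (f n) m t) (ℤ[z].conv-const c (f n m) t))))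
    where
    cst≈ : cst c ≈ₛ ℤ[x,y,z].const (ℤ[y,z].const (ℤ[z].const c))
    cst≈ zero    zero    zero    = ≡.refl
    cst≈ zero    zero    (suc t) = ≡.refl
    cst≈ zero    (suc m) t       = ≡.refl
    cst≈ (suc n) m       t       = ≡.refl

  -- Serves negation too, taken as a binary operation that ignores its first argument.
  cst-homo₂ : ∀ (_∙_ : ℤ → ℤ → ℤ) → (+ 0) ∙ (+ 0) ≡ + 0 → ∀ a b n m t → cst (a ∙ b) n m t ≡ cst a n m t ∙ cst b n m t
  cst-homo₂ _∙_ p a b zero    zero    zero    = ≡.refl
  cst-homo₂ _∙_ p a b zero    zero    (suc t) = ≡.sym p
  cst-homo₂ _∙_ p a b zero    (suc m) t       = ≡.sym p
  cst-homo₂ _∙_ p a b (suc n) m       t       = ≡.sym p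

  cst-homo-⊛ : ∀ a b → cst (a ℤ.* b) ≈ₛ cst a ⊛ cst b
  cst-homo-⊛ a b n m t = ≡.trans (scale n m t) (≡.sym (cst⊛ a (cst b) n m t))
    where
    scale : ∀ n m t → cst (a ℤ.* b) n m t ≡ a ℤ.* cst b n m t
    scale zero    zero    zero    = ≡.refl
    scale zero    zero    (suc t) = ≡.sym (ℤₚ.*-zeroʳ a)
    scale zero    (suc m) t       = ≡.sym (ℤₚ.*-zeroʳ a)
    scale (suc n) m       t       = ≡.sym (ℤₚ.*-zeroʳ a)

  ℤ⟶𝕊 : CommutativeRing.rawRing ℤₚ.+-*-commutativeRing -Raw-AlmostCommutative⟶ fromCommutativeRing 𝕊-ring
  ℤ⟶𝕊 = record
    { ⟦_⟧    = ι
    ; +-homo = λ a b → pointwise (cst-homo₂ ℤ._+_ ≡.refl a b)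
    ; *-homo = λ a b → pointwise (cst-homo-⊛ a b)
    ; -‿homo = λ a → pointwise (cst-homo₂ (λ _ → ℤ.-_) ≡.refl a a)
    ; 0-homo = ≈-refl
    ; 1-homo = ≈-refl
    }
    where open CommutativeRing 𝕊-ring using () renaming (refl to ≈-refl)

  open CommutativeRing 𝕊-ring public using
    (refl; sym; trans; setoid; +-cong; *-cong; -‿cong; *-comm; *-assoc; zeroʳ; zeroˡ; *-identityˡ; distribˡ;
     +-identityʳ; +-identityˡ; +-congˡ; +-congʳ; *-congˡ; *-congʳ)

  ι-homo-+ : ∀ a b → ι (a ℤ.+ b) ≈ ι a + ι b
  ι-homo-+ a b = pointwise (cst-homo₂ ℤ._+_ ≡.refl a b)

  open Relation.Binary.Reasoning.Setoid setoid

  private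
    coeff≟ : ∀ a b → Maybe (ι a ≈ ι b)
    coeff≟ a b with a ℤ.≟ b
    ... | yes ≡.refl = just refl
    ... | no _       = nothing

  module Solver = Algebra.Solver.Ring _ _ ℤ⟶𝕊 coeff≟
  open Solver using (op; [+]; [*]; var; solve; _:=_; con; _:+_; _:*_; _:-_; :-_; _:^_; Polynomial)

  :1 : ∀ {n} → Polynomial n
  :1 = con (+ 1)

  0ₛ 1ₛ x y z : 𝕊
  0ₛ = ι (+ 0)
  1ₛ = ι (+ 1)
  x = series X
  y = series Y
  z = series Z

  coeff-0 : ∀ {f} → f ≈ 0ₛ → ∀ n m t → coeff f n m t ≡ + 0
  coeff-0 p n m t = ≡.trans (at-coeff p n m t) (cst0≈0 n m t)

  ≈0 : ∀ {f} → (∀ n m t → coeff f n m t ≡ + 0) → f ≈ 0ₛ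
  ≈0 p = pointwise λ n m t → ≡.trans (p n m t) (≡.sym (cst0≈0 n m t))

  x-cancel : ∀ {f} → x * f ≈ 0ₛ → f ≈ 0ₛ
  x-cancel {f} p = ≈0 λ n m t → ≡.trans (≡.sym (X⊛ (coeff f) (suc n) m t)) (coeff-0 p (suc n) m t)

  y-cancel : ∀ {f} → y * f ≈ 0ₛ → f ≈ 0ₛ
  y-cancel {f} p = ≈0 λ n m t → ≡.trans (≡.sym (Y⊛ (coeff f) n (suc m) t)) (coeff-0 p n (suc m) t)

  -- Orders in `y`, cancellation and inverses

  infix 4 y^_∣_
  -- Stated through coefficients, without a quotient, so that `∣-all` turns divisibility by every
  -- power into equality with 0. The limit and uniqueness arguments below end there.
  record y^_∣_ (k : ℕ) (f : 𝕊) : Set where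
    constructor vanishing
    field below : ∀ n m t → m ℕ.< k → coeff f n m t ≡ + 0
  open y^_∣_ public

  ∣-resp : ∀ {k f g} → f ≈ g → y^ k ∣ f → y^ k ∣ g
  ∣-resp p b = vanishing λ n m t m<k → ≡.trans (≡.sym (at-coeff p n m t)) (below b n m t m<k)

  ∣-zero : ∀ {f} → y^ 0 ∣ f
  ∣-zero = vanishing λ n m t ()

  ∣-mono : ∀ {j k f} → j ℕ.≤ k → y^ k ∣ f → y^ j ∣ f
  ∣-mono j≤k b = vanishing λ n m t m<j → below b n m t (ℕₚ.<-≤-trans m<j j≤k)

  ∣-all : ∀ {f} → (∀ k → y^ k ∣ f) → f ≈ 0ₛ
  ∣-all b = ≈0 λ n m t → below (b (suc m)) n m t ℕₚ.≤-refl

  ∣-0ₛ : ∀ {k} → y^ k ∣ 0ₛ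
  ∣-0ₛ = vanishing λ n m t _ → cst0≈0 n m t

  ∣-+ : ∀ {k f g} → y^ k ∣ f → y^ k ∣ g → y^ k ∣ f + g
  ∣-+ b c = vanishing λ n m t m<k → ≡.cong₂ ℤ._+_ (below b n m t m<k) (below c n m t m<k)

  ∣-neg : ∀ {k f} → y^ k ∣ f → y^ k ∣ - f
  ∣-neg b = vanishing λ n m t m<k → ≡.cong ℤ.-_ (below b n m t m<k)

  ∣-* : ∀ {i j f g} → y^ i ∣ f → y^ j ∣ g → y^ i ℕ.+ j ∣ f * g
  ∣-* {i} {j} {f} {g} bf bg = vanishing λ n m t m<i+j →
    Σ≤-zero n _ λ a _ → Σ≤-zero m _ λ b b≤m → Σ≤-zero t _ λ c _ → term n m t a b c m<i+j b≤m
    where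
    term : ∀ n m t a b c → m ℕ.< i ℕ.+ j → b ℕ.≤ m → coeff f a b c ℤ.* coeff g (n ∸ a) (m ∸ b) (t ∸ c) ≡ + 0
    term n m t a b c m<i+j b≤m with b ℕ.<? i
    ... | yes b<i rewrite below bf a b c b<i = ≡.refl
    ... | no b≮i = ≡.trans
      (≡.cong (coeff f a b c ℤ.*_) (below bg (n ∸ a) (m ∸ b) (t ∸ c)
        (ℕₚ.+-cancelˡ-< b _ _ (≡.subst (ℕ._< b ℕ.+ j) (≡.sym (ℕₚ.m+[n∸m]≡n b≤m))
          (ℕₚ.<-≤-trans m<i+j (ℕₚ.+-monoˡ-≤ j (ℕₚ.≮⇒≥ b≮i)))))))
      (ℤₚ.*-zeroʳ (coeff f a b c))

  ∣-*ʳ : ∀ {k} f {g} → y^ k ∣ g → y^ k ∣ f * g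
  ∣-*ʳ f = ∣-* {0} {f = f} ∣-zero

  ∣-*ˡ : ∀ {k f} g → y^ k ∣ f → y^ k ∣ f * g
  ∣-*ˡ {f = f} g b = ∣-resp (*-comm g f) (∣-*ʳ g b)

  y∣y : y^ 1 ∣ y
  y∣y = vanishing λ { zero zero t _ → ≡.refl ; (suc n) zero t _ → ≡.refl ; _ (suc m) t (s≤s ()) }

  -- The hypothesis gives `g ≈ (1ₛ - f) * g`, so each power of `y` that divides `g` can be raised by
  -- one.
  unit-cancel : ∀ {f g} → y^ 1 ∣ 1ₛ - f → f * g ≈ 0ₛ → g ≈ 0ₛ
  unit-cancel {f} {g} unit p = ∣-all go
    where
    step : (1ₛ - f) * g ≈ g
    step = begin
      (1ₛ - f) * g ≈⟨ solve 2 (λ f g → (:1 :- f) :* g := g :- f :* g) refl f g ⟩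
      g - f * g    ≈⟨ +-congˡ (-‿cong p) ⟩
      g - 0ₛ       ≈⟨ solve 1 (λ g → g :- con (+ 0) := g) refl g ⟩
      g ∎
    go : ∀ k → y^ k ∣ g
    go zero    = ∣-zero
    go (suc k) = ∣-resp step (∣-* unit (go k))

  -- The inverse is the y-adic limit of the geometric sums of 1 - f.
  module Inverse (f : 𝕊) (unit : y^ 1 ∣ 1ₛ - f) where

    private
      h : 𝕊
      h = 1ₛ - f

      geometric : ℕ → 𝕊
      geometric zero    = 1ₛ
      geometric (suc k) = 1ₛ + h * geometric k

      pow : ℕ → 𝕊
      pow zero    = 1ₛ
      pow (suc k) = h * pow k

      ∣-pow : ∀ k → y^ k ∣ pow k
      ∣-pow zero    = ∣-zero
      ∣-pow (suc k) = ∣-* unit (∣-pow k)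

      f*geometric : ∀ k → 1ₛ - f * geometric k ≈ pow (suc k)
      f*geometric zero    = solve 1 (λ f → :1 :- f :* :1 := (:1 :- f) :* :1) refl f
      f*geometric (suc k) = trans
        (solve 2 (λ f g → :1 :- f :* (:1 :+ (:1 :- f) :* g) := (:1 :- f) :* (:1 :- f :* g)) refl f (geometric k))
        (*-congˡ (f*geometric k))

      geometric-stable : ∀ j k → y^ suc j ∣ geometric (j ℕ.+ k) - geometric j
      geometric-stable zero    zero    = ∣-resp (solve 0 (con (+ 0) := :1 :- :1) refl) ∣-0ₛ
      geometric-stable zero    (suc k) = ∣-resp
        (solve 2 (λ h g → h :* g := :1 :+ h :* g :- :1) refl h (geometric k)) (∣-*ˡ (geometric k) unit)
      geometric-stable (suc j) k       = ∣-resp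
        (solve 3 (λ h g g′ → h :* (g :- g′) := :1 :+ h :* g :- (:1 :+ h :* g′)) refl h (geometric (j ℕ.+ k)) (geometric j))
        (∣-* unit (geometric-stable j k))

    f⁻¹ : 𝕊
    -- Later sums differ from `geometric m` only from `y^(m+1)` on, so this coefficient has already
    -- reached its limit.
    coeff f⁻¹ n m t = coeff (geometric m) n m t

    private
      f⁻¹-geometric : ∀ k → y^ suc k ∣ geometric k - f⁻¹
      f⁻¹-geometric k = vanishing go
        where
        go : ∀ n m t → m ℕ.< suc k → coeff (geometric k - f⁻¹) n m t ≡ + 0
        go n m t (s≤s m≤k) with ℕₚ.m≤n⇒∃[o]m+o≡n m≤k
        ... | d , ≡.refl = below (geometric-stable m d) n m t ℕₚ.≤-refl

    f*f⁻¹ : f * f⁻¹ ≈ 1ₛ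
    f*f⁻¹ = begin
      f * f⁻¹              ≈⟨ solve 2 (λ f g → f :* g := :1 :- (:1 :- f :* g)) refl f f⁻¹ ⟩
      1ₛ - (1ₛ - f * f⁻¹)  ≈⟨ +-congˡ (-‿cong (∣-all limit)) ⟩
      1ₛ - 0ₛ              ≈⟨ solve 0 (:1 :- con (+ 0) := :1) refl ⟩
      1ₛ ∎
      where
      limit : ∀ k → y^ k ∣ 1ₛ - f * f⁻¹
      limit k = ∣-resp
        (trans (+-congʳ (sym (f*geometric k)))
          (solve 3 (λ f g g′ → (:1 :- f :* g) :+ f :* (g :- g′) := :1 :- f :* g′) refl f (geometric k) f⁻¹))
        (∣-mono (ℕₚ.n≤1+n k) (∣-+ (∣-pow (suc k)) (∣-*ʳ f (f⁻¹-geometric k))))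

  -- Summable families of series

  sumTo-last : ∀ n f → sumTo (suc n) f ≡ sumTo n f ℤ.+ f (suc n)
  sumTo-last zero    f = ≡.refl
  sumTo-last (suc n) f = ≡.trans (≡.cong (λ s → f 0 ℤ.+ s) (sumTo-last n (f ∘ suc))) (≡.sym (ℤₚ.+-assoc (f 0) _ _))

  sumTo-+ : ∀ n (f g : ℕ → ℤ) → sumTo n (λ s → f s ℤ.+ g s) ≡ sumTo n f ℤ.+ sumTo n g
  sumTo-+ zero    f g = ≡.refl
  sumTo-+ (suc n) f g = ≡.trans (≡.cong (λ s → f 0 ℤ.+ g 0 ℤ.+ s) (sumTo-+ n (f ∘ suc) (g ∘ suc)))
    (interchange (f 0) (g 0) _ _)
    where open import Algebra.Properties.CommutativeSemigroup ℤₚ.+-commutativeSemigroup using (interchange)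

  sumTo-stable : ∀ n d f → (∀ s → n ℕ.< s → f s ≡ + 0) → sumTo (n ℕ.+ d) f ≡ sumTo n f
  sumTo-stable n zero    f f≡0 = ≡.cong (λ k → sumTo k f) (ℕₚ.+-identityʳ n)
  sumTo-stable n (suc d) f f≡0 = ≡.trans (≡.cong (λ k → sumTo k f) (ℕₚ.+-suc n d)) (≡.trans (sumTo-last (n ℕ.+ d) f)
    (≡.trans (≡.cong₂ ℤ._+_ (sumTo-stable n d f f≡0) (f≡0 (suc (n ℕ.+ d)) (s≤s (ℕₚ.m≤m+n n d)))) (ℤₚ.+-identityʳ _)))

  -- The term `A s` starts at `x^s`, so the coefficient of `x^n` in the infinite sum involves only
  -- the terms up to `n`, and `total` may stop there. The family `E#` has this property because
  -- ranks are at most lengths.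
  record Summable (A : ℕ → 𝕊) : Set where
    constructor summable
    field early-zero : ∀ s n m t → n ℕ.< s → coeff (A s) n m t ≡ + 0
  open Summable

  total : (ℕ → 𝕊) → 𝕊
  coeff (total A) n m t = sumTo n λ s → coeff (A s) n m t

  Summable-* : ∀ {A} (c : ℕ → 𝕊) → Summable A → Summable (λ s → c s * A s)
  Summable-* {A} c sum = summable λ s n m t n<s →
    Σ≤-zero n _ λ a _ → Σ≤-zero m _ λ b _ → Σ≤-zero t _ λ d _ → term s n m t n<s a b d
    where
    term : ∀ s n m t → n ℕ.< s → ∀ a b d → coeff (c s) a b d ℤ.* coeff (A s) (n ∸ a) (m ∸ b) (t ∸ d) ≡ + 0
    term s n m t n<s a b d = ≡.trans
      (≡.cong (coeff (c s) a b d ℤ.*_) (early-zero sum s (n ∸ a) (m ∸ b) (t ∸ d) (ℕₚ.≤-<-trans (ℕₚ.m∸n≤m n a) n<s)))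
      (ℤₚ.*-zeroʳ (coeff (c s) a b d))

  total-cong : ∀ {A B} → (∀ s → A s ≈ B s) → total A ≈ total B
  total-cong p = pointwise λ n m t → sumTo-cong n _ _ λ s _ → at-coeff (p s) n m t

  total-+ : ∀ A B → total (λ s → A s + B s) ≈ total A + total B
  total-+ A B = pointwise λ n m t → sumTo-+ n _ _

  total-∣ : ∀ {k A} → (∀ s → y^ k ∣ A s) → y^ k ∣ total A
  total-∣ b = vanishing λ n m t m<k → sumTo-zero n _ λ s _ → below (b s) n m t m<k

  -- Cut off at the same degree, the shifted family reaches one term further than the original one;
  -- that term vanishes.
  total-split : ∀ A → Summable A → total A ≈ A 0 + total (A ∘ suc)
  total-split A sum = pointwise λ n m t → ≡.sym (≡.trans (sumTo-last n _)
    (≡.trans (≡.cong (λ u → sumTo n (λ s → coeff (A s) n m t) ℤ.+ u) (early-zero sum (suc n) n m t ℕₚ.≤-refl)) (ℤₚ.+-identityʳ _)))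

  -- The cut-off in `total A` varies with the degree, so finite distributivity does not apply at
  -- once. For the coefficient of `x^n` it may be moved to `n` throughout, since the added terms
  -- vanish.
  total-*ˡ : ∀ c A → Summable A → c * total A ≈ total (λ s → c * A s)
  total-*ˡ c A sum = pointwise λ n m t → ≡.trans (truncate n m t)
    (≡.trans (at-coeff (partial-* n A) n m t) (partial-coeff n (λ s → c * A s) n m t))
    where
    partial : ℕ → (ℕ → 𝕊) → 𝕊
    partial zero    A = A 0
    partial (suc N) A = A 0 + partial N (A ∘ suc)

    partial-coeff : ∀ N A n m t → coeff (partial N A) n m t ≡ sumTo N λ s → coeff (A s) n m t
    partial-coeff zero    A n m t = ≡.refl
    partial-coeff (suc N) A n m t = ≡.cong (λ s → coeff (A 0) n m t ℤ.+ s) (partial-coeff N (A ∘ suc) n m t)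

    partial-* : ∀ N A → c * partial N A ≈ partial N (λ s → c * A s)
    partial-* zero    A = refl
    partial-* (suc N) A = trans (distribˡ c (A 0) (partial N (A ∘ suc))) (+-congˡ (partial-* N (A ∘ suc)))

    stable : ∀ n a m t → coeff (total A) (n ∸ a) m t ≡ coeff (partial n A) (n ∸ a) m t
    stable n a m t with ℕₚ.m≤n⇒∃[o]m+o≡n (ℕₚ.m∸n≤m n a)
    ... | d , eq = ≡.trans (≡.sym (sumTo-stable (n ∸ a) d _ λ s → early-zero sum s (n ∸ a) m t))
      (≡.trans (≡.cong (λ N → sumTo N λ s → coeff (A s) (n ∸ a) m t) eq) (≡.sym (partial-coeff n A (n ∸ a) m t)))

    truncate : ∀ n m t → coeff (c * total A) n m t ≡ coeff (c * partial n A) n m t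
    truncate n m t = Σ≤-cong n _ _ λ a _ → Σ≤-cong m _ _ λ b _ → Σ≤-cong t _ _ λ d _ →
      ≡.cong (coeff c a b d ℤ.*_) (stable n a (m ∸ b) (t ∸ d))

  -- The coefficients of the powers of z

  E# : ℕ → 𝕊
  coeff (E# s) n m zero    = + count n m s
  coeff (E# s) n m (suc t) = + 0

  E#-summable : Summable E#
  E#-summable = summable λ { s n m zero n<s → ≡.cong +_ (count-rank n m s n<s) ; _ _ _ (suc _) _ → ≡.refl }

  weighted : (ℕ → 𝕊) → 𝕊
  weighted φ = total λ s → φ s * E# s

  weightedℕ : (ℕ → ℕ) → 𝕊
  weightedℕ φ = weighted (λ s → ι (+ φ s))

  +sumℕ : ∀ n f → + sumℕ n f ≡ sumTo n (λ s → + f s)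
  +sumℕ zero    f = ≡.refl
  +sumℕ (suc n) f = ≡.cong (λ u → + f 0 ℤ.+ u) (+sumℕ n (f ∘ suc))

  coeff-weightedℕ : ∀ φ n m → coeff (weightedℕ φ) n m 0 ≡ + sumℕ n λ s → φ s ℕ.* count n m s
  coeff-weightedℕ φ n m = ≡.trans
    (sumTo-cong n _ _ λ s _ → ≡.trans (cst⊛ (+ φ s) (coeff (E# s)) n m 0) (≡.sym (ℤₚ.pos-* (φ s) (count n m s))))
    (≡.sym (+sumℕ n _))

  coeff-weightedℕ-suc : ∀ φ n m t → coeff (weightedℕ φ) n m (suc t) ≡ + 0
  coeff-weightedℕ-suc φ n m t = sumTo-zero n _ λ s _ →
    ≡.trans (cst⊛ (+ φ s) (coeff (E# s)) n m (suc t)) (ℤₚ.*-zeroʳ (+ φ s))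

  step : ℕ → 𝕊
  step t = y * (x * weightedℕ (λ s → N₁ s t) + x * (x * weightedℕ (λ s → N₂ s t)))

  private
    A B : ℕ → 𝕊
    A t = weightedℕ (λ s → N₁ s t)
    B t = weightedℕ (λ s → N₂ s t)

    coeff-step-zero : ∀ r n t → coeff (step r) n 0 t ≡ + 0
    coeff-step-zero r n t = Y⊛ (coeff (x * A r + x * (x * B r))) n 0 t

    coeff-step : ∀ r n m t → coeff (step r) n (suc m) t
               ≡ shiftX (coeff (A r)) n m t ℤ.+ shiftX (shiftX (coeff (B r))) n m t
    coeff-step r n m t = ≡.trans (Y⊛ (coeff (x * A r + x * (x * B r))) n (suc m) t)
      (≡.cong₂ ℤ._+_ (X⊛ (coeff (A r)) n m t) (≡.trans (X⊛ (coeff (x * B r)) n m t) (inner n)))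
      where
      inner : ∀ n → shiftX (coeff (x * B r)) n m t ≡ shiftX (shiftX (coeff (B r))) n m t
      inner zero    = ≡.refl
      inner (suc n) = X⊛ (coeff (B r)) n m t

    coeff-step-0 : ∀ r n m → coeff (step r) (suc n) (suc m) 0 ≡ + count (suc n) (suc m) r
    coeff-step-0 r n m = ≡.trans (coeff-step r (suc n) m 0)
      (≡.trans (≡.cong₂ ℤ._+_ (coeff-weightedℕ (λ s → N₁ s r) n m) (second n))
        (≡.trans (≡.sym (ℤₚ.pos-+ _ (doubles n m r))) (≡.cong +_ (≡.sym (count-ss n m r)))))
      where
      second : ∀ n → shiftX (coeff (B r)) n m 0 ≡ + doubles n m r
      second zero    = ≡.refl
      second (suc n) = coeff-weightedℕ (λ s → N₂ s r) n m

    coeff-step-suc : ∀ r n m t → coeff (step r) n (suc m) (suc t) ≡ + 0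
    coeff-step-suc r n m t = ≡.trans (coeff-step r n m (suc t)) (≡.cong₂ ℤ._+_ (first n) (second n))
      where
      first : ∀ n → shiftX (coeff (A r)) n m (suc t) ≡ + 0
      first zero    = ≡.refl
      first (suc n) = coeff-weightedℕ-suc (λ s → N₁ s r) n m t
      second : ∀ n → shiftX (shiftX (coeff (B r))) n m (suc t) ≡ + 0
      second zero          = ≡.refl
      second (suc zero)    = ≡.refl
      second (suc (suc n)) = coeff-weightedℕ-suc (λ s → N₂ s r) n m t

  -- The summand `1ₛ` is the empty sequence, the only one without a parent.
  E#-zero : E# 0 ≈ 1ₛ + step 0
  E#-zero = pointwise go
    where
    go : ∀ n m t → coeff (E# 0) n m t ≡ coeff (1ₛ + step 0) n m t
    go zero    zero    zero    = ≡.cong +_ count-000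
    go zero    zero    (suc t) = ≡.sym (≡.cong₂ ℤ._+_ (≡.refl {x = + 0}) (coeff-step-zero 0 0 (suc t)))
    go (suc n) zero    zero    = ≡.trans (≡.cong +_ (count-s0 n 0))
      (≡.sym (≡.cong₂ ℤ._+_ (≡.refl {x = + 0}) (coeff-step-zero 0 (suc n) 0)))
    go (suc n) zero    (suc t) = ≡.sym (≡.cong₂ ℤ._+_ (≡.refl {x = + 0}) (coeff-step-zero 0 (suc n) (suc t)))
    go zero    (suc m) zero    = ≡.trans (≡.cong +_ (count-0s m 0))
      (≡.sym (≡.cong₂ ℤ._+_ (≡.refl {x = + 0}) (coeff-step 0 0 m 0)))
    go zero    (suc m) (suc t) = ≡.sym (≡.cong₂ ℤ._+_ (≡.refl {x = + 0}) (coeff-step-suc 0 0 m t))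
    go (suc n) (suc m) zero    = ≡.sym (≡.trans (≡.cong₂ ℤ._+_ (≡.refl {x = + 0}) (coeff-step-0 0 n m)) (ℤₚ.+-identityˡ _))
    go (suc n) (suc m) (suc t) = ≡.sym (≡.cong₂ ℤ._+_ (≡.refl {x = + 0}) (coeff-step-suc 0 (suc n) m t))

  E#-suc : ∀ r → E# (suc r) ≈ step (suc r)
  E#-suc r = pointwise go
    where
    go : ∀ n m t → coeff (E# (suc r)) n m t ≡ coeff (step (suc r)) n m t
    go n       zero    zero    = ≡.trans (≡.cong +_ (at0 n)) (≡.sym (coeff-step-zero (suc r) n 0))
      where
      at0 : ∀ n → count n 0 (suc r) ≡ 0
      at0 zero    = count-00s r
      at0 (suc n) = count-s0 n (suc r)
    go n       zero    (suc t) = ≡.sym (coeff-step-zero (suc r) n (suc t))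
    go zero    (suc m) zero    = ≡.trans (≡.cong +_ (count-0s m (suc r))) (≡.sym (coeff-step (suc r) 0 m 0))
    go (suc n) (suc m) zero    = ≡.sym (coeff-step-0 (suc r) n m)
    go n       (suc m) (suc t) = ≡.sym (coeff-step-suc (suc r) n m t)

  ∣-step : ∀ t → y^ 1 ∣ step t
  ∣-step t = ∣-*ˡ _ y∣y

  -- The ratio `w` and the geometric law

  a w v : 𝕊

  a = E# 0

  a-unit : y^ 1 ∣ 1ₛ - a
  a-unit = ∣-resp (trans (solve 1 (λ s → :- s := :1 :- (:1 :+ s)) refl (step 0)) (+-congˡ (-‿cong (sym E#-zero))))
    (∣-neg (∣-step 0))

  open Inverse a a-unit using () renaming (f⁻¹ to a⁻¹; f*f⁻¹ to a*a⁻¹)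

  w = a⁻¹ * E# 1
  v = 1ₛ - w

  w*a : w * a ≈ E# 1
  w*a = begin
    a⁻¹ * E# 1 * a     ≈⟨ solve 3 (λ a⁻¹ b a → a⁻¹ :* b :* a := a :* a⁻¹ :* b) refl a⁻¹ (E# 1) a ⟩
    a * a⁻¹ * E# 1     ≈⟨ *-congʳ a*a⁻¹ ⟩
    1ₛ * E# 1          ≈⟨ *-identityˡ (E# 1) ⟩
    E# 1 ∎

  ∣w : y^ 1 ∣ w
  ∣w = ∣-*ʳ a⁻¹ (∣-resp (sym (E#-suc 0)) (∣-step 1))

  v-unit : y^ 1 ∣ 1ₛ - v
  v-unit = ∣-resp (solve 1 (λ w → w := :1 :- (:1 :- w)) refl w) ∣w

  defect : ℕ → 𝕊
  defect t = E# (suc t) - w * E# t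

  defect-zero : defect 0 ≈ 0ₛ
  defect-zero = trans (+-congˡ (-‿cong w*a)) (solve 1 (λ b → b :- b := con (+ 0)) refl (E# 1))

  weighted-split : ∀ φ → weighted φ ≈ φ 0 * E# 0 + total (λ s → φ (suc s) * E# (suc s))
  weighted-split φ = total-split (λ s → φ s * E# s) (Summable-* φ E#-summable)

  weightedℕ-split₀ : ∀ φ → φ 0 ≡ 0 → weightedℕ φ ≈ total (λ s → ι (+ φ (suc s)) * E# (suc s))
  weightedℕ-split₀ φ φ0≡0 = begin
    weightedℕ φ                ≈⟨ weighted-split (λ s → ι (+ φ s)) ⟩
    ι (+ φ 0) * E# 0 + rest    ≡⟨ ≡.cong (λ k → ι (+ k) * E# 0 + rest) φ0≡0 ⟩
    0ₛ * E# 0 + rest           ≈⟨ solve 2 (λ e r → con (+ 0) :* e :+ r := r) refl (E# 0) rest ⟩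
    rest ∎
    where
    rest : 𝕊
    rest = total (λ s → ι (+ φ (suc s)) * E# (suc s))

  w*weighted : ∀ φ → w * weighted φ ≈ total (λ s → φ s * (w * E# s))
  w*weighted φ = trans (total-*ˡ w (λ s → φ s * E# s) (Summable-* φ E#-summable))
    (total-cong λ s → solve 3 (λ w c e → w :* (c :* e) := c :* (w :* e)) refl w (φ s) (E# s))

  total-shift : ∀ φ → total (λ s → φ s * E# (suc s)) ≈ total (λ s → φ s * defect s) + w * weighted φ
  total-shift φ = begin
    total (λ s → φ s * E# (suc s))
      ≈⟨ total-cong (λ s → solve 4 (λ c e w e′ → c :* e := c :* (e :- w :* e′) :+ c :* (w :* e′))
                        refl (φ s) (E# (suc s)) w (E# s)) ⟩
    total (λ s → φ s * defect s + φ s * (w * E# s))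
      ≈⟨ total-+ (λ s → φ s * defect s) (λ s → φ s * (w * E# s)) ⟩
    total (λ s → φ s * defect s) + total (λ s → φ s * (w * E# s))
      ≈⟨ +-congˡ (sym (w*weighted φ)) ⟩
    total (λ s → φ s * defect s) + w * weighted φ ∎

  -- At target rank `suc (suc t)` both kernels vanish for `s = 0`, and their value at `suc s` is the
  -- one at `s` for target `suc t`. So the sum for `E# (suc (suc t))` is the sum for `E# (suc t)`
  -- with each `E# s` replaced by `E# (suc s)`, and subtracting `w` times the latter leaves the
  -- defects.
  defect-suc : ∀ t → defect (suc t) ≈ y * (x * total (λ s → ι (+ N₁ s (suc t)) * defect s)
                                          + x * (x * total (λ s → ι (+ N₂ s (suc t)) * defect s)))
  defect-suc t = begin
    E# (suc (suc t)) - w * E# (suc t)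
      ≈⟨ +-cong (E#-suc (suc t)) (-‿cong (*-congˡ (E#-suc t))) ⟩
    step (suc (suc t)) - w * step (suc t)
      ≈⟨ +-congʳ (*-congˡ (+-cong (*-congˡ (shifted (λ s → N₁ s (suc (suc t))) ≡.refl))
                                 (*-congˡ (*-congˡ (shifted (λ s → N₂ s (suc (suc t)))
                                   (≡.trans (ℕₚ.+-identityʳ _) (ℕₚ.0∸n≡0 t))))))) ⟩
    y * (x * (AD + w * A (suc t)) + x * (x * (BD + w * B (suc t)))) - w * (y * (x * A (suc t) + x * (x * B (suc t))))
      ≈⟨ solve 7 (λ x y w a b a′ b′ →
           y :* (x :* (a′ :+ w :* a) :+ x :* (x :* (b′ :+ w :* b))) :- w :* (y :* (x :* a :+ x :* (x :* b)))
           := y :* (x :* a′ :+ x :* (x :* b′))) refl x y w (A (suc t)) (B (suc t)) AD BD ⟩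
    y * (x * AD + x * (x * BD)) ∎
    where
    AD BD : 𝕊
    AD = total (λ s → ι (+ N₁ s (suc t)) * defect s)
    BD = total (λ s → ι (+ N₂ s (suc t)) * defect s)
    shifted : ∀ φ → φ 0 ≡ 0 → weightedℕ φ ≈ total (λ s → ι (+ φ (suc s)) * defect s) + w * weightedℕ (λ s → φ (suc s))
    shifted φ φ0≡0 = trans (weightedℕ-split₀ φ φ0≡0) (total-shift (λ s → ι (+ φ (suc s))))

  -- The defects satisfy the recurrence of E#, but with initial value 0; hence y divides them to any power.
  defect≈0 : ∀ t → defect t ≈ 0ₛ
  defect≈0 t = ∣-all (λ k → go k t)
    where
    go : ∀ k t → y^ k ∣ defect t
    go zero    t       = ∣-zero
    go (suc k) zero    = ∣-resp (sym defect-zero) ∣-0ₛ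
    go (suc k) (suc t) = ∣-resp (sym (defect-suc t)) (∣-* y∣y
      (∣-+ (∣-*ʳ x (total-∣ λ s → ∣-*ʳ _ (go k s))) (∣-*ʳ x (∣-*ʳ x (total-∣ λ s → ∣-*ʳ _ (go k s))))))

  -- The geometric law is used in this form: weights can be shifted at the price of a factor `w`, so
  -- every weighted sum obeys a linear equation with coefficients in `w`.
  weighted-unfold : ∀ φ → weighted φ ≈ φ 0 * a + w * weighted (φ ∘ suc)
  weighted-unfold φ = begin
    weighted φ                                                           ≈⟨ weighted-split φ ⟩
    φ 0 * a + total (λ s → φ (suc s) * E# (suc s))                       ≈⟨ +-congˡ (total-shift (φ ∘ suc)) ⟩
    φ 0 * a + (total (λ s → φ (suc s) * defect s) + w * weighted (φ ∘ suc)) ≈⟨ +-congˡ (+-congʳ none) ⟩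
    φ 0 * a + (0ₛ + w * weighted (φ ∘ suc))
      ≈⟨ +-congˡ (+-identityˡ _) ⟩
    φ 0 * a + w * weighted (φ ∘ suc) ∎
    where
    none : total (λ s → φ (suc s) * defect s) ≈ 0ₛ
    none = ∣-all λ k → total-∣ λ s → ∣-*ʳ (φ (suc s)) (∣-resp (sym (defect≈0 s)) ∣-0ₛ)

  -- The equations for `a` and `w`

  weightedℕ-+ : ∀ φ ψ χ → (∀ s → φ s ≡ ψ s ℕ.+ χ s) → weightedℕ φ ≈ weightedℕ ψ + weightedℕ χ
  weightedℕ-+ φ ψ χ eq = trans (total-cong term) (total-+ (λ s → ι (+ ψ s) * E# s) (λ s → ι (+ χ s) * E# s))
    where
    term : ∀ s → ι (+ φ s) * E# s ≈ ι (+ ψ s) * E# s + ι (+ χ s) * E# s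
    term s = begin
      ι (+ φ s) * E# s                  ≡⟨ ≡.cong (λ k → ι (+ k) * E# s) (eq s) ⟩
      ι (+ ψ s ℤ.+ + χ s) * E# s        ≈⟨ *-congʳ (ι-homo-+ (+ ψ s) (+ χ s)) ⟩
      (ι (+ ψ s) + ι (+ χ s)) * E# s
        ≈⟨ solve 3 (λ a b e → (a :+ b) :* e := a :* e :+ b :* e) refl (ι (+ ψ s)) (ι (+ χ s)) (E# s) ⟩
      ι (+ ψ s) * E# s + ι (+ χ s) * E# s ∎

  -- The weights are the coefficients of `1 / (1 - w)^k` for `k = 1, 2, 3`, so these sums are
  -- `a / v`, `a / v^2` and `a / v^3`. Writing everything through `s₂` and powers of `v` avoids the
  -- divisions.
  s₀ s₁ s₂ : 𝕊
  s₀ = weightedℕ (λ _ → 1)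
  s₁ = weightedℕ suc
  s₂ = weightedℕ (triangle ∘ suc)

  s₀-unfold : s₀ ≈ a + w * s₀
  s₀-unfold = trans (weighted-unfold (λ _ → 1ₛ)) (+-congʳ (*-identityˡ a))

  s₁-unfold : s₁ ≈ s₀ + w * s₁
  s₁-unfold = begin
    s₁                                ≈⟨ weighted-unfold (λ s → ι (+ suc s)) ⟩
    1ₛ * a + w * weightedℕ (suc ∘ suc)
      ≈⟨ +-congˡ (*-congˡ (weightedℕ-+ (suc ∘ suc) (λ _ → 1) suc (λ _ → ≡.refl))) ⟩
    1ₛ * a + w * (s₀ + s₁)            ≈⟨ solve 4 (λ a w s t → :1 :* a :+ w :* (s :+ t) := (a :+ w :* s) :+ w :* t) refl a w s₀ s₁ ⟩
    (a + w * s₀) + w * s₁             ≈⟨ +-congʳ (sym s₀-unfold) ⟩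
    s₀ + w * s₁ ∎

  s₂-unfold : s₂ ≈ s₁ + w * s₂
  s₂-unfold = begin
    s₂                                ≈⟨ weighted-unfold (λ s → ι (+ triangle (suc s))) ⟩
    1ₛ * a + w * weightedℕ (λ s → triangle (suc (suc s)))
      ≈⟨ +-congˡ (*-congˡ (weightedℕ-+ _ (suc ∘ suc) (triangle ∘ suc) (λ _ → ≡.refl))) ⟩
    1ₛ * a + w * (weightedℕ (suc ∘ suc) + s₂)
      ≈⟨ solve 4 (λ a w s t → :1 :* a :+ w :* (s :+ t) := (:1 :* a :+ w :* s) :+ w :* t) refl a w (weightedℕ (suc ∘ suc)) s₂ ⟩
    (1ₛ * a + w * weightedℕ (suc ∘ suc)) + w * s₂   ≈⟨ +-congʳ (sym (weighted-unfold (λ s → ι (+ suc s)))) ⟩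
    s₁ + w * s₂ ∎

  module _ where
    private
      peel : ∀ {f g} → f ≈ g + w * f → g ≈ v * f
      peel {f} {g} p = begin
        g                   ≈⟨ solve 3 (λ f g w → g := (g :+ w :* f) :- w :* f) refl f g w ⟩
        (g + w * f) - w * f ≈⟨ +-congʳ (sym p) ⟩
        f - w * f           ≈⟨ solve 2 (λ f w → f :- w :* f := (:1 :- w) :* f) refl f w ⟩
        v * f ∎

      s₁≈ : s₁ ≈ v * s₂
      s₁≈ = peel s₂-unfold

      s₀≈ : s₀ ≈ v * (v * s₂)
      s₀≈ = trans (peel s₁-unfold) (*-congˡ s₁≈)

      a≈ : a ≈ v * (v * (v * s₂))
      a≈ = trans (peel s₀-unfold) (*-congˡ s₀≈)

      minus : ∀ {f g h} → f ≈ g + h → g ≈ f - h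
      minus {f} {g} {h} p = trans (solve 2 (λ g h → g := (g :+ h) :- h) refl g h) (+-congʳ (sym p))

      linear : weightedℕ id ≈ v * s₂ - v * (v * s₂)
      linear = trans (minus (weightedℕ-+ suc id (λ _ → 1) (λ s → ℕₚ.+-comm 1 s))) (+-cong s₁≈ (-‿cong s₀≈))

      triangular : weightedℕ triangle ≈ s₂ - v * s₂
      triangular = trans (minus (weightedℕ-+ (triangle ∘ suc) triangle suc (λ s → ℕₚ.+-comm (suc s) (triangle s))))
        (+-congˡ (-‿cong s₁≈))

      triangular-pred : weightedℕ (λ s → triangle (s ∸ 1)) ≈ (s₂ - v * s₂) - (v * s₂ - v * (v * s₂))
      triangular-pred = trans
        (minus (weightedℕ-+ triangle (λ s → triangle (s ∸ 1)) id
          (λ { zero → ≡.refl ; (suc s) → ℕₚ.+-comm (suc s) (triangle s) })))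
        (+-cong triangular (-‿cong linear))

      -- The values of `step 0` and `step 1`, from `N₁ s 0 = s + 1`, `N₂ s 0 = triangle s`,
      -- `N₁ s 1 = s` and `N₂ s 1 = (s + 1) + triangle (s ∸ 1)`.
      Q₀ Q₁ : 𝕊
      Q₀ = y * (x * (v * s₂) + x * (x * (s₂ - v * s₂)))
      Q₁ = y * (x * (v * s₂ - v * (v * s₂)) + x * (x * (v * s₂ + ((s₂ - v * s₂) - (v * s₂ - v * (v * s₂))))))

      a-equation : a ≈ 1ₛ + Q₀
      a-equation = trans E#-zero (+-congˡ (*-congˡ (+-cong (*-congˡ s₁≈) (*-congˡ (*-congˡ triangular)))))

      b-equation : w * a ≈ Q₁
      b-equation = trans w*a (trans (E#-suc 0) (*-congˡ (+-cong (*-congˡ linear) (*-congˡ (*-congˡ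
        (trans (weightedℕ-+ (λ s → N₂ s 1) suc (λ s → triangle (s ∸ 1)) (λ _ → ≡.refl)) (+-cong s₁≈ triangular-pred)))))))

    -- Between the target ranks 0 and 1 the kernels are shifts of each other except for `adjacent`,
    -- which is 0 at rank 0 and `s + 1` at rank 1. Subtracting `w` times the equation for `a` from
    -- the one for `w * a` leaves only that part, `y x^2 s₁`, and `s₁ = v s₂`.
    w-equation : w ≈ y * x * x * v * s₂
    w-equation = begin
      w                    ≈⟨ solve 2 (λ w p → w := w :* (:1 :+ p) :- w :* p) refl w Q₀ ⟩
      w * (1ₛ + Q₀) - w * Q₀ ≈⟨ +-congʳ (*-congˡ (sym a-equation)) ⟩
      w * a - w * Q₀        ≈⟨ +-congʳ b-equation ⟩
      Q₁ - w * Q₀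
        ≈⟨ solve 4 (λ x y w s → let v = :1 :- w in
             y :* (x :* (v :* s :- v :* (v :* s)) :+ x :* (x :* (v :* s :+ ((s :- v :* s) :- (v :* s :- v :* (v :* s))))))
               :- w :* (y :* (x :* (v :* s) :+ x :* (x :* (s :- v :* s))))
             := y :* x :* x :* v :* s) refl x y w s₂ ⟩
      y * x * x * v * s₂ ∎

    yx²a≈ : y * x * x * a ≈ w * v * v
    yx²a≈ = begin
      y * x * x * a                        ≈⟨ *-congˡ a≈ ⟩
      y * x * x * (v * (v * (v * s₂)))
        ≈⟨ solve 4 (λ x y v s → y :* x :* x :* (v :* (v :* (v :* s))) := y :* x :* x :* v :* s :* v :* v) refl x y v s₂ ⟩
      y * x * x * v * s₂ * v * v           ≈⟨ *-congʳ (*-congʳ (sym w-equation)) ⟩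
      w * v * v ∎

    xva≈ : x * v * a ≈ w * v + x * (1ₛ - w + w * w)
    xva≈ = begin
      x * v * a                    ≈⟨ *-congˡ a-equation ⟩
      x * v * (1ₛ + Q₀)
        ≈⟨ solve 4 (λ x y w s → let v = :1 :- w in
             x :* v :* (:1 :+ y :* (x :* (v :* s) :+ x :* (x :* (s :- v :* s))))
             := x :* v :+ y :* x :* x :* v :* s :* (v :+ x :* w)) refl x y w s₂ ⟩
      x * v + y * x * x * v * s₂ * (v + x * w)   ≈⟨ +-congˡ (*-congʳ (sym w-equation)) ⟩
      x * v + w * (v + x * w)
        ≈⟨ solve 2 (λ x w → let v = :1 :- w in x :* v :+ w :* (v :+ x :* w) := w :* v :+ x :* (:1 :- w :+ w :* w)) refl x w ⟩
      w * v + x * (1ₛ - w + w * w) ∎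

  -- The quartic equation

  z^ : ℕ → 𝕊
  z^ zero    = 1ₛ
  z^ (suc s) = z * z^ s

  -- A Kronecker delta times `c`; the recursion on both indices mirrors repeated multiplication by
  -- `z`.
  select : ℕ → ℕ → ℤ → ℤ
  select zero    zero    c = c
  select zero    (suc t) c = + 0
  select (suc s) zero    c = + 0
  select (suc s) (suc t) c = select s t c

  coeff-z^ : ∀ r s n m t → coeff (z^ s * E# r) n m t ≡ select s t (+ count n m r)
  coeff-z^ r zero    n m zero    = at-coeff (*-identityˡ (E# r)) n m 0
  coeff-z^ r zero    n m (suc t) = at-coeff (*-identityˡ (E# r)) n m (suc t)
  coeff-z^ r (suc s) n m t       = ≡.trans (at-coeff (*-assoc z (z^ s) (E# r)) n m t)
    (≡.trans (Z⊛ (coeff (z^ s * E# r)) n m t) (shifted t))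
    where
    shifted : ∀ t → shiftZ (coeff (z^ s * E# r)) n m t ≡ select (suc s) t (+ count n m r)
    shifted zero    = ≡.refl
    shifted (suc t) = coeff-z^ r s n m t

  sumTo-select : ∀ n t (g : ℕ → ℤ) → (∀ s → n ℕ.< s → g s ≡ + 0) → sumTo n (λ s → select s t (g s)) ≡ g t
  sumTo-select zero    zero    g late = ≡.refl
  sumTo-select zero    (suc t) g late = ≡.sym (late (suc t) (s≤s z≤n))
  sumTo-select (suc n) zero    g late = ≡.trans (≡.cong (λ u → g 0 ℤ.+ u) (sumTo-zero n _ λ _ _ → ≡.refl)) (ℤₚ.+-identityʳ _)
  sumTo-select (suc n) (suc t) g late = ≡.trans (ℤₚ.+-identityˡ _)
    (sumTo-select n t (g ∘ suc) λ s n<s → late (suc s) (s≤s n<s))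

  e : 𝕊
  e = series E

  e-weighted : e ≈ weighted z^
  e-weighted = pointwise λ n m t → ≡.sym (≡.trans (sumTo-cong n _ _ λ s _ → coeff-z^ s s n m t)
    (sumTo-select n t (λ s → + count n m s) λ s n<s → ≡.cong +_ (count-rank n m s n<s)))

  u : 𝕊
  u = 1ₛ - z * w

  -- Shifting the weights `z^ s` multiplies them by `z`, so one unfolding gives `e = a + w z e`.
  u*e≈a : u * e ≈ a
  u*e≈a = begin
    u * e               ≈⟨ solve 3 (λ z w e → (:1 :- z :* w) :* e := e :- w :* (z :* e)) refl z w e ⟩
    e - w * (z * e)     ≈⟨ +-congʳ e-unfold ⟩
    (a + w * (z * e)) - w * (z * e) ≈⟨ solve 2 (λ a r → (a :+ r) :- r := a) refl a (w * (z * e)) ⟩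
    a ∎
    where
    e-unfold : e ≈ a + w * (z * e)
    e-unfold = begin
      e                                  ≈⟨ e-weighted ⟩
      weighted z^                        ≈⟨ weighted-unfold z^ ⟩
      1ₛ * a + w * weighted (z^ ∘ suc)
        ≈⟨ +-cong (*-identityˡ a) (*-congˡ (total-cong λ s → *-assoc z (z^ s) (E# s))) ⟩
      a + w * total (λ s → z * (z^ s * E# s))
        ≈⟨ +-congˡ (*-congˡ (sym (total-*ˡ z (λ s → z^ s * E# s) (Summable-* z^ E#-summable)))) ⟩
      a + w * (z * weighted z^)          ≈⟨ +-congˡ (*-congˡ (*-congˡ (sym e-weighted))) ⟩
      a + w * (z * e) ∎

  u-unit : y^ 1 ∣ 1ₛ - u
  u-unit = ∣-resp (solve 2 (λ z w → z :* w := :1 :- (:1 :- z :* w)) refl z w) (∣-*ʳ z ∣w)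

  infixr 8 _^ₛ_
  _^ₛ_ : 𝕊 → ℕ → 𝕊
  f ^ₛ zero  = 1ₛ
  f ^ₛ suc n = f * f ^ₛ n

  infix 4 _represents_
  -- Links the wrapped series, on which the solver works, with the bare series of the theorem, along
  -- the syntax of an expression.
  record _represents_ (f : 𝕊) (g : FPS) : Set where
    constructor representing
    field represented : coeff f ≈ₛ g
  open _represents_ public

  eval : ∀ {n} → Polynomial n → Vec 𝕊 n → 𝕊
  eval = Solver.⟦_⟧

  -- Substitutes equal values into a large polynomial without spelling out its congruence; this is
  -- how the values of `p` and `q` enter `Hᵖ`.
  eval-cong : ∀ {n} (p : Polynomial n) {ρ σ : Vec 𝕊 n} → (∀ i → lookup ρ i ≈ lookup σ i) → eval p ρ ≈ eval p σ
  eval-cong (op [+] p q) h = +-cong (eval-cong p h) (eval-cong q h)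
  eval-cong (op [*] p q) h = *-cong (eval-cong p h) (eval-cong q h)
  eval-cong (con c)      h = refl
  eval-cong (var i)      h = h i
  eval-cong (p :^ zero)  h = refl
  eval-cong (p :^ suc k) h = *-cong (eval-cong p h) (eval-cong (p :^ k) h)
  eval-cong (:- p)       h = -‿cong (eval-cong p h)

  module _ {n} (x y z : Polynomial n) where
    private
      c : ℕ → Polynomial n
      c k = con (+ k)
    C1ᵖ C2ᵖ C3ᵖ C4ᵖ : Polynomial n
    C1ᵖ = :- (c 1 :- c 2 :* y :* x :* (c 1 :- x) :* z :+ y :* (c 1 :- x) :^ 2 :* (c 1 :- z))
    C2ᵖ = y :* ( c 2 :* x :^ 2 :* z :^ 2
         :+ x :* (c 1 :- x) :* (c 2 :* z :^ 2 :- c 6 :* z :+ c 3)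
         :+ y :* x :^ 2 :* (c 1 :- x) :^ 2 :* z :^ 2
         :+ (c 1 :- x) :^ 2 :* (c 1 :- z)
         :- y :* x :* (c 1 :- x) :^ 3 :* (c 1 :- z))
    C3ᵖ = y :* x :* ( c 2 :* y :* x :^ 2 :* (c 1 :- x) :* z :^ 3
             :+ x :* z :* (c 1 :- z) :* (c 4 :- z)
             :- c 2 :* y :* x :* (c 1 :- x) :^ 2 :* z :* (c 1 :- z)
             :- c 2 :* (c 1 :- x) :* (c 1 :- z) :^ 2)
    C4ᵖ = y :* x :^ 2 :* ( y :* x :^ 2 :* z :^ 4
                  :- y :* x :* (c 1 :- x) :* z :^ 2 :* (c 1 :- z)
                  :+ (c 1 :- z) :^ 3)

  -- x⁴ u⁴ (x v)³ P(a / u) for u = 1 - z w, written in p = y x² a and q = x v a.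
  module _ {n} (x z w p q : Polynomial n) where
    private
      1-x 1-z 1-zw d h0 h1 h2 h3 : Polynomial n
      1-x = :1 :- x
      1-z = :1 :- z
      1-zw = :1 :- z :* w
      d = x :* (:1 :- w)
      h0 = x :^ 4 :* 1-zw :^ 4 :+ 1-zw :^ 3 :* x :^ 2 :* p :* (con (+ 2) :* x :* 1-x :* z :- 1-x :^ 2 :* 1-z)
        :+ 1-zw :^ 2 :* p :^ 2 :* (x :^ 2 :* 1-x :^ 2 :* z :^ 2 :- x :* 1-x :^ 3 :* 1-z)
      h1 = :- x :^ 4 :* 1-zw :^ 3
        :+ 1-zw :^ 2 :* x :^ 2 :* p :* (con (+ 2) :* x :^ 2 :* z :^ 2 :+ x :* 1-x :* (con (+ 2) :* z :^ 2 :- con (+ 6) :* z :+ con (+ 3))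
                                   :+ 1-x :^ 2 :* 1-z)
        :+ 1-zw :* x :* p :^ 2 :* (con (+ 2) :* x :^ 2 :* 1-x :* z :^ 3 :- con (+ 2) :* x :* 1-x :^ 2 :* z :* 1-z)
      h2 = 1-zw :* x :^ 3 :* p :* (x :* z :* 1-z :* (con (+ 4) :- z) :- con (+ 2) :* 1-x :* 1-z :^ 2)
        :+ x :^ 2 :* p :^ 2 :* (x :^ 2 :* z :^ 4 :- x :* 1-x :* z :^ 2 :* 1-z)
      h3 = x :^ 4 :* p :* 1-z :^ 3
    Hᵖ : Polynomial n
    Hᵖ = h0 :* d :^ 3 :+ h1 :* d :^ 2 :* q :+ h2 :* d :* q :^ 2 :+ h3 :* q :^ 3

  C1 C2 C3 C4 : 𝕊
  C1 = eval (C1ᵖ (var (# 0)) (var (# 1)) (var (# 2))) (x ∷ y ∷ z ∷ [])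
  C2 = eval (C2ᵖ (var (# 0)) (var (# 1)) (var (# 2))) (x ∷ y ∷ z ∷ [])
  C3 = eval (C3ᵖ (var (# 0)) (var (# 1)) (var (# 2))) (x ∷ y ∷ z ∷ [])
  C4 = eval (C4ᵖ (var (# 0)) (var (# 1)) (var (# 2))) (x ∷ y ∷ z ∷ [])

  module Representation where
    infixl 6 _⊕ʳ_ _⊖ʳ_
    infixl 7 _⊛ʳ_
    infixr 8 _^ʳ_

    _⊕ʳ_ : ∀ {f g f′ g′} → f represents f′ → g represents g′ → f + g represents f′ ⊕ g′
    p ⊕ʳ q = representing λ n m t → ≡.cong₂ ℤ._+_ (represented p n m t) (represented q n m t)

    ⊝ʳ_ : ∀ {f f′} → f represents f′ → - f represents ⊝ f′
    ⊝ʳ p = representing λ n m t → ≡.cong ℤ.-_ (represented p n m t)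

    _⊖ʳ_ : ∀ {f g f′ g′} → f represents f′ → g represents g′ → f - g represents f′ ⊖ g′
    p ⊖ʳ q = representing (represented (p ⊕ʳ (⊝ʳ q)))

    _⊛ʳ_ : ∀ {f g f′ g′} → f represents f′ → g represents g′ → f * g represents f′ ⊛ g′
    _⊛ʳ_ {f} {g} {f′} {g′} p q = representing
      (at-coeff (*-cong {f} {series f′} {g} {series g′} (pointwise (represented p)) (pointwise (represented q))))

    kʳ : ∀ n → ι (+ n) represents k n
    kʳ n = representing λ _ _ _ → ≡.refl

    _^ʳ_ : ∀ {f f′} → f represents f′ → ∀ n → f ^ₛ n represents f′ ^^ n
    p ^ʳ zero  = representing λ _ _ _ → ≡.refl
    p ^ʳ suc n = representing (represented (p ⊛ʳ p ^ʳ n))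

    X′ : x represents X
    X′ = representing λ _ _ _ → ≡.refl
    Y′ : y represents Y
    Y′ = representing λ _ _ _ → ≡.refl
    Z′ : z represents Z
    Z′ = representing λ _ _ _ → ≡.refl
    E′ : e represents E
    E′ = representing λ _ _ _ → ≡.refl

    -- Their types are inferred: checking them against c1, …, c4 and P directly would unfold all products of series.
    c1ʳ = ⊝ʳ (kʳ 1 ⊖ʳ kʳ 2 ⊛ʳ Y′ ⊛ʳ X′ ⊛ʳ (kʳ 1 ⊖ʳ X′) ⊛ʳ Z′ ⊕ʳ Y′ ⊛ʳ (kʳ 1 ⊖ʳ X′) ^ʳ 2 ⊛ʳ (kʳ 1 ⊖ʳ Z′))
    c2ʳ = Y′ ⊛ʳ ( kʳ 2 ⊛ʳ X′ ^ʳ 2 ⊛ʳ Z′ ^ʳ 2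
           ⊕ʳ X′ ⊛ʳ (kʳ 1 ⊖ʳ X′) ⊛ʳ (kʳ 2 ⊛ʳ Z′ ^ʳ 2 ⊖ʳ kʳ 6 ⊛ʳ Z′ ⊕ʳ kʳ 3)
           ⊕ʳ Y′ ⊛ʳ X′ ^ʳ 2 ⊛ʳ (kʳ 1 ⊖ʳ X′) ^ʳ 2 ⊛ʳ Z′ ^ʳ 2
           ⊕ʳ (kʳ 1 ⊖ʳ X′) ^ʳ 2 ⊛ʳ (kʳ 1 ⊖ʳ Z′)
           ⊖ʳ Y′ ⊛ʳ X′ ⊛ʳ (kʳ 1 ⊖ʳ X′) ^ʳ 3 ⊛ʳ (kʳ 1 ⊖ʳ Z′))
    c3ʳ = Y′ ⊛ʳ X′ ⊛ʳ ( kʳ 2 ⊛ʳ Y′ ⊛ʳ X′ ^ʳ 2 ⊛ʳ (kʳ 1 ⊖ʳ X′) ⊛ʳ Z′ ^ʳ 3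
               ⊕ʳ X′ ⊛ʳ Z′ ⊛ʳ (kʳ 1 ⊖ʳ Z′) ⊛ʳ (kʳ 4 ⊖ʳ Z′)
               ⊖ʳ kʳ 2 ⊛ʳ Y′ ⊛ʳ X′ ⊛ʳ (kʳ 1 ⊖ʳ X′) ^ʳ 2 ⊛ʳ Z′ ⊛ʳ (kʳ 1 ⊖ʳ Z′)
               ⊖ʳ kʳ 2 ⊛ʳ (kʳ 1 ⊖ʳ X′) ⊛ʳ (kʳ 1 ⊖ʳ Z′) ^ʳ 2)
    c4ʳ = Y′ ⊛ʳ X′ ^ʳ 2 ⊛ʳ ( Y′ ⊛ʳ X′ ^ʳ 2 ⊛ʳ Z′ ^ʳ 4
                    ⊖ʳ Y′ ⊛ʳ X′ ⊛ʳ (kʳ 1 ⊖ʳ X′) ⊛ʳ Z′ ^ʳ 2 ⊛ʳ (kʳ 1 ⊖ʳ Z′)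
                    ⊕ʳ (kʳ 1 ⊖ʳ Z′) ^ʳ 3)

    c0′ : 1ₛ represents c0
    c0′ = kʳ 1
    c1′ : C1 represents c1
    c1′ = c1ʳ
    c2′ : C2 represents c2
    c2′ = c2ʳ
    c3′ : C3 represents c3
    c3′ = c3ʳ
    c4′ : C4 represents c4
    c4′ = c4ʳ
    Pʳ = c0′ ⊕ʳ c1′ ⊛ʳ E′ ⊕ʳ c2′ ⊛ʳ E′ ^ʳ 2 ⊕ʳ c3′ ⊛ʳ E′ ^ʳ 3 ⊕ʳ c4′ ⊛ʳ E′ ^ʳ 4

    represents-P : 1ₛ + C1 * e + C2 * e ^ₛ 2 + C3 * e ^ₛ 3 + C4 * e ^ₛ 4 represents P E
    represents-P = Pʳ

  open Representation

  -- Multiplied by `u^4`, the quartic becomes a polynomial in `a` in which each `y` is accompanied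
  -- by a factor `a`. Pairing them as `y a = p / x^2` leaves at most `p^2` and `a^3`, which explains
  -- the multipliers `x^4` and `(x v)^3`. With the values of `p` and `q` inserted, an identity in
  -- `x`, `z` and `w` remains.
  P-root : 1ₛ + C1 * e + C2 * e ^ₛ 2 + C3 * e ^ₛ 3 + C4 * e ^ₛ 4 ≈ 0ₛ
  P-root = cancel (begin
    x ^ₛ 4 * (x * v) ^ₛ 3 * (u ^ₛ 4 * (1ₛ + C1 * e + C2 * e ^ₛ 2 + C3 * e ^ₛ 3 + C4 * e ^ₛ 4))
      ≈⟨ solve 7 (λ m u e c1 c2 c3 c4 →
           m :* (u :^ 4 :* (:1 :+ c1 :* e :+ c2 :* e :^ 2 :+ c3 :* e :^ 3 :+ c4 :* e :^ 4))
           := m :* (u :^ 4 :+ c1 :* u :^ 3 :* (u :* e) :+ c2 :* u :^ 2 :* (u :* e) :^ 2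
                    :+ c3 :* u :* (u :* e) :^ 3 :+ c4 :* (u :* e) :^ 4))
         refl (x ^ₛ 4 * (x * v) ^ₛ 3) u e C1 C2 C3 C4 ⟩
    x ^ₛ 4 * (x * v) ^ₛ 3 * G (u * e)
      ≈⟨ *-congˡ (+-cong (+-cong (+-cong (+-congˡ (*-congˡ eq)) (*-congˡ (^-cong 2))) (*-congˡ (^-cong 3))) (*-congˡ (^-cong 4))) ⟩
    x ^ₛ 4 * (x * v) ^ₛ 3 * G a
      ≈⟨ solve 5 (λ x y z w a → let u = :1 :- z :* w in
           x :^ 4 :* (x :* (:1 :- w)) :^ 3
             :* (u :^ 4 :+ C1ᵖ x y z :* u :^ 3 :* a :+ C2ᵖ x y z :* u :^ 2 :* a :^ 2 :+ C3ᵖ x y z :* u :* a :^ 3 :+ C4ᵖ x y z :* a :^ 4)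
           := Hᵖ x z w (y :* x :* x :* a) (x :* (:1 :- w) :* a)) refl x y z w a ⟩
    H (y * x * x * a) (x * v * a)
      ≈⟨ eval-cong (Hᵖ (var (# 0)) (var (# 1)) (var (# 2)) (var (# 3)) (var (# 4)))
           {x ∷ z ∷ w ∷ y * x * x * a ∷ x * v * a ∷ []} {x ∷ z ∷ w ∷ w * v * v ∷ w * v + x * (1ₛ - w + w * w) ∷ []}
           (λ { Fin.zero → refl ; (Fin.suc Fin.zero) → refl ; (Fin.suc (Fin.suc Fin.zero)) → refl
              ; (Fin.suc (Fin.suc (Fin.suc Fin.zero))) → yx²a≈ ; (Fin.suc (Fin.suc (Fin.suc (Fin.suc Fin.zero)))) → xva≈ }) ⟩
    H (w * v * v) (w * v + x * (1ₛ - w + w * w))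
      ≈⟨ solve 3 (λ x z w → let v = :1 :- w in
           Hᵖ x z w (w :* v :* v) (w :* v :+ x :* (:1 :- w :+ w :* w)) := con (+ 0)) refl x z w ⟩
    0ₛ ∎)
    where
    G : 𝕊 → 𝕊
    G a = u ^ₛ 4 + C1 * u ^ₛ 3 * a + C2 * u ^ₛ 2 * a ^ₛ 2 + C3 * u * a ^ₛ 3 + C4 * a ^ₛ 4
    H : 𝕊 → 𝕊 → 𝕊
    H p q = eval (Hᵖ (var (# 0)) (var (# 1)) (var (# 2)) (var (# 3)) (var (# 4))) (x ∷ z ∷ w ∷ p ∷ q ∷ [])
    eq : u * e ≈ a
    eq = u*e≈a
    ^-cong : ∀ n → (u * e) ^ₛ n ≈ a ^ₛ n
    ^-cong zero    = refl
    ^-cong (suc n) = *-cong eq (^-cong n)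
    -- The multiplier is `x^7 v^3 u^4`: `x` acts as a shift, and `v` and `u` are 1 modulo `y`.
    cancel : ∀ {f} → x ^ₛ 4 * (x * v) ^ₛ 3 * (u ^ₛ 4 * f) ≈ 0ₛ → f ≈ 0ₛ
    cancel {f} p = unit-cancel u-unit (unit-cancel u-unit (unit-cancel u-unit (unit-cancel u-unit
      (unit-cancel v-unit (unit-cancel v-unit (unit-cancel v-unit
      (x-cancel (x-cancel (x-cancel (x-cancel (x-cancel (x-cancel (x-cancel (trans
        (solve 4 (λ x v u f → x :* (x :* (x :* (x :* (x :* (x :* (x :* (v :* (v :* (v :* (u :* (u :* (u :* (u :* f)))))))))))))
           := x :^ 4 :* (x :* v) :^ 3 :* (u :^ 4 :* f)) refl x v u f) p))))))))))))))

  P-vanishes : P E ≈ₛ cst (+ 0)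
  P-vanishes n m t = ≡.trans (≡.sym (represented represents-P n m t)) (at-coeff P-root n m t)

  -- Linear independence of 1, E, E², E³

  -- The series in `x` and `z` alone, the ground ring over which `w` is transcendental.
  record YFree (f : 𝕊) : Set where
    constructor y-free
    field higher-zero : ∀ n m t → coeff f n (suc m) t ≡ + 0
  open YFree

  YFree-∣ : ∀ {f} → YFree f → y^ 1 ∣ f → f ≈ 0ₛ
  YFree-∣ {f} free b = ≈0 go
    where
    go : ∀ n m t → coeff f n m t ≡ + 0
    go n zero    t = below b n 0 t (s≤s z≤n)
    go n (suc m) t = higher-zero free n m t

  YFree-ι : ∀ c → YFree (ι c)
  YFree-ι c = y-free λ { zero _ _ → ≡.refl ; (suc _) _ _ → ≡.refl }

  YFree-x : YFree x
  YFree-x = y-free λ { zero _ _ → ≡.refl ; (suc zero) _ _ → ≡.refl ; (suc (suc _)) _ _ → ≡.refl }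

  YFree-z : YFree z
  YFree-z = y-free λ { zero _ _ → ≡.refl ; (suc _) _ _ → ≡.refl }

  YFree-+ : ∀ {f g} → YFree f → YFree g → YFree (f + g)
  YFree-+ p q = y-free λ n m t → ≡.cong₂ ℤ._+_ (higher-zero p n m t) (higher-zero q n m t)

  YFree-neg : ∀ {f} → YFree f → YFree (- f)
  YFree-neg p = y-free λ n m t → ≡.cong ℤ.-_ (higher-zero p n m t)

  YFree-* : ∀ {f g} → YFree f → YFree g → YFree (f * g)
  YFree-* {f} {g} p q = y-free λ n m t →
    Σ≤-zero n _ λ a _ → Σ≤-zero (suc m) _ λ b _ → Σ≤-zero t _ λ d _ → term n m t a b d
    where
    term : ∀ n m t a b d → coeff f a b d ℤ.* coeff g (n ∸ a) (suc m ∸ b) (t ∸ d) ≡ + 0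
    term n m t a zero    d = ≡.trans (≡.cong (coeff f a 0 d ℤ.*_) (higher-zero q (n ∸ a) m (t ∸ d))) (ℤₚ.*-zeroʳ (coeff f a 0 d))
    term n m t a (suc b) d = ≡.cong (ℤ._* coeff g (n ∸ a) (m ∸ b) (t ∸ d)) (higher-zero p a b d)

  head down : 𝕊 → 𝕊
  coeff (head f) n zero    t = coeff f n 0 t
  coeff (head f) n (suc m) t = + 0
  coeff (down f) n m t = coeff f n (suc m) t

  YFree-head : ∀ f → YFree (head f)
  YFree-head f = y-free λ _ _ _ → ≡.refl

  head+down : ∀ f → f ≈ head f + y * down f
  head+down f = pointwise go
    where
    go : ∀ n m t → coeff f n m t ≡ coeff (head f + y * down f) n m t
    go n zero    t = ≡.sym (≡.trans (≡.cong (λ c → coeff f n 0 t ℤ.+ c) (Y⊛ (coeff (down f)) n 0 t)) (ℤₚ.+-identityʳ _))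
    go n (suc m) t = ≡.sym (≡.trans (≡.cong (λ c → + 0 ℤ.+ c) (Y⊛ (coeff (down f)) n (suc m) t)) (ℤₚ.+-identityˡ _))

  -- The degree in `y` bounds how often a relation can be divided by `y`; in `x` and `z` arbitrary
  -- series are allowed.
  record YDegree< (N : ℕ) (f : 𝕊) : Set where
    constructor degree-below
    field above-zero : ∀ n m t → N ℕ.≤ m → coeff f n m t ≡ + 0
  open YDegree<

  degree-0 : ∀ {f} → YDegree< 0 f → f ≈ 0ₛ
  degree-0 p = ≈0 λ n m t → above-zero p n m t z≤n

  degree-down : ∀ {N f} → YDegree< (suc N) f → YDegree< N (down f)
  degree-down p = degree-below λ n m t N≤m → above-zero p n (suc m) t (s≤s N≤m)

  degree-mono : ∀ {M N f} → M ℕ.≤ N → YDegree< M f → YDegree< N f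
  degree-mono M≤N p = degree-below λ n m t N≤m → above-zero p n m t (ℕₚ.≤-trans M≤N N≤m)

  polynomial-degree : Poly → ℕ
  polynomial-degree []                      = 0
  polynomial-degree ((c , a , b , d) ∷ ps) = suc b ⊔ polynomial-degree ps

  degree-polynomial : ∀ ps → YDegree< (polynomial-degree ps) (series ⟦ ps ⟧)
  degree-polynomial ps = degree-below (go ps)
    where
    go : ∀ ps n m t → polynomial-degree ps ℕ.≤ m → ⟦ ps ⟧ n m t ≡ + 0
    go []                     n m t _ = cst0≈0 n m t
    go ((c , a , b , d) ∷ ps) n m t N≤m = ≡.cong₂ ℤ._+_
      (monomial n (ℕₚ.≤-trans (ℕₚ.m≤m⊔n (suc b) (polynomial-degree ps)) N≤m)) (go ps n m t (ℕₚ.≤-trans (ℕₚ.m≤n⊔m (suc b) (polynomial-degree ps)) N≤m))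
      where
      monomial : ∀ n → b ℕ.< m → monoS c a b d n m t ≡ + 0
      monomial n b<m with n ≡ᵇ a | m ≡ᵇ b in eq
      ... | false | _     = ≡.refl
      ... | true  | false = ≡.refl
      ... | true  | true with ≡.refl ← ℕₚ.≡ᵇ⇒≡ m b (≡.subst T (≡.sym eq) _) with () ← ℕₚ.<-irrefl ≡.refl b<m

  -- Polynomial functions with coefficients free of `y`

  horner : List 𝕊 → 𝕊 → 𝕊
  horner []       ω = 0ₛ
  horner (c ∷ cs) ω = c + ω * horner cs ω

  -- A property of a function rather than of a list, so that a relation found at `w` can be
  -- evaluated at any other series.
  record IsPolynomial (g : 𝕊 → 𝕊) : Set where
    constructor polynomial
    field
      {coefficients} : List 𝕊
      free           : All YFree coefficients
      evaluates      : ∀ ω → g ω ≈ horner coefficients ω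

  module _ where
    private
      add : List 𝕊 → List 𝕊 → List 𝕊
      add []       ds       = ds
      add (c ∷ cs) []       = c ∷ cs
      add (c ∷ cs) (d ∷ ds) = c + d ∷ add cs ds

      mul : List 𝕊 → List 𝕊 → List 𝕊
      mul []       ds = []
      mul (c ∷ cs) ds = add (map (c *_) ds) (0ₛ ∷ mul cs ds)

      add-free : ∀ {cs ds} → All YFree cs → All YFree ds → All YFree (add cs ds)
      add-free []       qs       = qs
      add-free (p ∷ ps) []       = p ∷ ps
      add-free (p ∷ ps) (q ∷ qs) = YFree-+ p q ∷ add-free ps qs

      scale-free : ∀ {c ds} → YFree c → All YFree ds → All YFree (map (c *_) ds)
      scale-free p []       = []
      scale-free p (q ∷ qs) = YFree-* p q ∷ scale-free p qs

      mul-free : ∀ {cs ds} → All YFree cs → All YFree ds → All YFree (mul cs ds)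
      mul-free []       qs = []
      mul-free (p ∷ ps) qs = add-free (scale-free p qs) (YFree-ι (+ 0) ∷ mul-free ps qs)

      horner-add : ∀ cs ds ω → horner (add cs ds) ω ≈ horner cs ω + horner ds ω
      horner-add []       ds       ω = sym (+-identityˡ _)
      horner-add (c ∷ cs) []       ω = sym (+-identityʳ _)
      horner-add (c ∷ cs) (d ∷ ds) ω = trans (+-congˡ (*-congˡ (horner-add cs ds ω)))
        (solve 5 (λ c d ω f g → c :+ d :+ ω :* (f :+ g) := (c :+ ω :* f) :+ (d :+ ω :* g)) refl
          c d ω (horner cs ω) (horner ds ω))

      horner-scale : ∀ c ds ω → horner (map (c *_) ds) ω ≈ c * horner ds ω
      horner-scale c []       ω = sym (zeroʳ c)
      horner-scale c (d ∷ ds) ω = trans (+-congˡ (*-congˡ (horner-scale c ds ω)))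
        (solve 4 (λ c d ω f → c :* d :+ ω :* (c :* f) := c :* (d :+ ω :* f)) refl c d ω (horner ds ω))

      horner-mul : ∀ cs ds ω → horner (mul cs ds) ω ≈ horner cs ω * horner ds ω
      horner-mul []       ds ω = sym (zeroˡ _)
      horner-mul (c ∷ cs) ds ω = begin
        horner (add (map (c *_) ds) (0ₛ ∷ mul cs ds)) ω
          ≈⟨ horner-add (map (c *_) ds) (0ₛ ∷ mul cs ds) ω ⟩
        horner (map (c *_) ds) ω + (0ₛ + ω * horner (mul cs ds) ω)
          ≈⟨ +-cong (horner-scale c ds ω) (+-congˡ (*-congˡ (horner-mul cs ds ω))) ⟩
        c * horner ds ω + (0ₛ + ω * (horner cs ω * horner ds ω))
          ≈⟨ solve 4 (λ c ω f g → c :* g :+ (con (+ 0) :+ ω :* (f :* g)) := (c :+ ω :* f) :* g) refl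
               c ω (horner cs ω) (horner ds ω) ⟩
        (c + ω * horner cs ω) * horner ds ω ∎

    const-poly : ∀ {c} → YFree c → IsPolynomial (λ _ → c)
    const-poly {c} p = polynomial (p ∷ []) λ ω → solve 2 (λ c ω → c := c :+ ω :* con (+ 0)) refl c ω

    id-poly : IsPolynomial (λ ω → ω)
    id-poly = polynomial (YFree-ι (+ 0) ∷ YFree-ι (+ 1) ∷ []) λ ω →
      solve 1 (λ ω → ω := con (+ 0) :+ ω :* (:1 :+ ω :* con (+ 0))) refl ω

    +-poly : ∀ {f g} → IsPolynomial f → IsPolynomial g → IsPolynomial (λ ω → f ω + g ω)
    +-poly (polynomial {cs} p f≈) (polynomial {ds} q g≈) = polynomial (add-free p q) λ ω →
      trans (+-cong (f≈ ω) (g≈ ω)) (sym (horner-add cs ds ω))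

    *-poly : ∀ {f g} → IsPolynomial f → IsPolynomial g → IsPolynomial (λ ω → f ω * g ω)
    *-poly (polynomial {cs} p f≈) (polynomial {ds} q g≈) = polynomial (mul-free p q) λ ω →
      trans (*-cong (f≈ ω) (g≈ ω)) (sym (horner-mul cs ds ω))

    neg-poly : ∀ {f} → IsPolynomial f → IsPolynomial (λ ω → - f ω)
    neg-poly {f} (polynomial {cs} p f≈) = polynomial (scale-free (YFree-neg (YFree-ι (+ 1))) p) λ ω → begin
      - f ω                              ≈⟨ -‿cong (f≈ ω) ⟩
      - horner cs ω                      ≈⟨ solve 1 (λ h → :- h := (:- :1) :* h) refl (horner cs ω) ⟩
      (- 1ₛ) * horner cs ω                 ≈⟨ sym (horner-scale (- 1ₛ) cs ω) ⟩
      horner (map ((- 1ₛ) *_) cs) ω ∎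

  ^-poly : ∀ {f} → IsPolynomial f → ∀ n → IsPolynomial (λ ω → f ω ^ₛ n)
  ^-poly p zero    = const-poly (YFree-ι (+ 1))
  ^-poly p (suc n) = *-poly p (^-poly p n)

  -- Multiplication by `v * v` turns `w` into `y x^2 a`, a product of factors that can be cancelled.
  w-cancel : ∀ {f} → w * f ≈ 0ₛ → f ≈ 0ₛ
  w-cancel {f} p = unit-cancel a-unit (x-cancel (x-cancel (y-cancel (begin
    y * (x * (x * (a * f)))  ≈⟨ solve 4 (λ x y a f → y :* (x :* (x :* (a :* f))) := y :* x :* x :* a :* f) refl x y a f ⟩
    y * x * x * a * f        ≈⟨ *-congʳ yx²a≈ ⟩
    w * v * v * f            ≈⟨ solve 3 (λ w v f → w :* v :* v :* f := v :* v :* (w :* f)) refl w v f ⟩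
    v * v * (w * f)          ≈⟨ *-congˡ p ⟩
    v * v * 0ₛ               ≈⟨ zeroʳ (v * v) ⟩
    0ₛ ∎))))

  -- The lowest coefficient of a relation is divisible by y, hence 0, because w is.
  w-transcendental : ∀ {g} → IsPolynomial g → g w ≈ 0ₛ → ∀ ω → g ω ≈ 0ₛ
  w-transcendental (polynomial free g≈) gw≈0 ω = trans (g≈ ω) (go free (trans (sym (g≈ w)) gw≈0))
    where
    go : ∀ {cs} → All YFree cs → horner cs w ≈ 0ₛ → horner cs ω ≈ 0ₛ
    go {[]}     []       p = refl
    go {c ∷ cs} (q ∷ qs) p = begin
      c + ω * horner cs ω ≈⟨ +-cong c≈0 (*-congˡ (go qs (w-cancel w*rest≈0))) ⟩
      0ₛ + ω * 0ₛ         ≈⟨ solve 1 (λ ω → con (+ 0) :+ ω :* con (+ 0) := con (+ 0)) refl ω ⟩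
      0ₛ ∎
      where
      c≈0 : c ≈ 0ₛ
      c≈0 = YFree-∣ q (∣-resp
        (trans (solve 2 (λ c r → c :+ r :- r := c) refl c (w * horner cs w)) refl)
        (∣-+ (∣-resp (sym p) ∣-0ₛ) (∣-neg (∣-*ˡ (horner cs w) ∣w))))
      w*rest≈0 : w * horner cs w ≈ 0ₛ
      w*rest≈0 = trans (sym (+-identityˡ _)) (trans (+-congʳ (sym c≈0)) p)

  -- The parametrisation of `y` and `e` by `w`

  numeratorʸ numeratorᵉ denominatorᵉ : 𝕊 → 𝕊
  -- y = numeratorʸ / (x numeratorᵉ) and e = numeratorᵉ / denominatorᵉ as rational functions of x, z and w.
  numeratorʸ ω   = ω * ((1ₛ - ω) * ((1ₛ - ω) * (1ₛ - ω)))
  numeratorᵉ ω   = ω * (1ₛ - ω) + x * (1ₛ - ω + ω * ω)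
  denominatorᵉ ω = x * ((1ₛ - ω) * (1ₛ - z * ω))

  y-equation : y * (x * numeratorᵉ w) ≈ numeratorʸ w
  y-equation = begin
    y * (x * numeratorᵉ w)  ≈⟨ *-congˡ (*-congˡ (sym xva≈)) ⟩
    y * (x * (x * v * a))   ≈⟨ solve 4 (λ x y v a → y :* (x :* (x :* v :* a)) := v :* (y :* x :* x :* a)) refl x y v a ⟩
    v * (y * x * x * a)     ≈⟨ *-congˡ yx²a≈ ⟩
    v * (w * v * v)         ≈⟨ solve 2 (λ w v → v :* (w :* v :* v) := w :* (v :* (v :* v))) refl w v ⟩
    numeratorʸ w ∎

  e-equation : denominatorᵉ w * e ≈ numeratorᵉ w
  e-equation = begin
    x * (v * u) * e  ≈⟨ solve 4 (λ x v u e → x :* (v :* u) :* e := x :* v :* (u :* e)) refl x v u e ⟩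
    x * v * (u * e)  ≈⟨ *-congˡ u*e≈a ⟩
    x * v * a        ≈⟨ xva≈ ⟩
    numeratorᵉ w ∎

  -- For f of degree less than N in y, the polynomial (x numeratorᵉ)^N f in w.
  homogenise : ℕ → 𝕊 → 𝕊 → 𝕊
  homogenise zero    f ω = 0ₛ
  homogenise (suc N) f ω = head f * (x * numeratorᵉ ω) ^ₛ suc N + numeratorʸ ω * homogenise N (down f) ω

  -- Each factor `y` supplied by `head+down` absorbs one factor `x * numeratorᵉ w` and becomes
  -- `numeratorʸ w`.
  homogenise-at-w : ∀ N f → YDegree< N f → homogenise N f w ≈ (x * numeratorᵉ w) ^ₛ N * f
  homogenise-at-w zero    f p = sym (trans (*-congˡ (degree-0 p)) (zeroʳ 1ₛ))
  homogenise-at-w (suc N) f p = begin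
    head f * (b * b ^ₛ N) + numeratorʸ w * homogenise N (down f) w
      ≈⟨ +-congˡ (*-cong (sym y-equation) (homogenise-at-w N (down f) (degree-down p))) ⟩
    head f * (b * b ^ₛ N) + y * b * (b ^ₛ N * down f)
      ≈⟨ solve 5 (λ h b c y d → h :* (b :* c) :+ y :* b :* (c :* d) := b :* c :* (h :+ y :* d)) refl
           (head f) b (b ^ₛ N) y (down f) ⟩
    b * b ^ₛ N * (head f + y * down f)
      ≈⟨ *-congˡ (sym (head+down f)) ⟩
    b * b ^ₛ N * f ∎
    where
    b : 𝕊
    b = x * numeratorᵉ w

  1-poly : IsPolynomial (λ ω → 1ₛ - ω)
  1-poly = +-poly (const-poly (YFree-ι (+ 1))) (neg-poly id-poly)

  numeratorʸ-poly : IsPolynomial numeratorʸ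
  numeratorʸ-poly = *-poly id-poly (*-poly 1-poly (*-poly 1-poly 1-poly))

  numeratorᵉ-poly : IsPolynomial numeratorᵉ
  numeratorᵉ-poly = +-poly (*-poly id-poly 1-poly) (*-poly (const-poly YFree-x) (+-poly 1-poly (*-poly id-poly id-poly)))

  denominatorᵉ-poly : IsPolynomial denominatorᵉ
  denominatorᵉ-poly = *-poly (const-poly YFree-x) (*-poly 1-poly
    (+-poly (const-poly (YFree-ι (+ 1))) (neg-poly (*-poly (const-poly YFree-z) id-poly))))

  homogenise-poly : ∀ N f → IsPolynomial (homogenise N f)
  homogenise-poly zero    f = const-poly (YFree-ι (+ 0))
  homogenise-poly (suc N) f = +-poly
    (*-poly (const-poly (YFree-head f)) (^-poly (*-poly (const-poly YFree-x) numeratorᵉ-poly) (suc N)))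
    (*-poly numeratorʸ-poly (homogenise-poly N (down f)))

  -- Orders at the place `ω = 1`

  Regular : 𝕊 → Set
  Regular c = ∀ {k f} → y^ k ∣ c * f → y^ k ∣ f

  x-regular : Regular x
  x-regular {f = f} p = vanishing λ n m t m<k → ≡.trans (≡.sym (X⊛ (coeff f) (suc n) m t)) (below p (suc n) m t m<k)

  -- Below the given order in `y`, each coefficient of `f` equals the one at the preceding power of
  -- `z`, and at the first power it is 0.
  1-z-regular : Regular (1ₛ - z)
  1-z-regular {k} {f} p = vanishing go
    where
    difference : (1ₛ - z) * f ≈ f - z * f
    difference = solve 2 (λ z f → (:1 :- z) :* f := f :- z :* f) refl z f
    go : ∀ n m t → m ℕ.< k → coeff f n m t ≡ + 0
    go n m t m<k = ≡.trans (ℤₚ.i-j≡0⇒i≡j (coeff f n m t) (coeff (z * f) n m t)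
        (≡.trans (≡.sym (at-coeff difference n m t)) (below p n m t m<k)))
      (≡.trans (Z⊛ (coeff f) n m t) (shifted t))
      where
      shifted : ∀ t → shiftZ (coeff f) n m t ≡ + 0
      shifted zero    = ≡.refl
      shifted (suc t) = go n m t m<k

  y-divide : ∀ {k f} → y^ suc k ∣ y * f → y^ k ∣ f
  y-divide {f = f} p = vanishing λ n m t m<k → ≡.trans (≡.sym (Y⊛ (coeff f) n (suc m) t)) (below p n (suc m) t (s≤s m<k))

  regular-* : ∀ {c d} → Regular c → Regular d → Regular (c * d)
  regular-* {c} {d} rc rd {f = f} p = rd (rc (∣-resp (*-assoc c d f) p))

  regular-resp : ∀ {c d} → c ≈ d → Regular c → Regular d
  regular-resp c≈d rc p = rc (∣-resp (*-congʳ (sym c≈d)) p)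

  regular-1 : Regular 1ₛ
  regular-1 {f = f} p = ∣-resp (*-identityˡ f) p

  regular-^ : ∀ {c} → Regular c → ∀ n → Regular (c ^ₛ n)
  regular-^ rc zero    = regular-1
  regular-^ rc (suc n) = regular-* rc (regular-^ rc n)

  -- Regularity depends only on the series modulo `y`: once `y^j` divides `f`, the next power
  -- divides `y * (r * f)`, hence `c * f`, hence `f`.
  regular-perturb : ∀ {c} r → Regular c → Regular (c + y * r)
  regular-perturb {c} r rc {k} {f} p = go k ℕₚ.≤-refl
    where
    go : ∀ j → j ℕ.≤ k → y^ j ∣ f
    go zero    _   = ∣-zero
    go (suc j) j<k = rc (∣-resp
      (solve 4 (λ c y r f → (c :+ y :* r) :* f :- y :* (r :* f) := c :* f) refl c y r f)
      (∣-+ (∣-mono j<k p) (∣-neg (∣-* y∣y (∣-*ʳ r (go j (ℕₚ.<⇒≤ j<k)))))))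

  -- The place w = 1, where y has a triple zero and e a simple pole, is reached by substituting 1 - y for w.
  η : 𝕊
  η = 1ₛ - y

  -- The value at `ω = 1` is `x`, so no zero of the numerator compensates the pole of `e`.
  numeratorᵉ-regular : Regular (numeratorᵉ η)
  numeratorᵉ-regular = regular-resp
    (solve 2 (λ x y → let η = :1 :- y in
        x :+ y :* (:1 :- y :- x :+ x :* y) := η :* (:1 :- η) :+ x :* (:1 :- η :+ η :* η)) refl x y)
    (regular-perturb (1ₛ - y - x + x * y) x-regular)

  x*numeratorᵉ-regular : Regular (x * numeratorᵉ η)
  x*numeratorᵉ-regular = regular-* x-regular numeratorᵉ-regular

  private
    δ : 𝕊
    δ = x * ((1ₛ - z) + y * z)

  denominatorᵉ≈ : denominatorᵉ η ≈ y * δ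
  denominatorᵉ≈ = solve 3 (λ x y z → let η = :1 :- y in
    x :* ((:1 :- η) :* (:1 :- z :* η)) := y :* (x :* ((:1 :- z) :+ y :* z))) refl x y z

  denominatorᵉ-∣ : y^ 1 ∣ denominatorᵉ η
  denominatorᵉ-∣ = ∣-resp (sym denominatorᵉ≈) (∣-*ˡ δ y∣y)

  -- The zero of the denominator is simple: its cofactor `δ` is `x * (1ₛ - z)` modulo `y`, hence
  -- regular.
  denominatorᵉ-divide : ∀ {k f} → y^ suc k ∣ denominatorᵉ η * f → y^ k ∣ f
  denominatorᵉ-divide {f = f} p = regular-* x-regular (regular-perturb z 1-z-regular)
    (y-divide (∣-resp (trans (*-congʳ denominatorᵉ≈) (*-assoc y δ f)) p))

  numeratorʸ-∣ : y^ 3 ∣ numeratorʸ η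
  numeratorʸ-∣ = ∣-*ʳ η (∣-* (∣y) (∣-* ∣y ∣y))
    where
    ∣y : y^ 1 ∣ 1ₛ - η
    ∣y = ∣-resp (solve 1 (λ y → y := :1 :- (:1 :- y)) refl y) y∣y

  -- Modulo `y` only the term with `head f` survives, and its other factor is regular; so `y`
  -- divides `head f`, which is free of `y`.
  homogenise-head : ∀ N f → y^ 1 ∣ homogenise (suc N) f η → head f ≈ 0ₛ
  homogenise-head N f p = YFree-∣ (YFree-head f) (regular-^ x*numeratorᵉ-regular (suc N)
    (∣-resp (solve 3 (λ h b r → h :* b :+ r :- r := b :* h) refl (head f) ((x * numeratorᵉ η) ^ₛ suc N) rest)
      (∣-+ p (∣-neg (∣-mono (s≤s z≤n) (∣-*ˡ (homogenise N (down f) η) numeratorʸ-∣))))))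
    where
    rest : 𝕊
    rest = numeratorʸ η * homogenise N (down f) η

  homogenise-∣ : ∀ N f → head f ≈ 0ₛ → y^ 3 ∣ homogenise (suc N) f η
  homogenise-∣ N f h≈0 = ∣-resp
    (trans (solve 2 (λ b r → r := con (+ 0) :* b :+ r) refl ((x * numeratorᵉ η) ^ₛ suc N) rest) (+-congʳ (*-congʳ (sym h≈0))))
    (∣-*ˡ (homogenise N (down f) η) numeratorʸ-∣)
    where
    rest : 𝕊
    rest = numeratorʸ η * homogenise N (down f) η

  -- Comparing orders in a cubic relation

  cubic : 𝕊 → 𝕊 → 𝕊 → 𝕊 → 𝕊
  cubic q₀ q₁ q₂ q₃ = q₀ + q₁ * e + q₂ * e ^ₛ 2 + q₃ * e ^ₛ 3

  -- denominatorᵉ³ (x numeratorᵉ)^N (q₀ + q₁ e + q₂ e² + q₃ e³) as a polynomial in w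
  cleared : ℕ → 𝕊 → 𝕊 → 𝕊 → 𝕊 → 𝕊 → 𝕊
  cleared N q₀ q₁ q₂ q₃ ω = d * (d * (d * h q₀ + n * h q₁) + n * n * h q₂) + n * n * n * h q₃
    where
    d n : 𝕊
    d = denominatorᵉ ω
    n = numeratorᵉ ω
    h : 𝕊 → 𝕊
    h q = homogenise N q ω

  cleared-poly : ∀ N q₀ q₁ q₂ q₃ → IsPolynomial (cleared N q₀ q₁ q₂ q₃)
  cleared-poly N q₀ q₁ q₂ q₃ = +-poly
    (*-poly d (+-poly (*-poly d (+-poly (*-poly d (h q₀)) (*-poly n (h q₁)))) (*-poly (*-poly n n) (h q₂))))
    (*-poly (*-poly (*-poly n n) n) (h q₃))
    where
    d = denominatorᵉ-poly
    n = numeratorᵉ-poly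
    h = homogenise-poly N

  cleared-at-w : ∀ N q₀ q₁ q₂ q₃ → YDegree< N q₀ → YDegree< N q₁ → YDegree< N q₂ → YDegree< N q₃ →
    cubic q₀ q₁ q₂ q₃ ≈ 0ₛ → cleared N q₀ q₁ q₂ q₃ w ≈ 0ₛ
  cleared-at-w N q₀ q₁ q₂ q₃ b₀ b₁ b₂ b₃ relation = begin
    cleared N q₀ q₁ q₂ q₃ w
      ≈⟨ +-cong (*-congˡ (+-cong (*-congˡ (+-cong (*-congˡ (at-w q₀ b₀)) (*-cong n≈ (at-w q₁ b₁))))
                                 (*-cong (*-cong n≈ n≈) (at-w q₂ b₂))))
                (*-cong (*-cong (*-cong n≈ n≈) n≈) (at-w q₃ b₃)) ⟩
    d * (d * (d * (m * q₀) + d * e * (m * q₁)) + d * e * (d * e) * (m * q₂)) + d * e * (d * e) * (d * e) * (m * q₃)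
      ≈⟨ solve 7 (λ d e m q₀ q₁ q₂ q₃ →
           d :* (d :* (d :* (m :* q₀) :+ d :* e :* (m :* q₁)) :+ d :* e :* (d :* e) :* (m :* q₂))
             :+ d :* e :* (d :* e) :* (d :* e) :* (m :* q₃)
           := d :* d :* d :* m :* (q₀ :+ q₁ :* e :+ q₂ :* e :^ 2 :+ q₃ :* e :^ 3)) refl d e m q₀ q₁ q₂ q₃ ⟩
    d * d * d * m * cubic q₀ q₁ q₂ q₃ ≈⟨ *-congˡ relation ⟩
    d * d * d * m * 0ₛ                ≈⟨ zeroʳ (d * d * d * m) ⟩
    0ₛ ∎
    where
    d m : 𝕊
    d = denominatorᵉ w
    m = (x * numeratorᵉ w) ^ₛ N
    n≈ : numeratorᵉ w ≈ d * e
    n≈ = sym e-equation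
    at-w : ∀ q → YDegree< N q → homogenise N q w ≈ m * q
    at-w = homogenise-at-w N

  AllZero : 𝕊 → 𝕊 → 𝕊 → 𝕊 → Set
  AllZero q₀ q₁ q₂ q₃ = (q₀ ≈ 0ₛ) × (q₁ ≈ 0ₛ) × (q₂ ≈ 0ₛ) × (q₃ ≈ 0ₛ)

  -- A vanishing head makes its term divisible by `y^3`, by the triple zero of `numeratorʸ`. Each
  -- division by the simple zero `d` costs one power: `y^2` remains for the quadratic part and `y`
  -- for the linear one, just enough to read off `head₂` and `head₁`.
  heads-vanish : ∀ N q₀ q₁ q₂ q₃ → YDegree< (suc N) q₀ → YDegree< (suc N) q₁ → YDegree< (suc N) q₂ → YDegree< (suc N) q₃ →
    cubic q₀ q₁ q₂ q₃ ≈ 0ₛ → AllZero (head q₀) (head q₁) (head q₂) (head q₃)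
  heads-vanish N q₀ q₁ q₂ q₃ b₀ b₁ b₂ b₃ relation = head₀ , head₁ , head₂ , head₃
    where
    d n h₀ h₁ h₂ h₃ : 𝕊
    d = denominatorᵉ η
    n = numeratorᵉ η
    h₀ = homogenise (suc N) q₀ η
    h₁ = homogenise (suc N) q₁ η
    h₂ = homogenise (suc N) q₂ η
    h₃ = homogenise (suc N) q₃ η

    vanishing-sum : ∀ k → y^ k ∣ d * (d * (d * h₀ + n * h₁) + n * n * h₂) + n * n * n * h₃
    vanishing-sum k = ∣-resp
      (sym (w-transcendental (cleared-poly (suc N) q₀ q₁ q₂ q₃) (cleared-at-w (suc N) q₀ q₁ q₂ q₃ b₀ b₁ b₂ b₃ relation) η)) ∣-0ₛ

    dropˡ : ∀ {k f g} → y^ k ∣ f + g → y^ k ∣ f → y^ k ∣ g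
    dropˡ {f = f} {g} p q = ∣-resp (solve 2 (λ f g → f :+ g :- f := g) refl f g) (∣-+ p (∣-neg q))

    dropʳ : ∀ {k f g} → y^ k ∣ f + g → y^ k ∣ g → y^ k ∣ f
    dropʳ {f = f} {g} p q = ∣-resp (solve 2 (λ f g → f :+ g :- g := f) refl f g) (∣-+ p (∣-neg q))

    nr : Regular n
    nr = numeratorᵉ-regular

    head₃ : head q₃ ≈ 0ₛ
    head₃ = homogenise-head N q₃ (regular-* (regular-* nr nr) nr
      (dropˡ {f = d * (d * (d * h₀ + n * h₁) + n * n * h₂)} (vanishing-sum 1) (∣-*ˡ _ denominatorᵉ-∣)))

    quadratic-∣ : y^ 2 ∣ d * (d * h₀ + n * h₁) + n * n * h₂
    quadratic-∣ = denominatorᵉ-divide (dropʳ (vanishing-sum 3) (∣-*ʳ (n * n * n) (homogenise-∣ N q₃ head₃)))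

    head₂ : head q₂ ≈ 0ₛ
    head₂ = homogenise-head N q₂ (regular-* nr nr
      (dropˡ {f = d * (d * h₀ + n * h₁)} (∣-mono (s≤s z≤n) quadratic-∣) (∣-*ˡ _ denominatorᵉ-∣)))

    linear-∣ : y^ 1 ∣ d * h₀ + n * h₁
    linear-∣ = denominatorᵉ-divide (dropʳ quadratic-∣ (∣-*ʳ (n * n) (∣-mono (s≤s (s≤s z≤n)) (homogenise-∣ N q₂ head₂))))

    head₁ : head q₁ ≈ 0ₛ
    head₁ = homogenise-head N q₁ (nr (dropˡ {f = d * h₀} linear-∣ (∣-*ˡ h₀ denominatorᵉ-∣)))

    ∣q : ∀ q → head q ≈ 0ₛ → y^ 1 ∣ q
    ∣q q p = ∣-resp (sym (head+down q)) (∣-+ (∣-resp (sym p) ∣-0ₛ) (∣-*ˡ (down q) y∣y))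

    ∣head : ∀ q → y^ 1 ∣ q → y^ 1 ∣ head q
    ∣head q p = dropʳ (∣-resp (head+down q) p) (∣-*ˡ (down q) y∣y)

    -- The linear part is only known to be divisible by `y`, and `d * h₀` is so in any case, so the
    -- place gives no information on `q₀`. The original relation decides: modulo `y` it has become
    -- `q₀`.
    head₀ : head q₀ ≈ 0ₛ
    head₀ = YFree-∣ (YFree-head q₀) (∣head q₀ (dropʳ (dropʳ (dropʳ (∣-resp (sym relation) ∣-0ₛ)
      (∣-*ˡ (e ^ₛ 3) (∣q q₃ head₃))) (∣-*ˡ (e ^ₛ 2) (∣q q₂ head₂))) (∣-*ˡ e (∣q q₁ head₁))))

  cubic-independent : ∀ N q₀ q₁ q₂ q₃ → YDegree< N q₀ → YDegree< N q₁ → YDegree< N q₂ → YDegree< N q₃ →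
    cubic q₀ q₁ q₂ q₃ ≈ 0ₛ → AllZero q₀ q₁ q₂ q₃
  cubic-independent zero    q₀ q₁ q₂ q₃ b₀ b₁ b₂ b₃ relation = degree-0 b₀ , degree-0 b₁ , degree-0 b₂ , degree-0 b₃
  cubic-independent (suc N) q₀ q₁ q₂ q₃ b₀ b₁ b₂ b₃ relation =
    conclude q₀ h₀ (proj₁ downs) , conclude q₁ h₁ (proj₁ (proj₂ downs)) ,
    conclude q₂ h₂ (proj₁ (proj₂ (proj₂ downs))) , conclude q₃ h₃ (proj₂ (proj₂ (proj₂ downs)))
    where
    heads : AllZero (head q₀) (head q₁) (head q₂) (head q₃)
    heads = heads-vanish N q₀ q₁ q₂ q₃ b₀ b₁ b₂ b₃ relation
    h₀ = proj₁ heads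
    h₁ = proj₁ (proj₂ heads)
    h₂ = proj₁ (proj₂ (proj₂ heads))
    h₃ = proj₂ (proj₂ (proj₂ heads))

    shifted : ∀ q → head q ≈ 0ₛ → q ≈ y * down q
    shifted q p = trans (head+down q) (trans (+-congʳ p) (+-identityˡ _))

    conclude : ∀ q → head q ≈ 0ₛ → down q ≈ 0ₛ → q ≈ 0ₛ
    conclude q p p′ = trans (shifted q p) (trans (*-congˡ p′) (zeroʳ y))

    down-relation : cubic (down q₀) (down q₁) (down q₂) (down q₃) ≈ 0ₛ
    down-relation = y-cancel (begin
      y * cubic (down q₀) (down q₁) (down q₂) (down q₃)
        ≈⟨ solve 6 (λ y e a b c d → y :* (a :+ b :* e :+ c :* e :^ 2 :+ d :* e :^ 3)
             := y :* a :+ y :* b :* e :+ y :* c :* e :^ 2 :+ y :* d :* e :^ 3)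
             refl y e (down q₀) (down q₁) (down q₂) (down q₃) ⟩
      cubic (y * down q₀) (y * down q₁) (y * down q₂) (y * down q₃)
        ≈⟨ sym (+-cong (+-cong (+-cong (shifted q₀ h₀) (*-congʳ (shifted q₁ h₁))) (*-congʳ (shifted q₂ h₂))) (*-congʳ (shifted q₃ h₃))) ⟩
      cubic q₀ q₁ q₂ q₃ ≈⟨ relation ⟩
      0ₛ ∎)

    downs : AllZero (down q₀) (down q₁) (down q₂) (down q₃)
    downs = cubic-independent N (down q₀) (down q₁) (down q₂) (down q₃)
      (degree-down b₀) (degree-down b₁) (degree-down b₂) (degree-down b₃) down-relation

  ⟦⟧ʳ : ∀ q → series ⟦ q ⟧ represents ⟦ q ⟧
  ⟦⟧ʳ q = representing λ _ _ _ → ≡.refl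

  cubicʳ = λ q0 q1 q2 q3 → ⟦⟧ʳ q0 ⊕ʳ ⟦⟧ʳ q1 ⊛ʳ E′ ⊕ʳ ⟦⟧ʳ q2 ⊛ʳ E′ ^ʳ 2 ⊕ʳ ⟦⟧ʳ q3 ⊛ʳ E′ ^ʳ 3

  -- A polynomial of degree at most 3 over the field of rational functions with root `E` gives such
  -- a relation once denominators are cleared, so this is the minimality of the quartic.
  polynomials-independent : ∀ q0 q1 q2 q3 → ⟦ q0 ⟧ ⊕ ⟦ q1 ⟧ ⊛ E ⊕ ⟦ q2 ⟧ ⊛ E ^^ 2 ⊕ ⟦ q3 ⟧ ⊛ E ^^ 3 ≈ₛ cst (+ 0) →
    AllZero (series ⟦ q0 ⟧) (series ⟦ q1 ⟧) (series ⟦ q2 ⟧) (series ⟦ q3 ⟧)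
  polynomials-independent q0 q1 q2 q3 relation = cubic-independent N _ _ _ _
    (degree-mono (ℕₚ.≤-trans (ℕₚ.m≤m⊔n d0 d1) (ℕₚ.m≤m⊔n (d0 ⊔ d1) (d2 ⊔ d3))) (degree-polynomial q0))
    (degree-mono (ℕₚ.≤-trans (ℕₚ.m≤n⊔m d0 d1) (ℕₚ.m≤m⊔n (d0 ⊔ d1) (d2 ⊔ d3))) (degree-polynomial q1))
    (degree-mono (ℕₚ.≤-trans (ℕₚ.m≤m⊔n d2 d3) (ℕₚ.m≤n⊔m (d0 ⊔ d1) (d2 ⊔ d3))) (degree-polynomial q2))
    (degree-mono (ℕₚ.≤-trans (ℕₚ.m≤n⊔m d2 d3) (ℕₚ.m≤n⊔m (d0 ⊔ d1) (d2 ⊔ d3))) (degree-polynomial q3))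
    (pointwise λ n m t → ≡.trans (represented (cubicʳ q0 q1 q2 q3) n m t) (relation n m t))
    where
    d0 d1 d2 d3 N : ℕ
    d0 = polynomial-degree q0
    d1 = polynomial-degree q1
    d2 = polynomial-degree q2
    d3 = polynomial-degree q3
    N = (d0 ⊔ d1) ⊔ (d2 ⊔ d3)

open GeneratingFunction using (P-vanishes; polynomials-independent; at-coeff)

theorem4p3 : (P E ≈ₛ cst (+ 0))
    × (∀ (q0 q1 q2 q3 : Poly)
    → (⟦ q0 ⟧ ⊕ ⟦ q1 ⟧ ⊛ E ⊕ ⟦ q2 ⟧ ⊛ E ^^ 2 ⊕ ⟦ q3 ⟧ ⊛ E ^^ 3) ≈ₛ cst (+ 0)
    → (⟦ q0 ⟧ ≈ₛ cst (+ 0)) × (⟦ q1 ⟧ ≈ₛ cst (+ 0))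
    × (⟦ q2 ⟧ ≈ₛ cst (+ 0)) × (⟦ q3 ⟧ ≈ₛ cst (+ 0)))
theorem4p3 = P-vanishes , λ q0 q1 q2 q3 relation →
  let z0 , z1 , z2 , z3 = polynomials-independent q0 q1 q2 q3 relation
  in at-coeff z0 , at-coeff z1 , at-coeff z2 , at-coeff z3
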